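{- Let $G$ be a simple graph with vertex set $[\ell]=\{1,\dots,\ell\}$, let $\mathcal{A}=\mathcal{A}_G$ be the graphic arrangement of $G$ in $\mathbb{K}^\ell$, and let $H=H_{x_i-x_j}=\{x_i=x_j\}\in\mathcal{A}$, where $\{i,j\}\in E(G)$. Let $W$ be the set of vertices which are adjacent to both $i$ and $j$ in $G$, and for $k\in W$ let $y_k=x_k-x_i$ (regarded as an element of $S/(x_i-x_j)$). Then $$J_{\mathcal{A}}^H=\bigcap_{\{u,v\}\subset W,\ \{u,v\}\notin E(G)}(y_u,y_v),$$ where the intersection is over two-element subsets $\{u,v\}$ of $W$.
   Context: Let $\mathbb{K}$ be a field, $V=\mathbb{K}^\ell$ and $S=\mathbb{K}[x_1,\dots,x_\ell]$, where $x_1,\dots,x_\ell$ are the coordinate functions. For a simple graph $G$ with vertex set $[\ell]$ and edge set $E(G)$, the graphic arrangement is $\mathcal{A}_G=\{\{x_u=x_v\}\mid\{u,v\}\in E(G)\}$, a finite set of linear hyperplanes in $V$. For a finite set $\mathcal{A}$ of linear hyperplanes in $V$, $\alpha_H\in V^*$ denotes a defining linear form of $H\in\mathcal{A}$, and $Q(\mathcal{A})=\prod_{H\in\mathcal{A}}\alpha_H$. Let $\Omega_V^1=\bigoplus_i S\,dx_i$, $\Omega_V^2=\bigwedge^2\Omega_V^1$, and for $\alpha=\sum c_ix_i$ let $d\alpha=\sum c_i\,dx_i$. Define $$\Omega^1(\mathcal{A})=\{\omega\in \tfrac{1}{Q(\mathcal{A})}\Omega^1_V \mid Q(\mathcal{A})\,\omega\wedge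 d\alpha_L\in\alpha_L\Omega_V^2\ \text{for all } L\in\mathcal{A}\}.$$ For $H\in\mathcal{A}$, let $\overline S=S/(\alpha_H)=\mathrm{Sym}(H^*)$, let $\overline g$ denote the image in $\overline S$ of $g\in S$, and let $\mathcal{A}^H=\{H\cap L\mid L\in\mathcal{A},L\ne H\}$, an arrangement in $H$ with $Q(\mathcal{A}^H)\in\overline S$ the product of its defining linear forms. The residue map $\mathrm{res}^H_{\mathcal{A}}:\Omega^1(\mathcal{A})\to\overline S$ is $$\mathrm{res}^H_{\mathcal{A}}\big(f\,d\alpha_H+f_2\,d\alpha_2+\cdots+f_\ell\,d\alpha_\ell\big)=\frac{1}{Q(\mathcal{A}^H)}\,\overline{Q(\mathcal{A})f},$$ where $\alpha_H,\alpha_2,\dots,\alpha_\ell$ is any basis of $V^*$ (this is well defined, independent of the choice of $\alpha_2,\dots,\alpha_\ell$, and takes values in $\overline S$). The residue ideal $J_{\mathcal{A}}^H\subset\overline S$ is the image of $\mathrm{res}^H_{\mathcal{A}}$. An empty intersection of ideals of $\overline S$ is $\overline S$. -}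

module Defs where

open import Algebra.Bundles using (CommutativeRing)
import Algebra.Definitions.RawMonoid as RawMonoidDefs
open import Data.Bool.Base using (if_then_else_)
open import Data.Fin.Base using (Fin; zero; Fin′; inject)
open import Data.List.Base as List using (List; []; _∷_; _++_; [_])
open import Data.List.Relation.Unary.All using (All)
open import Data.List.Relation.Unary.AllPairs using (AllPairs)
open import Data.List.Relation.Unary.Any using (Any)
import Data.Nat.Base as ℕ
open import Data.Nat.Base using (ℕ)
import Data.Nat.Properties as ℕ
open import Data.Product.Base using (Σ; ∃; ∃₂; _×_; _,_)
open import Data.Vec.Base as Vec using (Vec)
open import Data.Vec.Functional as Vector using (Vector)
import Data.Vec.Properties as Vec
open import Level using (Level; 0ℓ; suc; _⊔_)
open import Relation.Binary.Core using (Rel)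
open import Relation.Binary.Definitions using (Decidable; Irreflexive; Symmetric)
open import Relation.Binary.PropositionalEquality.Core using (_≡_; _≢_)
open import Relation.Nullary.Decidable.Core using (does)
open import Relation.Nullary.Negation.Core using (¬_)
open import Relation.Unary using (Pred; U; _∩_; _≐_)

record Field (c e : Level) : Set (suc (c ⊔ e)) where
  field
    commutativeRing : CommutativeRing c e
  open CommutativeRing commutativeRing public
  field
    1≉0     : ¬ (1# ≈ 0#)
    inverse : ∀ x → ¬ (x ≈ 0#) → ∃ λ y → x * y ≈ 1#

record SimpleGraph (n : ℕ) : Set₁ where
  field
    Adj         : Rel (Fin n) 0ℓ
    adj?        : Decidable Adj
    symmetric   : Symmetric Adj
    irreflexive : Irreflexive _≡_ Adj

  Edge : Set
  Edge = ∃₂ λ u v → Adj u v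

module Arrangements {c e : Level} (K : Field c e) (ℓ : ℕ) where
  open Field K using (Carrier; _≈_; _+_; _*_; -_; _-_; 0#; 1#; +-rawMonoid)
  open RawMonoidDefs +-rawMonoid using (sum)

  V : Set c
  V = Vector Carrier ℓ

  -- α stands for the linear form α₁ x₁ + ⋯ + α_ℓ x_ℓ.
  V* : Set c
  V* = Vector Carrier ℓ

  Ker : V* → Pred V e
  Ker α v = sum (λ k → α k * v k) ≈ 0#

  combination : ∀ {m} → Vector Carrier m → Vector V* m → V*
  combination a β k = sum (λ p → a p * β p k)

  record IsBasis {m : ℕ} (β : Vector V* m) : Set (c ⊔ e) where
    field
      independent : ∀ a → (∀ k → combination a β k ≈ 0#) → ∀ p → a p ≈ 0#
      spanning    : ∀ (γ : V*) → ∃ λ a → ∀ k → γ k ≈ combination a β k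

  -- S = K[x₁,…,x_ℓ]: a polynomial is a finite formal sum of terms
  -- a x^μ; two formal sums are the same polynomial when all their
  -- coefficients agree.
  S : Set c
  S = List (Carrier × Vec ℕ ℓ)

  coeff : S → Vec ℕ ℓ → Carrier
  coeff []            μ = 0#
  coeff ((a , ν) ∷ p) μ =
    if does (Vec.≡-dec ℕ._≟_ ν μ) then a + coeff p μ else coeff p μ

  infix  4 _≋_ _≋_[mod_]
  infixl 6 _+ₛ_ _-ₛ_
  infixl 7 _*ₛ_

  _≋_ : Rel S e
  p ≋ q = ∀ μ → coeff p μ ≈ coeff q μ

  const : Carrier → S
  const a = [ (a , Vec.replicate ℓ 0) ]

  x : Fin ℓ → S
  x k = [ (1# , Vec.replicate ℓ 0 Vec.[ k ]≔ 1) ]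

  0ₛ 1ₛ : S
  0ₛ = []
  1ₛ = const 1#

  _+ₛ_ _*ₛ_ _-ₛ_ : S → S → S
  p +ₛ q = p ++ q
  p *ₛ q = List.cartesianProductWith
             (λ (a , μ) (b , ν) → a * b , Vec.zipWith ℕ._+_ μ ν) p q
  p -ₛ q = p +ₛ List.map (λ (a , μ) → - a , μ) q

  sumₛ : ∀ {m} → Vector S m → S
  sumₛ = Vector.foldr _+ₛ_ 0ₛ

  productₛ : List S → S
  productₛ = List.foldr _*ₛ_ 1ₛ

  ⌜_⌝ : V* → S
  ⌜ α ⌝ = sumₛ (λ k → const (α k) *ₛ x k)

  -- Equality in S/(α).  Elements of S/(α) are represented by elements of
  -- S, and subsets of S/(α) by predicates on S.
  _≋_[mod_] : S → S → V* → Set (c ⊔ e)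
  p ≋ q [mod α ] = ∃ λ h → p -ₛ q ≋ h *ₛ ⌜ α ⌝

  -- The ideal (p , q) of S/(α).
  ⟨_,_⟩[mod_] : S → S → V* → Pred S (c ⊔ e)
  ⟨ p , q ⟩[mod α ] f = ∃₂ λ a b → f ≋ a *ₛ p +ₛ b *ₛ q [mod α ]

  Ω¹ : Set c
  Ω¹ = Vector S ℓ

  -- An element ω of (1/q)Ω¹, for q ≠ 0, is represented by qω ∈ Ω¹, which
  -- determines it.
  record Ω¹[1/_] (q : S) : Set c where
    field
      numerator : Ω¹

  -- Ω² is free on dx_a ∧ dx_b for a < b; the coefficient of that form in
  -- τ is τ b a, with a : Fin′ b encoding the constraint a < b.
  Ω² : Set c
  Ω² = (b : Fin ℓ) → Fin′ b → S

  d : V* → Ω¹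
  d α k = const (α k)

  _∧_ : Ω¹ → Ω¹ → Ω²
  (ω ∧ η) b a = ω (inject a) *ₛ η b -ₛ ω b *ₛ η (inject a)

  _∈_Ω² : Ω² → S → Set (c ⊔ e)
  σ ∈ p Ω² = ∃ λ (τ : Ω²) → ∀ b a → σ b a ≋ p *ₛ τ b a

  -- A set of hyperplanes of a subspace X of V is given as a family of
  -- subsets of V, in which repetitions are irrelevant.  DefiningForms is
  -- a choice of one linear form on X for every member of the (finite) set;
  -- linear forms on X are written as restrictions of linear forms on V.
  record DefiningForms {u : Level} {I : Set u} {v : Level}
                       (X : Pred V v) (𝓗 : I → Pred V e)
                       : Set (u ⊔ v ⊔ c ⊔ e) where
    field
      forms    : List V*
      sound    : All (λ α → ∃ λ k → 𝓗 k ≐ X ∩ Ker α) forms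
      complete : ∀ k → Any (λ α → 𝓗 k ≐ X ∩ Ker α) forms
      distinct : AllPairs (λ α β → ¬ (X ∩ Ker α ≐ X ∩ Ker β)) forms

    Q : S
    Q = productₛ (List.map ⌜_⌝ forms)

  -- The restriction to the member H = 𝓐 h, i.e. all H ∩ L with L ≠ H.
  _^_ : ∀ {u} {I : Set u} (𝓐 : I → Pred V e) (h : I) →
        (Σ I λ k → ¬ (𝓐 k ≐ 𝓐 h)) → Pred V e
  (𝓐 ^ h) (k , _) = 𝓐 h ∩ 𝓐 k

  graphic : (G : SimpleGraph ℓ) → SimpleGraph.Edge G → Pred V e
  graphic G (u , v , _) = λ w → w u ≈ w v

  module _ {u : Level} {I : Set u} {𝓐 : I → Pred V e} where

    record LogarithmicForm (D : DefiningForms U 𝓐) : Set (c ⊔ e) where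
      open DefiningForms D using (forms; Q)
      field
        ω : Ω¹[1/ Q ]
      open Ω¹[1/_] ω renaming (numerator to Qω) public
      field
        logarithmic : All (λ α → (Qω ∧ d α) ∈ ⌜ α ⌝ Ω²) forms

  -- All choices on which the definition of the residue map along H = 𝓐 h
  -- depends: α_L for L ∈ 𝓐, the form α_H and its completion to a basis
  -- of V*, and the defining forms of the restricted arrangement.
  record ResidueData {u : Level} {I : Set u} (𝓐 : I → Pred V e) (h : I)
                     : Set (u ⊔ c ⊔ e) where
    field
      definingForms : DefiningForms U 𝓐
      αᴴ            : V*
      αᴴ-defines    : 𝓐 h ≐ Ker αᴴ
      {m}           : ℕ
      αs            : Vector V* m
      isBasis       : IsBasis (αᴴ Vector.∷ αs)
      restricted    : DefiningForms (𝓐 h) (𝓐 ^ h)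

    open DefiningForms restricted using () renaming (Q to Qᴴ)
    open LogarithmicForm {D = definingForms}

    -- r represents the residue of ω = f dα_H + f₂ dα₂ + ⋯.  The coefficients
    -- f , f₂ , … are given by their numerators g = Q f , Q f₂ , …, and the
    -- fraction is cleared: Q(𝓐ᴴ) r = Q f in S/(α_H).
    IsResidue : LogarithmicForm definingForms → S → Set (c ⊔ e)
    IsResidue ω r = ∃ λ (g : Vector S (ℕ.suc m)) →
      (∀ k → Qω ω k ≋ sumₛ (λ p → g p *ₛ d ((αᴴ Vector.∷ αs) p) k))
      × (Qᴴ *ₛ r ≋ g zero [mod αᴴ ])

    residueIdeal : Pred S (c ⊔ e)
    residueIdeal r = ∃ λ ω → IsResidue ω r

  module _ (G : SimpleGraph ℓ) (i j : Fin ℓ) where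
    open SimpleGraph G using (Adj)

    W : Pred (Fin ℓ) 0ℓ
    W k = Adj k i × Adj k j

    NonEdgeInW : Set
    NonEdgeInW = ∃₂ λ u v → W u × W v × u ≢ v × ¬ Adj u v

{-# OPTIONS --safe #-}

module Submission where

-- A numerator η = Qω is logarithmic when, for every edge {p , q}, x_p - x_q
-- divides η_p + η_q and all η_k with k ∉ {p , q}; modulo x_i - x_j its residue r
-- then satisfies Q(𝓐ᴴ) r = η_i up to a unit, so Q(𝓐) itself plays no role.
-- For a non-edge {u , v} of W the conditions along ij, iu, iv, ju, jv put η_i
-- into y_u y_v (y_u , y_v).  The factors of Q(𝓐ᴴ) other than y_u and y_v do not
-- vanish on x_i = x_j = x_u = x_v, so r vanishes there.
-- Conversely, the intersection of the ideals (y_u , y_v) is spanned over K[x_i]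
-- by the monomials in the y_k for which the k ∈ W not dividing it form a clique
-- Z of G, and Σ_{a ∈ C} dx_a / ∏_{b ∈ C, b ≠ a} (x_a - x_b) for the clique
-- C = Z ∪ {i , j} has residue ± ∏_{k ∈ W ∖ Z} y_k.  Equality in K need not be
-- decidable: only exponents and adjacency are ever compared.

open import Algebra.Bundles using (AbelianGroup; CommutativeMonoid; CommutativeRing; RawRing)
import Algebra.Properties.AbelianGroup as AbelianGroupProperties
import Algebra.Properties.CommutativeMonoid.Sum as CommutativeMonoidSum
import Algebra.Properties.Ring as RingProperties
import Algebra.Properties.Semiring.Exp as Exp
import Algebra.Properties.Semiring.Mult as SemiringMult
import Algebra.Properties.Semiring.Sum as SemiringSum
import Algebra.Solver.Ring as RingSolver
open import Algebra.Solver.Ring.AlmostCommutativeRing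
  using (_-Raw-AlmostCommutative⟶_; fromCommutativeRing)
open import Data.Bool.Base using (true; false; if_then_else_)
import Data.Fin.Base as Fin
open import Data.Fin.Base using (Fin; zero; suc; toℕ; inject; fromℕ<)
import Data.Fin.Properties as Fin
open import Data.List.Base as List using (List; []; _∷_; _++_; [_])
open import Data.List.Relation.Unary.All as All using (All; []; _∷_)
import Data.List.Relation.Unary.All.Properties as All
open import Data.List.Relation.Unary.AllPairs using (AllPairs; []; _∷_)
open import Data.List.Relation.Unary.Any as Any using (Any; here; there)
import Data.List.Relation.Unary.Any.Properties as Any
open import Data.Maybe.Base using (Maybe; just; nothing)
import Data.Nat.Base as ℕ
open import Data.Nat.Base using (ℕ; zero; suc)
import Data.Nat.Properties as ℕ
open import Data.Product.Base using (∃; ∃₂; _×_; _,_; proj₁; proj₂)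
open import Data.Sum.Base using (_⊎_; inj₁; inj₂; [_,_]′)
open import Data.Vec.Base as Vec using (Vec; lookup)
open import Data.Vec.Functional as Vector using (Vector)
import Data.Vec.Properties as Vec
open import Defs
open import Function.Base using (_∘_; id)
import Level
open import Level using (Level; _⊔_; 0ℓ)
open import Relation.Binary.Definitions using (Tri; tri<; tri≈; tri>)
open import Relation.Binary.PropositionalEquality.Core as ≡ using (_≡_; _≢_)
import Relation.Binary.Reasoning.Setoid as SetoidReasoning
open import Relation.Binary.Structures using (IsEquivalence)
open import Relation.Nullary.Decidable using (dec-true; dec-false)
open import Relation.Nullary.Decidable.Core
  using (Dec; yes; no; does; _×-dec_; _⊎-dec_; ¬?; decidable-stable)
open import Relation.Nullary.Negation.Core using (¬_; contradiction)
open import Relation.Unary using (Pred; Decidable; U; _∩_; _≐_; ⋂)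

-- Restriction to `x_a = x_b` takes place inside S, as the substitution x_a ↦ x_b: its kernel
-- consists of the multiples of x_a - x_b. Since it sends any other difference x_p - x_q to a
-- difference of two distinct variables, primality of x_a - x_b reduces to one fact, that such a
-- difference is a non-zero-divisor. The obstacle in the converse is that for k ∈ W the edges {i ,
-- k} and {j , k} cut out the same hyperplane of H, so Q(𝓐ᴴ) has a single factor for two edges. The
-- clique forms need a numerator that is divisible by all edge differences and still comparable with
-- Q(𝓐ᴴ): it is x_i - x_j times ∏_{k ∈ W} (x_i - x_k) times a suitable lift of Q(𝓐ᴴ). Division by
-- the denominator of dx_i, which is x_i - x_j times ∏_{k ∈ Z} (x_i - x_k), leaves Q(𝓐ᴴ) times the
-- product over the k ∈ W outside Z, and this is where the residue comes from.

-- The library ring solver for an arbitrary commutative ring; integer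
-- coefficients, as reduced differences of naturals, let x - x cancel.
module Solver {a b : Level} (R : CommutativeRing a b) where
  open CommutativeRing R
  open RingProperties ring using (-‿distribˡ-*; -‿distribʳ-*)
  open AbelianGroupProperties +-abelianGroup using (⁻¹-∙-comm; ⁻¹-involutive; ε⁻¹≈ε)
  open SemiringMult semiring using (×-homo-+; ×-assoc-*; ×-comm-*; ×-assocˡ; ×-congʳ)
    renaming (_×_ to _⋆_)
  open SetoidReasoning setoid

  private
    Difference : Set
    Difference = ℕ × ℕ

    reduce : ℕ → ℕ → Difference
    reduce (suc m) (suc n) = reduce m n
    reduce m       n       = m , n

    ⟦_⟧ : Difference → Carrier
    ⟦ m , n ⟧ = m ⋆ 1# - n ⋆ 1#

    interchange : ∀ w x y z → (w + x) + (y + z) ≈ (w + y) + (x + z)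
    interchange w x y z = begin
      (w + x) + (y + z) ≈⟨ +-assoc w x (y + z) ⟩
      w + (x + (y + z)) ≈⟨ +-congˡ (+-assoc x y z) ⟨
      w + ((x + y) + z) ≈⟨ +-congˡ (+-congʳ (+-comm x y)) ⟩
      w + ((y + x) + z) ≈⟨ +-congˡ (+-assoc y x z) ⟩
      w + (y + (x + z)) ≈⟨ +-assoc w y (x + z) ⟨
      (w + y) + (x + z) ∎

    reduce-correct : ∀ m n → ⟦ reduce m n ⟧ ≈ ⟦ m , n ⟧
    reduce-correct zero    n       = refl
    reduce-correct (suc m) zero    = refl
    reduce-correct (suc m) (suc n) = begin
      ⟦ reduce m n ⟧                               ≈⟨ reduce-correct m n ⟩
      m ⋆ 1# - n ⋆ 1#                              ≈⟨ +-identityˡ _ ⟨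
      0# + (m ⋆ 1# - n ⋆ 1#)                       ≈⟨ +-congʳ (-‿inverseʳ 1#) ⟨
      (1# - 1#) + (m ⋆ 1# - n ⋆ 1#)                ≈⟨ interchange _ _ _ _ ⟩
      (1# + m ⋆ 1#) + (- 1# - n ⋆ 1#)              ≈⟨ +-congˡ (⁻¹-∙-comm _ _) ⟩
      (1# + m ⋆ 1#) - (1# + n ⋆ 1#)                ∎

    coefficients : RawRing 0ℓ 0ℓ
    coefficients = record
      { Carrier = Difference
      ; _≈_     = _≡_
      ; _+_     = λ (m , n) (m′ , n′) → reduce (m ℕ.+ m′) (n ℕ.+ n′)
      ; _*_     = λ (m , n) (m′ , n′) →
                    reduce (m ℕ.* m′ ℕ.+ n ℕ.* n′) (m ℕ.* n′ ℕ.+ n ℕ.* m′)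
      ; -_      = λ (m , n) → n , m
      ; 0#      = 0 , 0
      ; 1#      = 1 , 0
      }

    ⋆1-homo-* : ∀ m n → (m ℕ.* n) ⋆ 1# ≈ (m ⋆ 1#) * (n ⋆ 1#)
    ⋆1-homo-* m n = begin
      (m ℕ.* n) ⋆ 1#      ≈⟨ ×-assocˡ 1# m n ⟨
      m ⋆ (n ⋆ 1#)        ≈⟨ ×-congʳ m (*-identityˡ _) ⟨
      m ⋆ (1# * (n ⋆ 1#)) ≈⟨ ×-assoc-* m 1# (n ⋆ 1#) ⟨
      (m ⋆ 1#) * (n ⋆ 1#) ∎

    +-homo : ∀ p q → ⟦ RawRing._+_ coefficients p q ⟧ ≈ ⟦ p ⟧ + ⟦ q ⟧
    +-homo (m , n) (m′ , n′) = begin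
      ⟦ reduce (m ℕ.+ m′) (n ℕ.+ n′) ⟧
        ≈⟨ reduce-correct (m ℕ.+ m′) (n ℕ.+ n′) ⟩
      (m ℕ.+ m′) ⋆ 1# - (n ℕ.+ n′) ⋆ 1#
        ≈⟨ +-cong (×-homo-+ 1# m m′) (-‿cong (×-homo-+ 1# n n′)) ⟩
      (m ⋆ 1# + m′ ⋆ 1#) - (n ⋆ 1# + n′ ⋆ 1#)
        ≈⟨ +-congˡ (⁻¹-∙-comm _ _) ⟨
      (m ⋆ 1# + m′ ⋆ 1#) + (- (n ⋆ 1#) - n′ ⋆ 1#)
        ≈⟨ interchange _ _ _ _ ⟩
      ⟦ m , n ⟧ + ⟦ m′ , n′ ⟧ ∎

    *-difference : ∀ w x y z → (w - x) * (y - z) ≈ (w * y + x * z) - (w * z + x * y)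
    *-difference w x y z = begin
      (w - x) * (y - z)
        ≈⟨ distribʳ _ w (- x) ⟩
      w * (y - z) + - x * (y - z)
        ≈⟨ +-cong (distribˡ w y (- z)) (distribˡ (- x) y (- z)) ⟩
      (w * y + w * - z) + (- x * y + - x * - z)
        ≈⟨ +-cong (+-congˡ (sym (-‿distribʳ-* w z)))
                  (+-cong (sym (-‿distribˡ-* x y)) negneg) ⟩
      (w * y - w * z) + (- (x * y) + x * z)
        ≈⟨ +-congˡ (+-comm _ _) ⟩
      (w * y - w * z) + (x * z - x * y)
        ≈⟨ interchange _ _ _ _ ⟩
      (w * y + x * z) + (- (w * z) - x * y)
        ≈⟨ +-congˡ (⁻¹-∙-comm _ _) ⟩
      (w * y + x * z) - (w * z + x * y) ∎
      where
      negneg : - x * - z ≈ x * z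
      negneg = begin
        - x * - z     ≈⟨ -‿distribˡ-* x (- z) ⟨
        - (x * - z)   ≈⟨ -‿cong (-‿distribʳ-* x z) ⟨
        - (- (x * z)) ≈⟨ ⁻¹-involutive _ ⟩
        x * z         ∎

    *-homo : ∀ p q → ⟦ RawRing._*_ coefficients p q ⟧ ≈ ⟦ p ⟧ * ⟦ q ⟧
    *-homo (m , n) (m′ , n′) = begin
      ⟦ RawRing._*_ coefficients (m , n) (m′ , n′) ⟧
        ≈⟨ reduce-correct (m ℕ.* m′ ℕ.+ n ℕ.* n′) _ ⟩
      (m ℕ.* m′ ℕ.+ n ℕ.* n′) ⋆ 1# - (m ℕ.* n′ ℕ.+ n ℕ.* m′) ⋆ 1#
        ≈⟨ +-cong (products m m′ n n′) (-‿cong (products m n′ n m′)) ⟩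
      (m ⋆ 1# * (m′ ⋆ 1#) + n ⋆ 1# * (n′ ⋆ 1#)) - (m ⋆ 1# * (n′ ⋆ 1#) + n ⋆ 1# * (m′ ⋆ 1#))
        ≈⟨ *-difference _ _ _ _ ⟨
      ⟦ m , n ⟧ * ⟦ m′ , n′ ⟧ ∎
      where
      products : ∀ p q r s → (p ℕ.* q ℕ.+ r ℕ.* s) ⋆ 1# ≈ p ⋆ 1# * (q ⋆ 1#) + r ⋆ 1# * (s ⋆ 1#)
      products p q r s =
        trans (×-homo-+ 1# (p ℕ.* q) (r ℕ.* s)) (+-cong (⋆1-homo-* p q) (⋆1-homo-* r s))

    negation-homo : ∀ p → ⟦ RawRing.-_ coefficients p ⟧ ≈ - ⟦ p ⟧
    negation-homo (m , n) = begin
      n ⋆ 1# - m ⋆ 1#           ≈⟨ +-comm _ _ ⟩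
      - (m ⋆ 1#) + n ⋆ 1#       ≈⟨ +-congˡ (⁻¹-involutive _) ⟨
      - (m ⋆ 1#) - - (n ⋆ 1#)   ≈⟨ ⁻¹-∙-comm _ _ ⟩
      - (m ⋆ 1# - n ⋆ 1#)       ∎

    morphism : coefficients -Raw-AlmostCommutative⟶ fromCommutativeRing R
    morphism = record
      { ⟦_⟧    = ⟦_⟧
      ; +-homo = +-homo
      ; *-homo = *-homo
      ; -‿homo = negation-homo
      ; 0-homo = -‿inverseʳ 0#
      ; 1-homo = trans (+-cong (+-identityʳ 1#) ε⁻¹≈ε) (+-identityʳ 1#)
      }

    equal? : ∀ p q → Maybe (⟦ p ⟧ ≈ ⟦ q ⟧)
    equal? (m , n) (m′ , n′) with m ℕ.≟ m′ | n ℕ.≟ n′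
    ... | yes ≡.refl | yes ≡.refl = just refl
    ... | _          | _          = nothing

  open RingSolver coefficients (fromCommutativeRing R) morphism equal? public
    using (solve; _:=_; _:+_; _:*_; _:-_; :-_)

-- Ideals, quotients and divisibility in a commutative ring

module CommutativeRingIdeals {a b : Level} (R : CommutativeRing a b) where
  open CommutativeRing R
  open Solver R

  record IsIdeal {p} (I : Pred Carrier p) : Set (a ⊔ b ⊔ p) where
    field
      resp     : ∀ {f g} → f ≈ g → I f → I g
      0∈       : I 0#
      +-closed : ∀ {f g} → I f → I g → I (f + g)
      *-closed : ∀ h {f} → I f → I (h * f)

    neg-closed : ∀ {f} → I f → I (- f)
    neg-closed {f} f∈ = resp (trans (sym (-‿distribˡ-* 1# f)) (-‿cong (*-identityˡ f))) (*-closed (- 1#) f∈)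
      where open RingProperties ring using (-‿distribˡ-*)

  -- The carrier stays and only the equality becomes coarser, so congruences modulo `I` are
  -- equations of a commutative ring and the congruence lemmas for finite sums and products apply to
  -- them.
  _/_ : ∀ {p} (I : Pred Carrier p) → IsIdeal I → CommutativeRing a p
  I / isIdeal = record
    { _≈_ = _~_ ; _+_ = _+_ ; _*_ = _*_ ; -_ = -_ ; 0# = 0# ; 1# = 1#
    ; isCommutativeRing = record
      { isRing = record
        { +-isAbelianGroup = record
          { isGroup = record
            { isMonoid = record
              { isSemigroup = record
                { isMagma = record { isEquivalence = ~-equivalence ; ∙-cong = ~-+-cong }
                ; assoc = λ f g h → ≈⇒~ (+-assoc f g h) }
              ; identity = (λ f → ≈⇒~ (+-identityˡ f)) , (λ f → ≈⇒~ (+-identityʳ f)) }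
            ; inverse = (λ f → ≈⇒~ (-‿inverseˡ f)) , (λ f → ≈⇒~ (-‿inverseʳ f))
            ; ⁻¹-cong = ~-neg-cong }
          ; comm = λ f g → ≈⇒~ (+-comm f g) }
        ; *-cong = ~-*-cong
        ; *-assoc = λ f g h → ≈⇒~ (*-assoc f g h)
        ; *-identity = (λ f → ≈⇒~ (*-identityˡ f)) , (λ f → ≈⇒~ (*-identityʳ f))
        ; distrib = (λ f g h → ≈⇒~ (distribˡ f g h)) , (λ f g h → ≈⇒~ (distribʳ f g h)) }
      ; *-comm = λ f g → ≈⇒~ (*-comm f g) } }
    where
    open IsIdeal isIdeal
    _~_ : Carrier → Carrier → Set _
    f ~ g = I (f - g)

    ≈⇒~ : ∀ {f g} → f ≈ g → f ~ g
    ≈⇒~ {f} {g} f≈g = resp (sym (trans (+-congʳ f≈g) (-‿inverseʳ g))) 0∈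

    ~-equivalence : IsEquivalence _~_
    ~-equivalence = record
      { refl  = ≈⇒~ refl
      ; sym   = λ {f} {g} f~g →
          resp (solve 2 (λ f g → :- (f :- g) := g :- f) refl f g) (neg-closed f~g)
      ; trans = λ {f} {g} {h} f~g g~h →
          resp (solve 3 (λ f g h → (f :- g) :+ (g :- h) := f :- h) refl f g h) (+-closed f~g g~h)
      }

    ~-+-cong : ∀ {f f′ g g′} → f ~ f′ → g ~ g′ → (f + g) ~ (f′ + g′)
    ~-+-cong {f} {f′} {g} {g′} p q =
      resp (solve 4 (λ f f′ g g′ → (f :- f′) :+ (g :- g′) := (f :+ g) :- (f′ :+ g′)) refl f f′ g g′)
           (+-closed p q)

    ~-*-cong : ∀ {f f′ g g′} → f ~ f′ → g ~ g′ → (f * g) ~ (f′ * g′)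
    ~-*-cong {f} {f′} {g} {g′} p q =
      resp (solve 4 (λ f f′ g g′ → g :* (f :- f′) :+ f′ :* (g :- g′) := f :* g :- f′ :* g′) refl f f′ g g′)
           (+-closed (*-closed g p) (*-closed f′ q))

    ~-neg-cong : ∀ {f f′} → f ~ f′ → (- f) ~ (- f′)
    ~-neg-cong {f} {f′} p =
      resp (solve 2 (λ f f′ → :- (f :- f′) := :- f :- :- f′) refl f f′) (neg-closed p)

  infix 4 _∣_

  _∣_ : Carrier → Pred Carrier (a ⊔ b)
  d ∣ f = ∃ λ h → f ≈ h * d

  ∣-isIdeal : ∀ d → IsIdeal (d ∣_)
  ∣-isIdeal d = record
    { resp     = λ { f≈g (h , eq) → h , trans (sym f≈g) eq }
    ; 0∈       = 0# , sym (zeroˡ d)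
    ; +-closed = λ { (h , eq) (h′ , eq′) → h + h′ , trans (+-cong eq eq′) (sym (distribʳ d h h′)) }
    ; *-closed = λ { k (h , eq) → k * h , trans (*-congˡ eq) (sym (*-assoc k h d)) }
    }

module SingleTerm {a b} (M : CommutativeMonoid a b) where
  open CommutativeMonoid M
  open CommutativeMonoidSum M

  sum-ε : ∀ {n} (f : Vector Carrier n) → (∀ k → f k ≈ ε) → sum f ≈ ε
  sum-ε {n} f f≈ε = trans (sum-cong-≋ f≈ε) (sum-replicate-zero n)

  sum-single : ∀ {n} (f : Vector Carrier n) m → (∀ k → k ≢ m → f k ≈ ε) → sum f ≈ f m
  sum-single f zero    f≈ε =
    trans (∙-congˡ (sum-ε (f ∘ suc) (λ k → f≈ε (suc k) λ ()))) (identityʳ _)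
  sum-single f (suc m) f≈ε =
    trans (∙-cong (f≈ε zero λ ()) (sum-single (f ∘ suc) m
      (λ k k≢m → f≈ε (suc k) (k≢m ∘ Fin.suc-injective))))
          (identityˡ _)

lookup-ext : ∀ {a} {A : Set a} {n} {u v : Vec A n} → (∀ k → lookup u k ≡ lookup v k) → u ≡ v
lookup-ext {u = u} {v} eq =
  ≡.trans (≡.sym (Vec.tabulate∘lookup u)) (≡.trans (Vec.tabulate-cong eq) (Vec.tabulate∘lookup v))

-- Exponent vectors

module Monomials (ℓ : ℕ) where
  infixl 6 _⊕_

  Monomial : Set
  Monomial = Vec ℕ ℓ

  𝟘 : Monomial
  𝟘 = Vec.replicate ℓ 0

  _⊕_ : Monomial → Monomial → Monomial
  _⊕_ = Vec.zipWith ℕ._+_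

  𝕖 : Fin ℓ → Monomial
  𝕖 k = 𝟘 Vec.[ k ]≔ 1

  lookup-⊕ : ∀ μ ν k → lookup (μ ⊕ ν) k ≡ lookup μ k ℕ.+ lookup ν k
  lookup-⊕ μ ν k = Vec.lookup-zipWith ℕ._+_ k μ ν

  lookup-𝟘 : ∀ k → lookup 𝟘 k ≡ 0
  lookup-𝟘 k = Vec.lookup-replicate k 0

  lookup-𝕖-same : ∀ k → lookup (𝕖 k) k ≡ 1
  lookup-𝕖-same k = Vec.lookup∘updateAt k 𝟘

  lookup-𝕖-other : ∀ {k m} → m ≢ k → lookup (𝕖 k) m ≡ 0
  lookup-𝕖-other {k} {m} m≢k = ≡.trans (Vec.lookup∘updateAt′ m k m≢k 𝟘) (lookup-𝟘 m)

  ⊕-assoc : ∀ μ ν κ → (μ ⊕ ν) ⊕ κ ≡ μ ⊕ (ν ⊕ κ)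
  ⊕-assoc = Vec.zipWith-assoc ℕ.+-assoc

  ⊕-comm : ∀ μ ν → μ ⊕ ν ≡ ν ⊕ μ
  ⊕-comm = Vec.zipWith-comm ℕ.+-comm

  ⊕-identityˡ : ∀ μ → 𝟘 ⊕ μ ≡ μ
  ⊕-identityˡ = Vec.zipWith-identityˡ ℕ.+-identityˡ

  ⊕-cancelˡ : ∀ μ {ν κ} → μ ⊕ ν ≡ μ ⊕ κ → ν ≡ κ
  ⊕-cancelˡ μ {ν} {κ} eq = lookup-ext λ k → ℕ.+-cancelˡ-≡ (lookup μ k) _ _
    (≡.trans (≡.sym (lookup-⊕ μ ν k)) (≡.trans (≡.cong (λ ξ → lookup ξ k) eq) (lookup-⊕ μ κ k)))

  ⊕-complement : ∀ μ k {n} → lookup μ k ≡ suc n → ∃ λ ν → μ ≡ 𝕖 k ⊕ ν × lookup ν k ≡ n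
  ⊕-complement μ k {n} eq = ν , lookup-ext componentwise ,
    ≡.trans (Vec.lookup-zipWith ℕ._∸_ k μ (𝕖 k)) (≡.cong₂ ℕ._∸_ eq (lookup-𝕖-same k))
    where
    ν = Vec.zipWith ℕ._∸_ μ (𝕖 k)
    𝕖≤μ : ∀ m → lookup (𝕖 k) m ℕ.≤ lookup μ m
    𝕖≤μ m with m Fin.≟ k
    ... | yes ≡.refl = ≡.subst₂ ℕ._≤_ (≡.sym (lookup-𝕖-same k)) (≡.sym eq) (ℕ.s≤s ℕ.z≤n)
    ... | no  m≢k    = ≡.subst (ℕ._≤ _) (≡.sym (lookup-𝕖-other m≢k)) ℕ.z≤n
    componentwise : ∀ m → lookup μ m ≡ lookup (𝕖 k ⊕ ν) m
    componentwise m = ≡.trans (≡.sym (ℕ.m+[n∸m]≡n (𝕖≤μ m))) (≡.sym (≡.trans (lookup-⊕ (𝕖 k) ν m)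
      (≡.cong (lookup (𝕖 k) m ℕ.+_) (Vec.lookup-zipWith ℕ._∸_ m μ (𝕖 k)))))

-- The polynomial ring of formal sums

module Polynomials {c e : Level} (K : Field c e) (ℓ : ℕ) where
  open Field K
  open Arrangements K ℓ
  open Monomials ℓ

  infix 4 _≟ₘ_

  _≟ₘ_ = Vec.≡-dec {n = ℓ} ℕ._≟_

  coeff-++ : ∀ p q μ → coeff (p ++ q) μ ≈ coeff p μ + coeff q μ
  coeff-++ []            q μ = sym (+-identityˡ _)
  coeff-++ ((a , ν) ∷ p) q μ with does (ν ≟ₘ μ)
  ... | true  = trans (+-congˡ (coeff-++ p q μ)) (sym (+-assoc _ _ _))
  ... | false = coeff-++ p q μ

  -ₛ_ : S → S
  -ₛ_ = List.map (λ (a , μ) → - a , μ)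

  coeff-neg : ∀ p μ → coeff (-ₛ p) μ ≈ - coeff p μ
  coeff-neg []            μ = sym ε⁻¹≈ε
    where open AbelianGroupProperties +-abelianGroup using (ε⁻¹≈ε)
  coeff-neg ((a , ν) ∷ p) μ with does (ν ≟ₘ μ)
  ... | true  = trans (+-congˡ (coeff-neg p μ)) (⁻¹-∙-comm _ _)
    where open AbelianGroupProperties +-abelianGroup using (⁻¹-∙-comm)
  ... | false = coeff-neg p μ

  without : Monomial → S → S
  without ν []            = []
  without ν ((a , κ) ∷ p) = if does (κ ≟ₘ ν) then without ν p else (a , κ) ∷ without ν p

  without-length : ∀ ν p → List.length (without ν p) ℕ.≤ List.length p
  without-length ν []            = ℕ.z≤n
  without-length ν ((a , κ) ∷ p) with does (κ ≟ₘ ν)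
  ... | true  = ℕ.m≤n⇒m≤1+n (without-length ν p)
  ... | false = ℕ.s≤s (without-length ν p)

  coeff-without-same : ∀ ν p → coeff (without ν p) ν ≈ 0#
  coeff-without-same ν []            = refl
  coeff-without-same ν ((a , κ) ∷ p) with κ ≟ₘ ν
  ... | yes κ≡ν = coeff-without-same ν p
  ... | no  κ≢ν rewrite dec-false (κ ≟ₘ ν) κ≢ν = coeff-without-same ν p

  coeff-without-other : ∀ {ν μ} p → ν ≢ μ → coeff (without ν p) μ ≈ coeff p μ
  coeff-without-other         []            ν≢μ = refl
  coeff-without-other {ν} {μ} ((a , κ) ∷ p) ν≢μ with κ ≟ₘ ν
  ... | yes ≡.refl rewrite dec-false (κ ≟ₘ μ) ν≢μ = coeff-without-other p ν≢μ
  ... | no  κ≢ν with does (κ ≟ₘ μ)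
  ...   | true  = +-congˡ (coeff-without-other p ν≢μ)
  ...   | false = coeff-without-other p ν≢μ

  -- The universal property of S as a sum of copies of K indexed by the monomials. The content is
  -- `ext-cong`: a formal sum may repeat exponents or carry zero terms, yet its image depends on the
  -- coefficients only.
  module Extension {g h} (M : AbelianGroup g h)
                   (act      : Carrier → Monomial → AbelianGroup.Carrier M)
                   (act-cong : ∀ {a b} ν → a ≈ b → AbelianGroup._≈_ M (act a ν) (act b ν))
                   (act-+    : ∀ a b ν → AbelianGroup._≈_ M (act (a + b) ν)
                     (AbelianGroup._∙_ M (act a ν) (act b ν)))
                   where
    private
      module M = AbelianGroup M
    open M using (_∙_; ε; _⁻¹)
    open AbelianGroupProperties M

    ext : S → AbelianGroup.Carrier M
    ext []            = AbelianGroup.ε M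
    ext ((a , ν) ∷ p) = AbelianGroup._∙_ M (act a ν) (ext p)

    act-0 : ∀ ν → act 0# ν M.≈ ε
    act-0 ν = identityˡ-unique _ _ (M.trans (M.sym (act-+ 0# 0# ν)) (act-cong ν (+-identityˡ 0#)))

    act-neg : ∀ a ν → act (- a) ν M.≈ act a ν ⁻¹
    act-neg a ν = inverseˡ-unique _ _
      (M.trans (M.sym (act-+ (- a) a ν)) (M.trans (act-cong ν (-‿inverseˡ a)) (act-0 ν)))

    ext-++ : ∀ p q → AbelianGroup._≈_ M (ext (p ++ q)) (AbelianGroup._∙_ M (ext p) (ext q))
    ext-++ []            q = M.sym (M.identityˡ _)
    ext-++ ((a , ν) ∷ p) q = M.trans (M.∙-congˡ (ext-++ p q)) (M.sym (M.assoc _ _ _))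

    ext-neg : ∀ p → AbelianGroup._≈_ M (ext (-ₛ p)) (AbelianGroup._⁻¹ M (ext p))
    ext-neg []            = M.sym ε⁻¹≈ε
    ext-neg ((a , ν) ∷ p) = M.trans (M.∙-cong (act-neg a ν) (ext-neg p)) (⁻¹-∙-comm _ _)

    private
      split : ∀ ν p → ext p M.≈ act (coeff p ν) ν ∙ ext (without ν p)
      split ν []            = M.sym (M.trans (M.identityʳ _) (act-0 ν))
      split ν ((a , κ) ∷ p) with κ ≟ₘ ν
      ... | yes ≡.refl = M.trans (M.∙-congˡ (split ν p))
                           (M.trans (M.sym (M.assoc _ _ _)) (M.∙-congʳ (M.sym (act-+ a _ κ))))
      ... | no  _      = M.trans (M.∙-congˡ (split ν p)) (x∙yz≈y∙xz _ _ _)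
        where open import Algebra.Properties.CommutativeSemigroup M.commutativeSemigroup using (x∙yz≈y∙xz)

      -- Single terms need not be zero, only the total for each exponent is. So all terms with the
      -- exponent of the head are removed at once: by `split` they contribute `act` of a zero
      -- coefficient, and the remaining list is shorter.
      vanish : ∀ n p → List.length p ℕ.≤ n → (∀ μ → coeff p μ ≈ 0#) → ext p M.≈ ε
      vanish n       []            _          _  = M.refl
      vanish (suc n) ((a , ν) ∷ p) (ℕ.s≤s p≤n) p≈0 = M.trans (split ν ((a , ν) ∷ p))
        (M.trans (M.∙-cong (M.trans (act-cong ν (p≈0 ν)) (act-0 ν))
                           (vanish n (without ν ((a , ν) ∷ p)) shorter without≈0))
                 (M.identityʳ _))
        where
        shorter : List.length (without ν ((a , ν) ∷ p)) ℕ.≤ n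
        shorter rewrite dec-true (ν ≟ₘ ν) ≡.refl = ℕ.≤-trans (without-length ν p) p≤n
        without≈0 : ∀ μ → coeff (without ν ((a , ν) ∷ p)) μ ≈ 0#
        without≈0 μ with ν ≟ₘ μ
        ... | yes ≡.refl = coeff-without-same ν ((a , ν) ∷ p)
        ... | no  ν≢μ    = trans (coeff-without-other ((a , ν) ∷ p) ν≢μ) (p≈0 μ)

    ext-cong : ∀ {p q} → p ≋ q → AbelianGroup._≈_ M (ext p) (ext q)
    ext-cong {p} {q} p≋q = x∙y⁻¹≈ε⇒x≈y _ _
      (M.trans (M.sym (M.trans (ext-++ p (-ₛ q)) (M.∙-congˡ (ext-neg q))))
               (vanish _ (p -ₛ q) ℕ.≤-refl difference≈0))
      where
      difference≈0 : ∀ μ → coeff (p -ₛ q) μ ≈ 0#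
      difference≈0 μ = trans (coeff-++ p (-ₛ q) μ)
        (trans (+-cong (p≋q μ) (coeff-neg q μ)) (-‿inverseʳ _))

  module Functional (φ : Monomial → Carrier) =
    Extension +-abelianGroup (λ a ν → a * φ ν) (λ ν a≈b → *-congʳ a≈b) (λ a b ν → distribʳ (φ ν) a b)

  -- The K-linear functional on S with values `φ` on the monomials. These functionals separate
  -- polynomials, which turns the ring laws into identities between iterated evaluations: a product
  -- is evaluated at sums of exponents.
  E : (Monomial → Carrier) → S → Carrier
  E φ = Functional.ext φ

  δ : Monomial → Monomial → Carrier
  δ μ ν = if does (ν ≟ₘ μ) then 1# else 0#

  coeff≈E : ∀ p μ → coeff p μ ≈ E (δ μ) p
  coeff≈E []            μ = refl
  coeff≈E ((a , ν) ∷ p) μ with does (ν ≟ₘ μ)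
  ... | true  = +-cong (sym (*-identityʳ a)) (coeff≈E p μ)
  ... | false = trans (coeff≈E p μ) (sym (trans (+-congʳ (zeroʳ a)) (+-identityˡ _)))

  E-ext : ∀ {p q} → (∀ φ → E φ p ≈ E φ q) → p ≋ q
  E-ext {p} {q} eq μ = trans (coeff≈E p μ) (trans (eq (δ μ)) (sym (coeff≈E q μ)))

  E-congʳ : ∀ φ {p q} → p ≋ q → E φ p ≈ E φ q
  E-congʳ φ {p} {q} = Functional.ext-cong φ {p} {q}

  E-congˡ : ∀ {φ ψ} p → (∀ ν → φ ν ≈ ψ ν) → E φ p ≈ E ψ p
  E-congˡ []            eq = refl
  E-congˡ ((a , ν) ∷ p) eq = +-cong (*-congˡ (eq ν)) (E-congˡ p eq)

  E-scale : ∀ a φ p → E (λ ν → a * φ ν) p ≈ a * E φ p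
  E-scale a φ []            = sym (zeroʳ a)
  E-scale a φ ((b , ν) ∷ p) = trans (+-cong (x∙yz≈y∙xz b a (φ ν)) (E-scale a φ p)) (sym (distribˡ a _ _))
    where open import Algebra.Properties.CommutativeSemigroup *-commutativeSemigroup using (x∙yz≈y∙xz)

  E-0 : ∀ p → E (λ _ → 0#) p ≈ 0#
  E-0 []            = refl
  E-0 ((a , ν) ∷ p) = trans (+-cong (zeroʳ a) (E-0 p)) (+-identityˡ 0#)

  E-+ : ∀ φ ψ p → E (λ ν → φ ν + ψ ν) p ≈ E φ p + E ψ p
  E-+ φ ψ []            = sym (+-identityˡ 0#)
  E-+ φ ψ ((a , ν) ∷ p) = trans (+-cong (distribˡ a _ _) (E-+ φ ψ p)) (interchange _ _ _ _)
    where open import Algebra.Properties.CommutativeSemigroup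
                 (CommutativeMonoid.commutativeSemigroup +-commutativeMonoid) using (interchange)

  -- Interchange of two finite sums; with `E-*` it yields commutativity of the product.
  E-swap : ∀ (φ : Monomial → Monomial → Carrier) p q →
           E (λ ν → E (φ ν) q) p ≈ E (λ κ → E (λ ν → φ ν κ) p) q
  E-swap φ []            q = sym (E-0 q)
  E-swap φ ((a , ν) ∷ p) q =
    trans (+-cong (sym (E-scale a (φ ν) q)) (E-swap φ p q)) (sym (E-+ _ _ q))

  E-* : ∀ φ p q → E φ (p *ₛ q) ≈ E (λ ν → E (λ κ → φ (ν ⊕ κ)) q) p
  E-* φ []            q = refl
  E-* φ ((a , ν) ∷ p) q =
    trans (Functional.ext-++ φ (List.map _ q) (p *ₛ q)) (+-cong (termwise q) (E-* φ p q))
    where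
    termwise : ∀ q → E φ (List.map (λ (b , κ) → a * b , ν ⊕ κ) q) ≈ a * E (λ κ → φ (ν ⊕ κ)) q
    termwise []            = sym (zeroʳ a)
    termwise ((b , κ) ∷ q) = trans (+-cong (*-assoc a b _) (termwise q)) (sym (distribˡ a _ _))

  E-const : ∀ φ a → E φ (const a) ≈ a * φ 𝟘
  E-const φ a = +-identityʳ _

  private
    *ₛ-comm : ∀ p q → p *ₛ q ≋ q *ₛ p
    *ₛ-comm p q = E-ext {p *ₛ q} {q *ₛ p} λ φ → trans (E-* φ p q) (trans (E-swap _ p q)
      (trans (E-congˡ q (λ κ → E-congˡ p (λ ν → reflexive (≡.cong φ (⊕-comm ν κ))))) (sym (E-* φ q p))))

    *ₛ-congʳ : ∀ {p p′} q → p ≋ p′ → p *ₛ q ≋ p′ *ₛ q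
    *ₛ-congʳ {p} {p′} q p≋p′ = E-ext {p *ₛ q} {p′ *ₛ q} λ φ →
      trans (E-* φ p q) (trans (E-congʳ _ {p} {p′} p≋p′) (sym (E-* φ p′ q)))

    *ₛ-assoc : ∀ p q r → (p *ₛ q) *ₛ r ≋ p *ₛ (q *ₛ r)
    *ₛ-assoc p q r = E-ext {(p *ₛ q) *ₛ r} {p *ₛ (q *ₛ r)} λ φ →
      trans (E-* φ (p *ₛ q) r) (trans (E-* _ p q) (trans
        (E-congˡ p (λ μ → trans (E-congˡ q (λ ν → E-congˡ r (λ κ → reflexive (≡.cong φ (⊕-assoc μ ν κ)))))
                                (sym (E-* (λ ξ → φ (μ ⊕ ξ)) q r))))
        (sym (E-* φ p (q *ₛ r)))))

    *ₛ-identityˡ : ∀ p → 1ₛ *ₛ p ≋ p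
    *ₛ-identityˡ p = E-ext {1ₛ *ₛ p} {p} λ φ →
      trans (E-* φ 1ₛ p) (trans (E-const (λ ν → E (λ κ → φ (ν ⊕ κ)) p) 1#) (trans (*-identityˡ _)
        (E-congˡ p (λ κ → reflexive (≡.cong φ (⊕-identityˡ κ))))))

    *ₛ-distribˡ : ∀ p q r → p *ₛ (q +ₛ r) ≋ p *ₛ q +ₛ p *ₛ r
    *ₛ-distribˡ p q r = E-ext {p *ₛ (q +ₛ r)} {p *ₛ q +ₛ p *ₛ r} λ φ →
      trans (E-* φ p (q +ₛ r)) (trans (E-congˡ p (λ ν → Functional.ext-++ _ q r)) (trans (E-+ _ _ p)
        (sym (trans (Functional.ext-++ φ (p *ₛ q) _) (+-cong (E-* φ p q) (E-* φ p r))))))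

    +ₛ-cong : ∀ {p p′ q q′} → p ≋ p′ → q ≋ q′ → p +ₛ q ≋ p′ +ₛ q′
    +ₛ-cong {p} {p′} {q} {q′} p≋p′ q≋q′ μ =
      trans (coeff-++ p q μ) (trans (+-cong (p≋p′ μ) (q≋q′ μ)) (sym (coeff-++ p′ q′ μ)))

    +ₛ-comm : ∀ p q → p +ₛ q ≋ q +ₛ p
    +ₛ-comm p q μ = trans (coeff-++ p q μ) (trans (+-comm _ _) (sym (coeff-++ q p μ)))

    +ₛ-assoc : ∀ p q r → (p +ₛ q) +ₛ r ≋ p +ₛ (q +ₛ r)
    +ₛ-assoc p q r μ = reflexive (≡.cong (λ s → coeff s μ) (++-assoc p q r))
      where open import Data.List.Properties using (++-assoc)

    -ₛ-inverseʳ : ∀ p → p -ₛ p ≋ 0ₛ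
    -ₛ-inverseʳ p μ = trans (coeff-++ p (-ₛ p) μ) (trans (+-congˡ (coeff-neg p μ)) (-‿inverseʳ _))

    ≋-trans : ∀ {p q r} → p ≋ q → q ≋ r → p ≋ r
    ≋-trans p≋q q≋r μ = trans (p≋q μ) (q≋r μ)

  polynomialRing : CommutativeRing c e
  polynomialRing = record
    { Carrier = S ; _≈_ = _≋_ ; _+_ = _+ₛ_ ; _*_ = _*ₛ_ ; -_ = -ₛ_ ; 0# = 0ₛ ; 1# = 1ₛ
    ; isCommutativeRing = record
      { isRing = record
        { +-isAbelianGroup = record
          { isGroup = record
            { isMonoid = record
              { isSemigroup = record
                { isMagma = record
                  { isEquivalence = record
                    { refl  = λ μ → refl
                    ; sym   = λ p≋q μ → sym (p≋q μ)
                    ; trans = λ {p} {q} {r} → ≋-trans {p} {q} {r} }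
                  ; ∙-cong = λ {p} {p′} {q} {q′} → +ₛ-cong {p} {p′} {q} {q′} }
                ; assoc = +ₛ-assoc }
              ; identity = (λ p μ → refl) , (λ p → +ₛ-comm p 0ₛ) }
            ; inverse = (λ p → ≋-trans { -ₛ p +ₛ p} {p -ₛ p} {0ₛ} (+ₛ-comm (-ₛ p) p) (-ₛ-inverseʳ p)) ,
              -ₛ-inverseʳ
            ; ⁻¹-cong = λ {p} {q} p≋q μ → trans (coeff-neg p μ)
              (trans (-‿cong (p≋q μ)) (sym (coeff-neg q μ))) }
          ; comm = +ₛ-comm }
        ; *-cong = λ {p} {p′} {q} {q′} p≋p′ q≋q′ μ →
            trans (*ₛ-congʳ {p} {p′} q p≋p′ μ) (trans (*ₛ-comm p′ q μ)
              (trans (*ₛ-congʳ {q} {q′} p′ q≋q′ μ) (*ₛ-comm q′ p′ μ)))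
        ; *-assoc = *ₛ-assoc
        ; *-identity = *ₛ-identityˡ ,
            (λ p → ≋-trans {p *ₛ 1ₛ} {1ₛ *ₛ p} {p} (*ₛ-comm p 1ₛ) (*ₛ-identityˡ p))
        ; distrib = *ₛ-distribˡ , λ p q r μ →
            trans (*ₛ-comm (q +ₛ r) p μ) (trans (*ₛ-distribˡ p q r μ)
              (+ₛ-cong {p *ₛ q} {q *ₛ p} {p *ₛ r} {r *ₛ p} (*ₛ-comm p q) (*ₛ-comm p r) μ)) }
      ; *-comm = *ₛ-comm } }

-- What the argument uses of S, with the ring kept abstract: endomorphisms over K prescribed on the
-- variables, their compatibility with ideals, and `regular`, the only trace of S being a domain.
record SubstitutionRing {a b c e} (K : CommutativeRing a b) (R : CommutativeRing c e) (ℓ : ℕ)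
                        : Set (a ⊔ b ⊔ Level.suc (c ⊔ e)) where
  private module K = CommutativeRing K
  open CommutativeRing R
  open CommutativeRingIdeals R
  field
    const      : K.Carrier → Carrier
    const-cong : ∀ {s t} → s K.≈ t → const s ≈ const t
    const-+    : ∀ s t → const (s K.+ t) ≈ const s + const t
    const-*    : ∀ s t → const (s K.* t) ≈ const s * const t
    const-1    : const K.1# ≈ 1#
    X          : Fin ℓ → Carrier
    ⟪_⟫        : (Fin ℓ → Carrier) → Carrier → Carrier
    ⟪⟫-cong    : ∀ σ {f g} → f ≈ g → ⟪ σ ⟫ f ≈ ⟪ σ ⟫ g
    ⟪⟫-+       : ∀ σ f g → ⟪ σ ⟫ (f + g) ≈ ⟪ σ ⟫ f + ⟪ σ ⟫ g
    ⟪⟫-*       : ∀ σ f g → ⟪ σ ⟫ (f * g) ≈ ⟪ σ ⟫ f * ⟪ σ ⟫ g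
    ⟪⟫-neg     : ∀ σ f → ⟪ σ ⟫ (- f) ≈ - ⟪ σ ⟫ f
    ⟪⟫-const   : ∀ σ s → ⟪ σ ⟫ (const s) ≈ const s
    ⟪⟫-X       : ∀ σ k → ⟪ σ ⟫ (X k) ≈ σ k
    ⟪X⟫        : ∀ f → ⟪ X ⟫ f ≈ f
    ⟪⟫-∘       : ∀ σ τ f → ⟪ σ ⟫ (⟪ τ ⟫ f) ≈ ⟪ ⟪ σ ⟫ ∘ τ ⟫ f
    ⟪⟫-mod     : ∀ {I : Pred Carrier (c ⊔ e)} → IsIdeal I → ∀ σ τ → (∀ k → I (σ k - τ k)) →
                 ∀ f → I (⟪ σ ⟫ f - ⟪ τ ⟫ f)
    regular    : ∀ {k m} → k ≢ m → ∀ {f} → (X k - X m) * f ≈ 0# → f ≈ 0#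

-- The polynomial ring as a ring with substitutions

module Substitution {c e : Level} (K : Field c e) (ℓ : ℕ) where
  open Field K hiding (zero)
  open Arrangements K ℓ hiding (_^_)
  open Monomials ℓ
  open Polynomials K ℓ
  private
    module S = CommutativeRing polynomialRing
  open CommutativeRingIdeals polynomialRing
  open Exp S.semiring using (_^_; ^-homo-*)
  open CommutativeMonoidSum S.*-commutativeMonoid
    renaming (sum to ∏; sum-cong-≋ to ∏-cong; ∑-distrib-+ to ∏-distrib-*) using ()
  open SingleTerm S.*-commutativeMonoid renaming (sum-single to ∏-single; sum-ε to ∏-1)

  const-cong : ∀ {a b} → a ≈ b → const a ≋ const b
  const-cong {a} {b} a≈b = E-ext {const a} {const b} λ φ → +-congʳ (*-congʳ a≈b)

  const-+ : ∀ a b → const (a + b) ≋ const a +ₛ const b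
  const-+ a b = E-ext {const (a + b)} {const a +ₛ const b} λ φ →
    trans (+-congʳ (distribʳ _ a b)) (trans (+-identityʳ _) (+-congˡ (sym (+-identityʳ _))))

  monomial : Monomial → S
  monomial ν = [ (1# , ν) ]

  const-* : ∀ a b → const (a * b) ≋ const a *ₛ const b
  const-* a b = E-ext {const (a * b)} {const a *ₛ const b} λ φ →
    +-congʳ (*-congˡ (reflexive (≡.cong φ (≡.sym (⊕-identityˡ 𝟘)))))

  monomial-⊕ : ∀ μ ν → monomial (μ ⊕ ν) ≋ monomial μ *ₛ monomial ν
  monomial-⊕ μ ν = E-ext {monomial (μ ⊕ ν)} {monomial μ *ₛ monomial ν} λ φ →
    +-congʳ (*-congʳ (sym (*-identityˡ 1#)))

  module _ (σ : Fin ℓ → S) where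

    power : Monomial → S
    power ν = ∏ (λ k → σ k ^ lookup ν k)

    private
      ^-cong : ∀ k {m n} → m ≡ n → σ k ^ m ≋ σ k ^ n
      ^-cong k eq = S.reflexive (≡.cong (σ k ^_) eq)

      power-𝟘 : power 𝟘 ≋ 1ₛ
      power-𝟘 = ∏-1 (λ k → σ k ^ lookup 𝟘 k) (λ k → ^-cong k (lookup-𝟘 k))

      power-⊕ : ∀ μ ν → power (μ ⊕ ν) ≋ power μ *ₛ power ν
      power-⊕ μ ν = S.trans {power (μ ⊕ ν)} {∏ (λ k → σ k ^ lookup μ k *ₛ σ k ^ lookup ν k)}
        {power μ *ₛ power ν}
        (∏-cong (λ k → S.trans {σ k ^ lookup (μ ⊕ ν) k} {σ k ^ (lookup μ k ℕ.+ lookup ν k)}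
          {σ k ^ lookup μ k *ₛ σ k ^ lookup ν k}
                  (^-cong k (lookup-⊕ μ ν k)) (^-homo-* (σ k) (lookup μ k) (lookup ν k))))
        (∏-distrib-* (λ k → σ k ^ lookup μ k) (λ k → σ k ^ lookup ν k))

      power-𝕖 : ∀ k → power (𝕖 k) ≋ σ k
      power-𝕖 k = S.trans {power (𝕖 k)} {σ k ^ lookup (𝕖 k) k} {σ k}
        (∏-single (λ m → σ m ^ lookup (𝕖 k) m) k (λ m m≢k → ^-cong m (lookup-𝕖-other m≢k)))
        (S.trans {σ k ^ lookup (𝕖 k) k} {σ k *ₛ 1ₛ} {σ k} (^-cong k (lookup-𝕖-same k))
          (S.*-identityʳ (σ k)))

    module Substituted = Extension S.+-abelianGroup (λ a ν → const a *ₛ power ν)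
      (λ {a} {b} ν a≈b → S.*-congʳ {power ν} {const a} {const b} (const-cong a≈b))
      (λ a b ν → S.trans {const (a + b) *ₛ power ν} {(const a +ₛ const b) *ₛ power ν}
        {const a *ₛ power ν +ₛ const b *ₛ power ν}
        (S.*-congʳ {power ν} {const (a + b)} {const a +ₛ const b} (const-+ a b))
          (S.distribʳ (power ν) (const a) (const b)))

    subst : S → S
    subst = Substituted.ext

    private
      open SetoidReasoning S.setoid

      subst-term : ∀ a ν → subst [ (a , ν) ] ≋ const a *ₛ power ν
      subst-term a ν = S.+-identityʳ (const a *ₛ power ν)

      subst-termʳ : ∀ a ν q → subst ([ (a , ν) ] *ₛ q) ≋ (const a *ₛ power ν) *ₛ subst q
      subst-termʳ a ν []            = S.sym {(const a *ₛ power ν) *ₛ 0ₛ} {0ₛ} (S.zeroʳ (const a *ₛ power ν))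
      subst-termʳ a ν ((b , κ) ∷ q) = begin
        const (a * b) *ₛ power (ν ⊕ κ) +ₛ subst ([ (a , ν) ] *ₛ q)
          ≈⟨ S.+-cong {const (a * b) *ₛ power (ν ⊕ κ)} {A *ₛ B}
               {subst ([ (a , ν) ] *ₛ q)} {A *ₛ subst q} factor (subst-termʳ a ν q) ⟩
        A *ₛ B +ₛ A *ₛ subst q
          ≈⟨ S.distribˡ A B (subst q) ⟨
        A *ₛ (B +ₛ subst q) ∎
        where
        open import Algebra.Properties.CommutativeSemigroup S.*-commutativeSemigroup using (interchange)
        A = const a *ₛ power ν
        B = const b *ₛ power κ
        factor : const (a * b) *ₛ power (ν ⊕ κ) ≋ A *ₛ B
        factor = begin
          const (a * b) *ₛ power (ν ⊕ κ)
            ≈⟨ S.*-cong {const (a * b)} {const a *ₛ const b} {power (ν ⊕ κ)} {power ν *ₛ power κ}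
                 (const-* a b) (power-⊕ ν κ) ⟩
          (const a *ₛ const b) *ₛ (power ν *ₛ power κ)
            ≈⟨ interchange (const a) (const b) (power ν) (power κ) ⟩
          A *ₛ B ∎

    subst-cong : ∀ {f g} → f ≋ g → subst f ≋ subst g
    subst-cong {f} {g} = Substituted.ext-cong {f} {g}

    subst-+ : ∀ f g → subst (f +ₛ g) ≋ subst f +ₛ subst g
    subst-+ = Substituted.ext-++

    subst-neg : ∀ f → subst (-ₛ f) ≋ -ₛ subst f
    subst-neg = Substituted.ext-neg

    subst-* : ∀ f g → subst (f *ₛ g) ≋ subst f *ₛ subst g
    subst-* []            g = λ μ → refl
    subst-* ((a , ν) ∷ f) g = begin
      subst (h ++ f *ₛ g)
        ≈⟨ S.reflexive (≡.cong (λ q → subst (q ++ f *ₛ g)) (≡.sym (++-identityʳ h))) ⟩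
      subst ([ (a , ν) ] *ₛ g +ₛ f *ₛ g)
        ≈⟨ subst-+ ([ (a , ν) ] *ₛ g) (f *ₛ g) ⟩
      subst ([ (a , ν) ] *ₛ g) +ₛ subst (f *ₛ g)
        ≈⟨ S.+-cong {subst ([ (a , ν) ] *ₛ g)} {A *ₛ subst g} {subst (f *ₛ g)} {subst f *ₛ subst g}
             (subst-termʳ a ν g) (subst-* f g) ⟩
      A *ₛ subst g +ₛ subst f *ₛ subst g
        ≈⟨ S.distribʳ (subst g) A (subst f) ⟨
      (A +ₛ subst f) *ₛ subst g ∎
      where
      open import Data.List.Properties using (++-identityʳ)
      A = const a *ₛ power ν
      h = List.map (λ (b , κ) → a * b , ν ⊕ κ) g

    subst-const : ∀ a → subst (const a) ≋ const a
    subst-const a = begin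
      subst (const a)      ≈⟨ subst-term a 𝟘 ⟩
      const a *ₛ power 𝟘   ≈⟨ S.*-congˡ {const a} {power 𝟘} {1ₛ} power-𝟘 ⟩
      const a *ₛ 1ₛ        ≈⟨ S.*-identityʳ (const a) ⟩
      const a              ∎

    subst-x : ∀ k → subst (x k) ≋ σ k
    subst-x k = begin
      subst (x k)           ≈⟨ subst-term 1# (𝕖 k) ⟩
      1ₛ *ₛ power (𝕖 k)     ≈⟨ S.*-identityˡ (power (𝕖 k)) ⟩
      power (𝕖 k)           ≈⟨ power-𝕖 k ⟩
      σ k                   ∎

    -- Terms of `f` with exponent outside `P` may be present in the list although they cancel.
    -- Deciding `P` suffices to delete them, which changes `f` only up to `_≋_`; no coefficient has
    -- to be tested.
    subst-∈ : ∀ {p q} {I : Pred S p} {P : Pred Monomial q} → IsIdeal I → Decidable P →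
              (∀ ν → P ν → I (power ν)) → ∀ f → (∀ ν → ¬ P ν → coeff f ν ≈ 0#) → I (subst f)
    subst-∈ {I = I} {P} isIdeal P? P⇒I f f≈0 =
      resp (subst-cong {restrict f} {f} restrict≋) (restrict-∈ f)
      where
      open IsIdeal isIdeal
      restrict : S → S
      restrict []            = []
      restrict ((a , ν) ∷ p) = if does (P? ν) then (a , ν) ∷ restrict p else restrict p

      restrict-∈ : ∀ p → I (subst (restrict p))
      restrict-∈ []            = 0∈
      restrict-∈ ((a , ν) ∷ p) = by-cases (P? ν)
        where
        by-cases : (P?ν : Dec (P ν)) → I (subst (if does P?ν then (a , ν) ∷ restrict p else restrict p))
        by-cases (yes Pν) = +-closed {const a *ₛ power ν} {subst (restrict p)}
          (*-closed (const a) {power ν} (P⇒I ν Pν)) (restrict-∈ p)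
        by-cases (no  _)  = restrict-∈ p

      coeff-restrict : ∀ p μ → coeff (restrict p) μ ≈ (if does (P? μ) then coeff p μ else 0#)
      coeff-restrict []            μ with does (P? μ)
      ... | true  = refl
      ... | false = refl
      coeff-restrict ((a , ν) ∷ p) μ with ν ≟ₘ μ
      coeff-restrict ((a , ν) ∷ p) μ | yes ≡.refl with P? ν | coeff-restrict p ν
      ... | yes _ | eq rewrite dec-true (ν ≟ₘ ν) ≡.refl = +-congˡ eq
      ... | no  _ | eq = eq
      coeff-restrict ((a , ν) ∷ p) μ | no ν≢μ with P? ν
      ... | yes _ rewrite dec-false (ν ≟ₘ μ) ν≢μ = coeff-restrict p μ
      ... | no  _ = coeff-restrict p μ

      restrict≋ : restrict f ≋ f
      restrict≋ μ = trans (coeff-restrict f μ) vanishing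
        where
        vanishing : (if does (P? μ) then coeff f μ else 0#) ≈ coeff f μ
        vanishing with P? μ
        ... | yes _  = refl
        ... | no ¬Pμ = sym (f≈0 μ ¬Pμ)

  module _ {p} {I : Pred S p} (isIdeal : IsIdeal I) (σ τ : Fin ℓ → S)
           (σ~τ : ∀ k → I (σ k -ₛ τ k)) where
    private
      module S/I = CommutativeRing (I / isIdeal)

      ^-mod : ∀ k n → S/I._≈_ (σ k ^ n) (τ k ^ n)
      ^-mod k zero    = S/I.refl {1ₛ}
      ^-mod k (suc n) = S/I.*-cong {σ k} {τ k} {σ k ^ n} {τ k ^ n} (σ~τ k) (^-mod k n)

      power-mod : ∀ ν → S/I._≈_ (power σ ν) (power τ ν)
      power-mod ν = CommutativeMonoidSum.sum-cong-≋ S/I.*-commutativeMonoid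
        {x = λ k → σ k ^ lookup ν k} {y = λ k → τ k ^ lookup ν k} (λ k → ^-mod k (lookup ν k))

    subst-mod : ∀ f → S/I._≈_ (subst σ f) (subst τ f)
    subst-mod []            = S/I.refl {0ₛ}
    subst-mod ((a , ν) ∷ f) =
      S/I.+-cong {const a *ₛ power σ ν} {const a *ₛ power τ ν} {subst σ f} {subst τ f}
        (S/I.*-congˡ {const a} {power σ ν} {power τ ν} (power-mod ν)) (subst-mod f)

  private
    sumₘ : ∀ {n} → Vector Monomial n → Monomial
    sumₘ = Vector.foldr _⊕_ 𝟘

    open CommutativeMonoidSum ℕ.+-0-commutativeMonoid using () renaming (sum to sumℕ)

    lookup-sumₘ : ∀ {n} (w : Vector Monomial n) m → lookup (sumₘ w) m ≡ sumℕ (λ k → lookup (w k) m)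
    lookup-sumₘ {zero}  w m = lookup-𝟘 m
    lookup-sumₘ {suc n} w m = ≡.trans (lookup-⊕ (w zero) _ m)
      (≡.cong (lookup (w zero) m ℕ.+_) (lookup-sumₘ (w ∘ suc) m))

    ∏-monomial : ∀ {n} (w : Vector Monomial n) → ∏ (λ k → monomial (w k)) ≋ monomial (sumₘ w)
    ∏-monomial {zero}  w μ = refl
    ∏-monomial {suc n} w = S.trans {∏ (λ k → monomial (w k))}
      {monomial (w zero) *ₛ monomial (sumₘ (w ∘ suc))} {monomial (sumₘ w)}
      (S.*-congˡ {monomial (w zero)} {∏ (λ k → monomial (w (suc k)))} {monomial (sumₘ (w ∘ suc))}
        (∏-monomial (w ∘ suc)))
      (S.sym {monomial (sumₘ w)} {monomial (w zero) *ₛ monomial (sumₘ (w ∘ suc))}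
        (monomial-⊕ (w zero) (sumₘ (w ∘ suc))))

    multiple : Fin ℓ → ℕ → Monomial
    multiple k zero    = 𝟘
    multiple k (suc n) = 𝕖 k ⊕ multiple k n

    lookup-multiple-same : ∀ k n → lookup (multiple k n) k ≡ n
    lookup-multiple-same k zero    = lookup-𝟘 k
    lookup-multiple-same k (suc n) = ≡.trans (lookup-⊕ (𝕖 k) _ k)
      (≡.cong₂ ℕ._+_ (lookup-𝕖-same k) (lookup-multiple-same k n))

    lookup-multiple-other : ∀ {k m} n → m ≢ k → lookup (multiple k n) m ≡ 0
    lookup-multiple-other {m = m} zero    m≢k = lookup-𝟘 m
    lookup-multiple-other {k} {m} (suc n) m≢k = ≡.trans (lookup-⊕ (𝕖 k) _ m)
      (≡.cong₂ ℕ._+_ (lookup-𝕖-other m≢k) (lookup-multiple-other n m≢k))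

    sumₘ-multiple : ∀ ν → sumₘ (λ k → multiple k (lookup ν k)) ≡ ν
    sumₘ-multiple ν = lookup-ext λ m → ≡.trans (lookup-sumₘ (λ k → multiple k (lookup ν k)) m)
      (≡.trans (SingleTerm.sum-single ℕ.+-0-commutativeMonoid (λ k → lookup (multiple k (lookup ν k)) m) m
                 (λ k k≢m → lookup-multiple-other (lookup ν k) (k≢m ∘ ≡.sym)))
               (lookup-multiple-same m (lookup ν m)))

    x^≋ : ∀ k n → x k ^ n ≋ monomial (multiple k n)
    x^≋ k zero    μ = refl
    x^≋ k (suc n) = S.trans {x k *ₛ x k ^ n} {x k *ₛ monomial (multiple k n)}
      {monomial (multiple k (suc n))}
      (S.*-congˡ {x k} {x k ^ n} {monomial (multiple k n)} (x^≋ k n))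
      (S.sym {monomial (multiple k (suc n))} {x k *ₛ monomial (multiple k n)}
        (monomial-⊕ (𝕖 k) (multiple k n)))

    power-x : ∀ ν → power x ν ≋ monomial ν
    power-x ν = S.trans {power x ν} {∏ (λ k → monomial (multiple k (lookup ν k)))} {monomial ν}
      (∏-cong (λ k → x^≋ k (lookup ν k)))
      (S.trans {∏ (λ k → monomial (multiple k (lookup ν k)))}
        {monomial (sumₘ (λ k → multiple k (lookup ν k)))} {monomial ν}
        (∏-monomial (λ k → multiple k (lookup ν k)))
        (S.reflexive (≡.cong monomial (sumₘ-multiple ν))))

  subst-id : ∀ f → subst x f ≋ f
  subst-id []            μ = refl
  subst-id ((a , ν) ∷ f) = S.+-cong {const a *ₛ power x ν} {[ (a , ν) ]} {subst x f} {f} term≋ (subst-id f)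
    where
    term≋ : const a *ₛ power x ν ≋ [ (a , ν) ]
    term≋ = S.trans {const a *ₛ power x ν} {const a *ₛ monomial ν} {[ (a , ν) ]}
      (S.*-congˡ {const a} {power x ν} {monomial ν} (power-x ν))
      (E-ext {const a *ₛ monomial ν} {[ (a , ν) ]} λ φ →
        +-congʳ (*-cong (*-identityʳ a) (reflexive (≡.cong φ (⊕-identityˡ ν)))))

  E-x* : ∀ φ k f → E φ (x k *ₛ f) ≈ E (λ κ → φ (𝕖 k ⊕ κ)) f
  E-x* φ k f = trans (E-* φ (x k) f) (trans (+-identityʳ _) (*-identityˡ _))

  coeff-x*-⊕ : ∀ k f μ → coeff (x k *ₛ f) (𝕖 k ⊕ μ) ≈ coeff f μ
  coeff-x*-⊕ k f μ = trans (coeff≈E (x k *ₛ f) (𝕖 k ⊕ μ)) (trans (E-x* _ k f)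
    (trans (E-congˡ f δ-shift) (sym (coeff≈E f μ))))
    where
    δ-shift : ∀ κ → δ (𝕖 k ⊕ μ) (𝕖 k ⊕ κ) ≈ δ μ κ
    δ-shift κ with κ ≟ₘ μ
    ... | yes ≡.refl rewrite dec-true (𝕖 k ⊕ κ ≟ₘ 𝕖 k ⊕ κ) ≡.refl = refl
    ... | no  κ≢μ rewrite dec-false (𝕖 k ⊕ κ ≟ₘ 𝕖 k ⊕ μ) (κ≢μ ∘ ⊕-cancelˡ (𝕖 k)) = refl

  coeff-x*-0 : ∀ k f μ → lookup μ k ≡ 0 → coeff (x k *ₛ f) μ ≈ 0#
  coeff-x*-0 k f μ μₖ≡0 = trans (coeff≈E (x k *ₛ f) μ) (trans (E-x* _ k f)
    (trans (E-congˡ f δ≈0) (E-0 f)))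
    where
    impossible : ∀ κ → 𝕖 k ⊕ κ ≢ μ
    impossible κ ≡.refl = ℕ.1+n≢0 (≡.trans
      (≡.sym (≡.trans (lookup-⊕ (𝕖 k) κ k) (≡.cong (ℕ._+ lookup κ k) (lookup-𝕖-same k)))) μₖ≡0)
    δ≈0 : ∀ κ → δ μ (𝕖 k ⊕ κ) ≈ 0#
    δ≈0 κ rewrite dec-false (𝕖 k ⊕ κ ≟ₘ μ) (impossible κ) = refl

  -- If x_k f = x_m f, then coeff f μ = coeff f (μ + e_k - e_m), which
  -- decreases the exponent of x_m until the coefficient is visibly zero.
  x-x-regular : ∀ {k m} → k ≢ m → ∀ {f} → (x k -ₛ x m) *ₛ f ≋ 0ₛ → f ≋ 0ₛ
  x-x-regular {k} {m} k≢m {f} eq μ = descend (lookup μ m) μ ≡.refl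
    where
    open RingProperties S.ring using () renaming ([y-z]x≈yx-zx to *-distribʳ-minus)
    open AbelianGroupProperties S.+-abelianGroup using (x∙y⁻¹≈ε⇒x≈y)
    xₖf≋xₘf : x k *ₛ f ≋ x m *ₛ f
    xₖf≋xₘf = x∙y⁻¹≈ε⇒x≈y (x k *ₛ f) (x m *ₛ f)
      (S.trans {x k *ₛ f -ₛ x m *ₛ f} {(x k -ₛ x m) *ₛ f} {0ₛ}
        (S.sym {(x k -ₛ x m) *ₛ f} {x k *ₛ f -ₛ x m *ₛ f} (*-distribʳ-minus f (x k) (x m))) eq)

    lookup-𝕖⊕ : ∀ μ → lookup (𝕖 k ⊕ μ) m ≡ lookup μ m
    lookup-𝕖⊕ μ = ≡.trans (lookup-⊕ (𝕖 k) μ m) (≡.cong (ℕ._+ lookup μ m) (lookup-𝕖-other (k≢m ∘ ≡.sym)))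

    shift : ∀ μ → coeff f μ ≈ coeff (x m *ₛ f) (𝕖 k ⊕ μ)
    shift μ = trans (sym (coeff-x*-⊕ k f μ)) (xₖf≋xₘf (𝕖 k ⊕ μ))

    descend : ∀ n μ → lookup μ m ≡ n → coeff f μ ≈ 0#
    descend zero    μ eq = trans (shift μ) (coeff-x*-0 m f (𝕖 k ⊕ μ) (≡.trans (lookup-𝕖⊕ μ) eq))
    descend (suc n) μ eq with ⊕-complement (𝕖 k ⊕ μ) m (≡.trans (lookup-𝕖⊕ μ) eq)
    ... | ν , eq′ , νₘ≡n = trans (shift μ) (trans (reflexive (≡.cong (coeff (x m *ₛ f)) eq′))
                             (trans (coeff-x*-⊕ m f ν) (descend n ν νₘ≡n)))

  module _ (σ τ : Fin ℓ → S) where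
    private
      open SetoidReasoning S.setoid

      subst-1 : subst σ 1ₛ ≋ 1ₛ
      subst-1 = subst-const σ 1#

      subst-^ : ∀ f n → subst σ (f ^ n) ≋ subst σ f ^ n
      subst-^ f zero    = subst-1
      subst-^ f (suc n) = begin
        subst σ (f *ₛ f ^ n)          ≈⟨ subst-* σ f (f ^ n) ⟩
        subst σ f *ₛ subst σ (f ^ n)  ≈⟨ S.*-congˡ {subst σ f} {subst σ (f ^ n)} {subst σ f ^ n}
            (subst-^ f n) ⟩
        subst σ f *ₛ subst σ f ^ n    ∎

      subst-∏ : ∀ {n} (g : Vector S n) → subst σ (∏ g) ≋ ∏ (subst σ ∘ g)
      subst-∏ {zero}  g = subst-1
      subst-∏ {suc n} g = begin
        subst σ (g zero *ₛ ∏ (g ∘ suc))          ≈⟨ subst-* σ (g zero) (∏ (g ∘ suc)) ⟩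
        subst σ (g zero) *ₛ subst σ (∏ (g ∘ suc)) ≈⟨ S.*-congˡ {subst σ (g zero)} {subst σ (∏ (g ∘ suc))}
            {∏ (subst σ ∘ g ∘ suc)} (subst-∏ (g ∘ suc)) ⟩
        subst σ (g zero) *ₛ ∏ (subst σ ∘ g ∘ suc) ∎

      subst-power : ∀ ν → subst σ (power τ ν) ≋ power (subst σ ∘ τ) ν
      subst-power ν = begin
        subst σ (∏ (λ k → τ k ^ lookup ν k))  ≈⟨ subst-∏ (λ k → τ k ^ lookup ν k) ⟩
        ∏ (λ k → subst σ (τ k ^ lookup ν k))  ≈⟨ ∏-cong (λ k → subst-^ (τ k) (lookup ν k)) ⟩
        power (subst σ ∘ τ) ν                 ∎

    subst-subst : ∀ f → subst σ (subst τ f) ≋ subst (subst σ ∘ τ) f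
    subst-subst []            = λ μ → refl
    subst-subst ((a , ν) ∷ f) = begin
      subst σ (const a *ₛ power τ ν +ₛ subst τ f)
        ≈⟨ subst-+ σ (const a *ₛ power τ ν) (subst τ f) ⟩
      subst σ (const a *ₛ power τ ν) +ₛ subst σ (subst τ f)
        ≈⟨ S.+-cong {subst σ (const a *ₛ power τ ν)} {const a *ₛ power (subst σ ∘ τ) ν}
            {subst σ (subst τ f)} {subst (subst σ ∘ τ) f}
             term (subst-subst f) ⟩
      const a *ₛ power (subst σ ∘ τ) ν +ₛ subst (subst σ ∘ τ) f ∎
      where
      term : subst σ (const a *ₛ power τ ν) ≋ const a *ₛ power (subst σ ∘ τ) ν
      term = begin
        subst σ (const a *ₛ power τ ν)           ≈⟨ subst-* σ (const a) (power τ ν) ⟩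
        subst σ (const a) *ₛ subst σ (power τ ν)
          ≈⟨ S.*-cong {subst σ (const a)} {const a} {subst σ (power τ ν)} {power (subst σ ∘ τ) ν}
              (subst-const σ a) (subst-power ν) ⟩
        const a *ₛ power (subst σ ∘ τ) ν         ∎

  substitutionRing : SubstitutionRing commutativeRing polynomialRing ℓ
  substitutionRing = record
    { const      = const
    ; const-cong = const-cong
    ; const-+    = const-+
    ; const-*    = const-*
    ; const-1    = λ μ → refl
    ; X          = x
    ; ⟪_⟫        = subst
    ; ⟪⟫-cong    = λ σ {f} {g} → subst-cong σ {f} {g}
    ; ⟪⟫-+       = subst-+
    ; ⟪⟫-*       = subst-*
    ; ⟪⟫-neg     = subst-neg
    ; ⟪⟫-const   = subst-const
    ; ⟪⟫-X       = subst-x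
    ; ⟪X⟫        = subst-id
    ; ⟪⟫-∘       = subst-subst
    ; ⟪⟫-mod     = subst-mod
    ; regular    = λ k≢m {f} → x-x-regular k≢m {f}
    }

-- Identification of two vertices

merge : ∀ {n} → Fin n → Fin n → Fin n → Fin n
merge a b k = if does (k Fin.≟ a) then b else k

merge-same : ∀ {n} (a b : Fin n) → merge a b a ≡ b
merge-same a b rewrite dec-true (a Fin.≟ a) ≡.refl = ≡.refl

merge-other : ∀ {n} {a : Fin n} b {k} → k ≢ a → merge a b k ≡ k
merge-other {a = a} b {k} k≢a rewrite dec-false (k Fin.≟ a) k≢a = ≡.refl

merge-target : ∀ {n} (a b : Fin n) → merge a b b ≡ b
merge-target a b with does (b Fin.≟ a)
... | true  = ≡.refl
... | false = ≡.refl

merge-avoids : ∀ {n} {a b : Fin n} → b ≢ a → ∀ k → merge a b k ≢ a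
merge-avoids {a = a} b≢a k with k Fin.≟ a
... | yes _   = b≢a
... | no  k≢a = k≢a

SamePair : ∀ {n} (a b p q : Fin n) → Set
SamePair a b p q = (a ≡ p × b ≡ q) ⊎ (a ≡ q × b ≡ p)

merge-separates : ∀ {n} {a b p q : Fin n} → p ≢ q → ¬ SamePair p q a b → merge a b p ≢ merge a b q
merge-separates {a = a} {b} {p} {q} p≢q ¬same with p Fin.≟ a | q Fin.≟ a
... | yes p≡a | yes q≡a = λ _   → p≢q (≡.trans p≡a (≡.sym q≡a))
... | yes p≡a | no  _   = λ b≡q → ¬same (inj₁ (p≡a , ≡.sym b≡q))
... | no  _   | yes q≡a = λ p≡b → ¬same (inj₂ (p≡b , q≡a))
... | no  _   | no  _   = p≢q

-- Divisibility by differences of variables, and clique forms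

module Differences {a b c e} {K : CommutativeRing a b} {R : CommutativeRing c e} {ℓ : ℕ}
                   (P : SubstitutionRing K R ℓ) where
  open CommutativeRing R hiding (zero)
  open CommutativeRingIdeals R
  open Solver R
  open SubstitutionRing P
  open AbelianGroupProperties +-abelianGroup using (x∙y⁻¹≈ε⇒x≈y; ε⁻¹≈ε)
  open CommutativeMonoidSum *-commutativeMonoid public
    using () renaming (sum to ∏; sum-cong-≋ to ∏-cong; ∑-distrib-+ to ∏-distrib-*)
  open SingleTerm *-commutativeMonoid public using () renaming (sum-single to ∏-single)
  open SetoidReasoning setoid

  ∣-refl : ∀ d → d ∣ d
  ∣-refl d = 1# , sym (*-identityˡ d)

  ∣-respˡ : ∀ {d d′ f} → d ≈ d′ → d ∣ f → d′ ∣ f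
  ∣-respˡ d≈d′ (h , eq) = h , trans eq (*-congˡ d≈d′)

  ∣-resp : ∀ {d f g} → f ≈ g → d ∣ f → d ∣ g
  ∣-resp {d} f≈g d∣f = IsIdeal.resp (∣-isIdeal d) f≈g d∣f

  ∣-*ˡ : ∀ {d f} h → d ∣ f → d ∣ h * f
  ∣-*ˡ {d} h d∣f = IsIdeal.*-closed (∣-isIdeal d) h d∣f

  ∣-*ʳ : ∀ {d f} h → d ∣ f → d ∣ f * h
  ∣-*ʳ {d} {f} h d∣f = ∣-resp (*-comm h f) (∣-*ˡ h d∣f)

  ≈⇒~ : ∀ {d f g} → f ≈ g → d ∣ (f - g)
  ≈⇒~ {d} {f} {g} f≈g = 0# , trans (trans (+-congʳ f≈g) (-‿inverseʳ g)) (sym (zeroˡ d))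

  ∣-swap : ∀ {f g h} → (f - g) ∣ h → (g - f) ∣ h
  ∣-swap {f} {g} {h} (k , eq) = - k , trans eq
    (solve 3 (λ f g k → k :* (f :- g) := :- k :* (g :- f)) refl f g k)

  ∣-∏ : ∀ {n} (g : Vector Carrier n) k → g k ∣ ∏ g
  ∣-∏ g zero    = ∣-*ʳ _ (∣-refl (g zero))
  ∣-∏ g (suc k) = ∣-*ˡ _ (∣-∏ (g ∘ suc) k)

  ∏-∣-∏ : ∀ {n} (f g : Vector Carrier n) → (∀ k → f k ∣ g k) → ∏ f ∣ ∏ g
  ∏-∣-∏ {zero}  f g f∣g = ∣-refl 1#
  ∏-∣-∏ {suc n} f g f∣g =
    let h , g₀≈ = f∣g zero
        k , ∏≈  = ∏-∣-∏ (f ∘ suc) (g ∘ suc) (f∣g ∘ suc)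
    in h * k , trans (*-cong g₀≈ ∏≈) (interchange h (f zero) k _)
    where open import Algebra.Properties.CommutativeSemigroup *-commutativeSemigroup using (interchange)

  -- That is, `g` is a non-zero-divisor modulo `d`.
  CoprimeTo : Carrier → Pred Carrier _
  CoprimeTo d g = ∀ {f} → d ∣ g * f → d ∣ f

  coprime-1 : ∀ {d} → CoprimeTo d 1#
  coprime-1 = ∣-resp (*-identityˡ _)

  coprime-∏ : ∀ {n d} (g : Vector Carrier n) → (∀ k → CoprimeTo d (g k)) → CoprimeTo d (∏ g)
  coprime-∏ {zero}  g coprime d∣f = coprime-1 d∣f
  coprime-∏ {suc n} g coprime d∣f =
    coprime-∏ (g ∘ suc) (coprime ∘ suc) (coprime zero (∣-resp (*-assoc _ _ _) d∣f))

  -- If f is h times the product of the tail, then the head divides h, because the tail is a product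
  -- of non-zero-divisors modulo the head.
  ∏-∣ : ∀ {n} (g : Vector Carrier n) → (∀ k m → k ≢ m → CoprimeTo (g k) (g m)) →
        ∀ {f} → (∀ k → g k ∣ f) → ∏ g ∣ f
  ∏-∣ {zero}  g coprime {f} g∣f = f , sym (*-identityʳ f)
  ∏-∣ {suc n} g coprime {f} g∣f
    with ∏-∣ (g ∘ suc) (λ k m k≢m → coprime (suc k) (suc m) (k≢m ∘ Fin.suc-injective)) (g∣f ∘ suc)
  ... | h , f≈h∏ with coprime-∏ (g ∘ suc) (λ k → coprime zero (suc k) λ ())
                        (∣-resp (trans f≈h∏ (*-comm _ _)) (g∣f zero))
  ...   | h′ , h≈ = h′ , trans f≈h∏ (trans (*-congʳ h≈) (*-assoc _ _ _))

  Regular : Pred Carrier _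
  Regular f = ∀ {g} → f * g ≈ 0# → g ≈ 0#

  regular-1 : Regular 1#
  regular-1 = trans (sym (*-identityˡ _))

  regular-* : ∀ {f g} → Regular f → Regular g → Regular (f * g)
  regular-* reg-f reg-g eq = reg-g (reg-f (trans (sym (*-assoc _ _ _)) eq))

  regular-∏ : ∀ {n} (g : Vector Carrier n) → (∀ k → Regular (g k)) → Regular (∏ g)
  regular-∏ {zero}  g reg = regular-1
  regular-∏ {suc n} g reg = regular-* (reg zero) (regular-∏ (g ∘ suc) (reg ∘ suc))

  regular-resp : ∀ {f g} → f ≈ g → Regular f → Regular g
  regular-resp f≈g reg eq = reg (trans (*-congʳ f≈g) eq)

  Unit : Pred Carrier _
  Unit f = ∃ λ g → g * f ≈ 1#

  regular-unit : ∀ {u} → Unit u → Regular u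
  regular-unit {u} (v , vu≈1) {g} ug≈0 = begin
    g           ≈⟨ *-identityˡ g ⟨
    1# * g      ≈⟨ *-congʳ vu≈1 ⟨
    v * u * g   ≈⟨ *-assoc v u g ⟩
    v * (u * g) ≈⟨ *-congˡ ug≈0 ⟩
    v * 0#      ≈⟨ zeroʳ v ⟩
    0#          ∎

  cancelˡ : ∀ {f} → Regular f → ∀ {g h} → f * g ≈ f * h → g ≈ h
  cancelˡ {f} reg {g} {h} eq = x∙y⁻¹≈ε⇒x≈y g h (reg (begin
    f * (g - h)   ≈⟨ solve 3 (λ f g h → f :* (g :- h) := f :* g :- f :* h) refl f g h ⟩
    f * g - f * h ≈⟨ +-congʳ eq ⟩
    f * h - f * h ≈⟨ -‿inverseʳ _ ⟩
    0#            ∎))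

  ⟪⟫-1 : ∀ σ → ⟪ σ ⟫ 1# ≈ 1#
  ⟪⟫-1 σ = trans (⟪⟫-cong σ (sym const-1)) (trans (⟪⟫-const σ _) const-1)

  ⟪⟫-minus : ∀ σ f g → ⟪ σ ⟫ (f - g) ≈ ⟪ σ ⟫ f - ⟪ σ ⟫ g
  ⟪⟫-minus σ f g = trans (⟪⟫-+ σ f (- g)) (+-congˡ (⟪⟫-neg σ g))

  ⟪⟫-0 : ∀ σ → ⟪ σ ⟫ 0# ≈ 0#
  ⟪⟫-0 σ = trans (⟪⟫-cong σ (sym (-‿inverseʳ 0#))) (trans (⟪⟫-minus σ 0# 0#) (-‿inverseʳ _))

  ⟪⟫-X-X : ∀ σ k m → ⟪ σ ⟫ (X k - X m) ≈ σ k - σ m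
  ⟪⟫-X-X σ k m = trans (⟪⟫-minus σ (X k) (X m)) (+-cong (⟪⟫-X σ k) (-‿cong (⟪⟫-X σ m)))

  ⟪⟫-unit : ∀ σ {u} → Unit u → Unit (⟪ σ ⟫ u)
  ⟪⟫-unit σ (v , vu≈1) = ⟪ σ ⟫ v , trans (sym (⟪⟫-* σ v _)) (trans (⟪⟫-cong σ vu≈1) (⟪⟫-1 σ))

  ∣⇒vanishes : ∀ a b {f} → (X a - X b) ∣ f → ⟪ X ∘ merge a b ⟫ f ≈ 0#
  ∣⇒vanishes a b {f} (h , f≈) = begin
    ⟪ σ ⟫ f                                       ≈⟨ ⟪⟫-cong σ f≈ ⟩
    ⟪ σ ⟫ (h * (X a - X b))                       ≈⟨ ⟪⟫-* σ h _ ⟩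
    ⟪ σ ⟫ h * ⟪ σ ⟫ (X a - X b)                   ≈⟨ *-congˡ (⟪⟫-X-X σ a b) ⟩
    ⟪ σ ⟫ h * (X (merge a b a) - X (merge a b b)) ≡⟨ ≡.cong₂ (λ k m → ⟪ σ ⟫ h * (X k - X m))
      (merge-same a b) (merge-target a b) ⟩
    ⟪ σ ⟫ h * (X b - X b)                         ≈⟨ *-congˡ (-‿inverseʳ (X b)) ⟩
    ⟪ σ ⟫ h * 0#                                  ≈⟨ zeroʳ _ ⟩
    0#                                            ∎
    where σ = X ∘ merge a b

  merge-mod : ∀ {I : Pred Carrier (c ⊔ e)} → IsIdeal I → ∀ κ → (∀ k → I (X k - X (κ k))) →
              ∀ f → I (f - ⟪ X ∘ κ ⟫ f)
  merge-mod isIdeal κ moved f =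
    IsIdeal.resp isIdeal (+-congʳ (⟪X⟫ f)) (⟪⟫-mod isIdeal X (X ∘ κ) moved f)

  ~-merge : ∀ a b f → (X a - X b) ∣ (f - ⟪ X ∘ merge a b ⟫ f)
  ~-merge a b = merge-mod (∣-isIdeal (X a - X b)) (merge a b) moved
    where
    moved : ∀ k → (X a - X b) ∣ (X k - X (merge a b k))
    moved k with k Fin.≟ a
    ... | yes ≡.refl = ∣-refl _
    ... | no  _      = 0# , trans (-‿inverseʳ (X k)) (sym (zeroˡ _))

  vanishes⇒∣ : ∀ a b {f} → ⟪ X ∘ merge a b ⟫ f ≈ 0# → (X a - X b) ∣ f
  vanishes⇒∣ a b {f} eq = ∣-resp (trans (+-congˡ (trans (-‿cong eq) ε⁻¹≈ε)) (+-identityʳ f)) (~-merge a b f)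

  -- Setting x_a equal to x_b turns divisibility by x_a - x_b into vanishing. It keeps the images of
  -- `p` and `q` apart, so the image of x_p - x_q can be cancelled by `regular`.
  prime : ∀ {a b p q} → p ≢ q → ¬ SamePair p q a b → CoprimeTo (X a - X b) (X p - X q)
  prime {a} {b} {p} {q} p≢q ¬same {f} d∣ = vanishes⇒∣ a b (regular (merge-separates p≢q ¬same) (begin
    (X (merge a b p) - X (merge a b q)) * ⟪ σ ⟫ f ≈⟨ *-congʳ (⟪⟫-X-X σ p q) ⟨
    ⟪ σ ⟫ (X p - X q) * ⟪ σ ⟫ f                   ≈⟨ ⟪⟫-* σ _ f ⟨
    ⟪ σ ⟫ ((X p - X q) * f)                       ≈⟨ ∣⇒vanishes a b d∣ ⟩
    0#                                            ∎))
    where σ = X ∘ merge a b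

  Logarithmic : Fin ℓ → Fin ℓ → Pred (Vector Carrier ℓ) _
  Logarithmic p q η =
    (∀ k → k ≢ p → k ≢ q → (X p - X q) ∣ η k) × (X p - X q) ∣ (η p + η q)

  -- Q times the form Σ_{a ∈ C} dx_a / ∏_{k ∈ C, k ≠ a} (x_a - x_k), for a clique C.
  module CliqueForm {C : Pred (Fin ℓ) Level.zero} (C? : Decidable C) {Q : Carrier}
                    (differences∣Q : ∀ {p q} → C p → C q → p ≢ q → (X p - X q) ∣ Q) where

    -- The value 1 outside `C` and at `a` itself lets the product over the other members of the
    -- clique run over all of `Fin ℓ`.
    factor : Fin ℓ → Fin ℓ → Carrier
    factor a k = if does (C? k) then (if does (k Fin.≟ a) then 1# else X a - X k) else 1#

    denominator : Fin ℓ → Carrier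
    denominator a = ∏ (factor a)

    factor-elim : ∀ {p} (T : Pred Carrier p) a k → T 1# → (C k → k ≢ a → T (X a - X k)) → T (factor a k)
    factor-elim T a k t₁ t with C? k
    ... | no  _  = t₁
    ... | yes Ck with k Fin.≟ a
    ...   | yes _   = t₁
    ...   | no  k≢a = t Ck k≢a

    -- For fixed `a` the non-trivial factors are pairwise coprime, so it is enough that each of them
    -- divides `Q`.
    denominator∣Q : ∀ {a} → C a → denominator a ∣ Q
    denominator∣Q {a} Ca = ∏-∣ (factor a)
      (λ k m k≢m → factor-elim (λ g → CoprimeTo g (factor a m)) a k
        (λ {f} _ → f , sym (*-identityʳ f))
        (λ _ k≢a → factor-elim (CoprimeTo (X a - X k)) a m coprime-1
          (λ _ m≢a → prime (m≢a ∘ ≡.sym)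
            [ (λ (_ , m≡k) → k≢m (≡.sym m≡k)) , (λ (a≡k , _) → k≢a (≡.sym a≡k)) ]′)))
      (λ k → factor-elim (_∣ Q) a k (Q , sym (*-identityʳ Q))
        (λ Ck k≢a → differences∣Q Ca Ck (k≢a ∘ ≡.sym)))

    private
      quotient : ∀ a → Dec (C a) → Carrier
      quotient a (yes Ca) = proj₁ (denominator∣Q Ca)
      -- The form has no dx_a component for `a` outside the clique.
      quotient a (no  _)  = 0#

      quotient-in : ∀ {a} (d : Dec (C a)) → C a → Q ≈ quotient a d * denominator a
      quotient-in (yes Ca)  _  = proj₂ (denominator∣Q Ca)
      quotient-in (no  ¬Ca) Ca = contradiction Ca ¬Ca

      quotient-out : ∀ {a} (d : Dec (C a)) → ¬ C a → quotient a d ≈ 0#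
      quotient-out (yes Ca) ¬Ca = contradiction Ca ¬Ca
      quotient-out (no  _)  _   = refl

    η : Vector Carrier ℓ
    η a = quotient a (C? a)

    η-in : ∀ {a} → C a → Q ≈ η a * denominator a
    η-in {a} = quotient-in (C? a)

    η-out : ∀ {a} → ¬ C a → η a ≈ 0#
    η-out {a} = quotient-out (C? a)

    private
      -- Q is η_k times the denominator of dx_k. When no factor of that denominator is x_p - x_q up
      -- to sign, the whole divisibility of Q falls on η_k.
      ∣η : ∀ {p q} k → (X p - X q) ∣ Q → (C k → ∀ m → C m → m ≢ k → ¬ SamePair k m p q) → (X p - X q) ∣ η k
      ∣η {p} {q} k d∣Q ¬same with C? k
      ... | no  _  = 0# , sym (zeroˡ _)
      ... | yes Ck = coprime-∏ (factor k)
        (λ m → factor-elim (CoprimeTo (X p - X q)) k m coprime-1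
                 (λ Cm m≢k → prime (m≢k ∘ ≡.sym) (¬same Ck m Cm m≢k)))
        (∣-resp (trans (proj₂ (denominator∣Q Ck)) (*-comm _ _)) d∣Q)

      denominator-without : Fin ℓ → Fin ℓ → Carrier
      denominator-without a b = ∏ (λ k → if does (k Fin.≟ b) then 1# else factor a k)

      denominator-split : ∀ {a b} → C b → b ≢ a → denominator a ≈ (X a - X b) * denominator-without a b
      denominator-split {a} {b} Cb b≢a = begin
        ∏ (factor a)
          ≈⟨ ∏-cong pointwise ⟩
        ∏ (λ k → single k * (if does (k Fin.≟ b) then 1# else factor a k))
          ≈⟨ ∏-distrib-* single _ ⟩
        ∏ single * denominator-without a b
          ≈⟨ *-congʳ (trans (∏-single single b single-other) (single-same)) ⟩
        (X a - X b) * denominator-without a b ∎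
        where
        single : Fin ℓ → Carrier
        single k = if does (k Fin.≟ b) then X a - X b else 1#
        single-same : single b ≈ X a - X b
        single-same rewrite dec-true (b Fin.≟ b) ≡.refl = refl
        single-other : ∀ k → k ≢ b → single k ≈ 1#
        single-other k k≢b rewrite dec-false (k Fin.≟ b) k≢b = refl
        pointwise : ∀ k → factor a k ≈ single k * (if does (k Fin.≟ b) then 1# else factor a k)
        pointwise k with k Fin.≟ b
        ... | no  _      = sym (*-identityˡ _)
        ... | yes ≡.refl rewrite dec-true (C? k) Cb | dec-false (k Fin.≟ a) b≢a = sym (*-identityʳ _)

      -- Factor by factor, x_p - x_k and x_q - x_k agree modulo x_p - x_q.
      denominator-without-~ : ∀ p q → (X p - X q) ∣ (denominator-without p q - denominator-without q p)
      denominator-without-~ p q = CommutativeMonoidSum.sum-cong-≋ R/d.*-commutativeMonoid pointwise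
        where
        module R/d = CommutativeRing (((X p - X q) ∣_) / ∣-isIdeal (X p - X q))
        pointwise : ∀ k → (if does (k Fin.≟ q) then 1# else factor p k)
                  R/d.≈ (if does (k Fin.≟ p) then 1# else factor q k)
        pointwise k with C? k | k Fin.≟ q | k Fin.≟ p
        ... | yes _ | yes _ | yes _ = R/d.refl
        ... | yes _ | yes _ | no  _ = R/d.refl
        ... | yes _ | no  _ | yes _ = R/d.refl
        ... | yes _ | no  _ | no  _ = R/d.+-congʳ (∣-refl _)
        ... | no  _ | yes _ | yes _ = R/d.refl
        ... | no  _ | yes _ | no  _ = R/d.refl
        ... | no  _ | no  _ | yes _ = R/d.refl
        ... | no  _ | no  _ | no  _ = R/d.refl

      -- The poles along `x_p = x_q` cancel. From Q = η_p (x_p - x_q) D = η_q (x_q - x_p) D′ one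
      -- gets η_p D = - η_q D′, hence D (η_p + η_q) = η_q (D - D′), which is 0 modulo x_p - x_q; and
      -- D is coprime to x_p - x_q.
      ∣ηp+ηq : ∀ {p q} → C p → C q → p ≢ q → (X p - X q) ∣ (η p + η q)
      ∣ηp+ηq {p} {q} Cp Cq p≢q = coprime-∏ _ coprime (∣-resp sum≈ (∣-*ˡ (η q) (denominator-without-~ p q)))
        where
        D D′ : Carrier
        D  = denominator-without p q
        D′ = denominator-without q p

        opposite : η p * D ≈ - (η q * D′)
        opposite = cancelˡ (regular p≢q) (begin
          (X p - X q) * (η p * D)     ≈⟨ x∙yz≈y∙xz _ _ _ ⟩
          η p * ((X p - X q) * D)     ≈⟨ *-congˡ (denominator-split Cq (p≢q ∘ ≡.sym)) ⟨
          η p * denominator p         ≈⟨ η-in Cp ⟨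
          Q                           ≈⟨ η-in Cq ⟩
          η q * denominator q         ≈⟨ *-congˡ (denominator-split Cp p≢q) ⟩
          η q * ((X q - X p) * D′)    ≈⟨ solve 4
              (λ x y n d → n :* ((y :- x) :* d) := (x :- y) :* :- (n :* d)) refl (X p) (X q) (η q) D′ ⟩
          (X p - X q) * - (η q * D′)  ∎)
          where open import Algebra.Properties.CommutativeSemigroup *-commutativeSemigroup using (x∙yz≈y∙xz)

        sum≈ : η q * (D - D′) ≈ D * (η p + η q)
        sum≈ = begin
          η q * (D - D′)              ≈⟨ solve 3 (λ n d d′ → n :* (d :- d′) := :- (n :* d′) :+ d :* n) refl
              (η q) D D′ ⟩
          - (η q * D′) + D * η q      ≈⟨ +-congʳ opposite ⟨
          η p * D + D * η q           ≈⟨ solve 3 (λ m n d → m :* d :+ d :* n := d :* (m :+ n)) refl (η p)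
              (η q) D ⟩
          D * (η p + η q)             ∎

        coprime : ∀ k → CoprimeTo (X p - X q) (if does (k Fin.≟ q) then 1# else factor p k)
        coprime k with k Fin.≟ q
        ... | yes _   = coprime-1
        ... | no  k≢q = factor-elim (CoprimeTo (X p - X q)) p k coprime-1
          (λ _ k≢p → prime (k≢p ∘ ≡.sym) [ (λ (_ , k≡q) → k≢q k≡q) , (λ (p≡q , _) → p≢q p≡q) ]′)

    -- Cancellation is needed only when both endpoints lie in the clique. Otherwise at least one of
    -- η_p and η_q is zero, and the denominator belonging to the other has no factor x_p - x_q.
    η-logarithmic : ∀ {p q} → p ≢ q → (X p - X q) ∣ Q → Logarithmic p q η
    η-logarithmic {p} {q} p≢q d∣Q =
      (λ k k≢p k≢q → ∣η k d∣Q (λ _ m _ _ → [ (λ (k≡p , _) → k≢p k≡p) , (λ (k≡q , _) → k≢q k≡q) ]′))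
      , sum-divisible (C? p) (C? q)
      where
      sum-divisible : Dec (C p) → Dec (C q) → (X p - X q) ∣ (η p + η q)
      sum-divisible (yes Cp) (yes Cq) = ∣ηp+ηq Cp Cq p≢q
      sum-divisible (no ¬Cp) _        = IsIdeal.+-closed (∣-isIdeal _)
        (IsIdeal.resp (∣-isIdeal _) (sym (η-out ¬Cp)) (IsIdeal.0∈ (∣-isIdeal _)))
        (∣η q d∣Q (λ _ m Cm _ → [ (λ (q≡p , _) → p≢q (≡.sym q≡p)) , (λ { (_ , ≡.refl) → ¬Cp Cm }) ]′))
      sum-divisible _        (no ¬Cq) = IsIdeal.+-closed (∣-isIdeal _)
        (∣η p d∣Q (λ _ m Cm _ → [ (λ { (_ , ≡.refl) → ¬Cq Cm }) , (λ (p≡q , _) → p≢q p≡q) ]′))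
        (IsIdeal.resp (∣-isIdeal _) (sym (η-out ¬Cq)) (IsIdeal.0∈ (∣-isIdeal _)))

samePair? : ∀ {n} (a b p q : Fin n) → Dec (SamePair a b p q)
samePair? a b p q = (a Fin.≟ p ×-dec b Fin.≟ q) ⊎-dec (a Fin.≟ q ×-dec b Fin.≟ p)

merge-identifies : ∀ {n} {a b p q : Fin n} → p ≢ q → merge a b p ≡ merge a b q → SamePair p q a b
merge-identifies {a = a} {b} {p} {q} p≢q eq with samePair? p q a b
... | yes same = same
... | no ¬same = contradiction eq (merge-separates p≢q ¬same)

merge-fibre : ∀ {n} {a b k m : Fin n} → m ≢ b → merge a b k ≡ m → k ≡ m
merge-fibre {a = a} {b} {k} m≢b eq with k Fin.≟ a
... | yes _ = contradiction (≡.sym eq) m≢b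
... | no  _ = eq

merge-fibre-target : ∀ {n} {a b k : Fin n} → merge a b k ≡ b → k ≡ a ⊎ k ≡ b
merge-fibre-target {a = a} {b} {k} eq with k Fin.≟ a
... | yes k≡a = inj₁ k≡a
... | no  _   = inj₂ eq

adjacent-distinct : ∀ {n} (G : SimpleGraph n) → ∀ {p q} → SimpleGraph.Adj G p q → p ≢ q
adjacent-distinct G pq p≡q = SimpleGraph.irreflexive G p≡q pq

-- Logarithmic forms and residues along x_i = x_j

module ResidueAlong {a b c e} {K : CommutativeRing a b} {R : CommutativeRing c e} {ℓ : ℕ}
                    (P : SubstitutionRing K R ℓ)
                    (1≉0 : ¬ CommutativeRing._≈_ R (CommutativeRing.1# R) (CommutativeRing.0# R))
                    (G : SimpleGraph ℓ) {i j : Fin ℓ} (ij : SimpleGraph.Adj G i j) where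
  open CommutativeRing R hiding (zero)
  open SimpleGraph G using (Adj; adj?; symmetric)
  open CommutativeRingIdeals R
  open Solver R
  open SubstitutionRing P
  open Differences P
  open SetoidReasoning setoid

  private
    i≢j : i ≢ j
    i≢j = adjacent-distinct G ij

    d : Carrier
    d = X i - X j

    module R/d = CommutativeRing ((d ∣_) / ∣-isIdeal d)

  -- The substitution `X ∘ κ` is restriction to H, with S/(x_i - x_j) identified with the
  -- polynomials that do not involve x_j.
  κ : Fin ℓ → Fin ℓ
  κ = merge j i

  κ≢j : ∀ k → κ k ≢ j
  κ≢j = merge-avoids i≢j

  -- A defining form of a member of 𝓐ᴴ is given by a form on V, which is determined only modulo x_i
  -- - x_j and up to a scalar; hence the restriction and the unit.
  Difference : Carrier → Fin ℓ → Fin ℓ → Set _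
  Difference f p q = ∃ λ u → Unit u × ⟪ X ∘ κ ⟫ f ≈ u * (X p - X q)

  EdgeForm : Pred Carrier _
  EdgeForm f = ∃₂ λ p q → Adj p q × κ p ≢ κ q × Difference f (κ p) (κ q)

  product : List Carrier → Carrier
  product = List.foldr _*_ 1#

  ~-restriction : ∀ f → f R/d.≈ ⟪ X ∘ κ ⟫ f
  ~-restriction f = ∣-swap (~-merge j i f)

  -- For different pairs, primality would make x_{p′} - x_{q′} divide the unit `u`; setting x_{p′}
  -- equal to x_{q′} would then give 1 = 0.
  difference-unique : ∀ {f p q p′ q′} → p ≢ q → p′ ≢ q′ →
                      Difference f p q → Difference f p′ q′ → SamePair p q p′ q′
  difference-unique {f} {p} {q} {p′} {q′} p≢q p′≢q′ (u , unit@(v , vu≈1) , eq) (u′ , _ , eq′)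
    with samePair? p q p′ q′
  ... | yes same = same
  ... | no ¬same = contradiction 1≈0 1≉0
    where
    ∣u : (X p′ - X q′) ∣ u
    ∣u = prime p≢q ¬same (u′ , trans (*-comm _ _) (trans (sym eq) eq′))
    1≈0 : 1# ≈ 0#
    1≈0 = trans (sym (proj₂ (⟪⟫-unit (X ∘ merge p′ q′) unit)))
                (trans (*-congˡ (∣⇒vanishes p′ q′ ∣u)) (zeroʳ _))

  Common : Pred (Fin ℓ) Level.zero
  Common k = Adj k i × Adj k j

  common? : Decidable Common
  common? k = adj? k i ×-dec adj? k j

  -- For a common neighbour k the edges {i , k} and {j , k} share one factor of Q(𝓐ᴴ). This is the
  -- factor that a lift of Q(𝓐ᴴ) then lacks.
  commonFactor : Vector Carrier ℓ
  commonFactor k = if does (common? k) then X i - X k else 1#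

  private
    ∣commonProduct : ∀ {k} → Common k → (X i - X k) ∣ ∏ commonFactor
    ∣commonProduct {k} Wk = ∣-respˡ (commonFactor≈ k Wk) (∣-∏ commonFactor k)
      where
      commonFactor≈ : ∀ k → Common k → commonFactor k ≈ X i - X k
      commonFactor≈ k Wk rewrite dec-true (common? k) Wk = refl

    -- Only {i , m} and {j , m} can restrict to x_i - x_m. If {j , m} is an edge, the lift x_j - x_m
    -- takes care of it, and if {i , m} is an edge too, then `m` is common and x_i - x_m occurs in
    -- `∏ commonFactor`. If {j , m} is not an edge, x_i - x_m itself will do.
    lift-from-i : ∀ {m} → m ≢ i → m ≢ j → ∃ λ g → g R/d.≈ (X i - X m) ×
                  (∀ {p} → Adj p m → κ p ≡ i → (X p - X m) ∣ ∏ commonFactor * g)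
    lift-from-i {m} m≢i m≢j with adj? m j
    ... | yes mj = X j - X m
                 , (- 1# , trans (solve 3 (λ i j m → (j :- m) :- (i :- m) := :- (i :- j)) refl (X i) (X j)
                   (X m))
                                 (sym (-1*x≈-x d)))
                 , λ {p} pm κp≡i → [ (λ { ≡.refl → ∣-*ˡ _ (∣-refl _) })
                                   , (λ { ≡.refl → ∣-*ʳ _ (∣commonProduct (symmetric pm , mj)) }) ]′
                                   (merge-fibre-target {k = p} κp≡i)
      where open RingProperties ring using (-1*x≈-x)
    ... | no ¬mj = X i - X m , R/d.refl
                 , λ {p} pm κp≡i → [ (λ { ≡.refl → contradiction (symmetric pm) ¬mj })
                                   , (λ { ≡.refl → ∣-*ˡ _ (∣-refl _) }) ]′
                                   (merge-fibre-target {k = p} κp≡i)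

    lift-difference : ∀ {a b} → a ≢ b → a ≢ j → b ≢ j → ∃ λ g → g R/d.≈ (X a - X b) ×
                      (∀ {p q} → Adj p q → κ p ≡ a → κ q ≡ b → (X p - X q) ∣ ∏ commonFactor * g)
    lift-difference {a} {b} a≢b a≢j b≢j with a Fin.≟ i | b Fin.≟ i
    ... | yes ≡.refl | _ with lift-from-i (a≢b ∘ ≡.sym) b≢j
    ...   | g , g~ , divides = g , g~ , λ {p} {q} pq κp≡i κq≡b →
            ≡.subst (λ q → (X p - X q) ∣ _) (≡.sym (merge-fibre (a≢b ∘ ≡.sym) κq≡b))
              (divides (≡.subst (Adj p) (merge-fibre (a≢b ∘ ≡.sym) κq≡b) pq) κp≡i)
    lift-difference {a} {b} a≢b a≢j b≢j | no a≢i | yes ≡.refl with lift-from-i a≢b a≢j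
    ...   | g , g~ , divides = - g
            , R/d.trans (R/d.-‿cong g~) (≈⇒~ (solve 2 (λ x y → :- (x :- y) := y :- x) refl (X i) (X a)))
            , λ {p} {q} pq κp≡a κq≡i → divides′ (merge-fibre a≢i κp≡a) pq κq≡i
      where
      divides′ : ∀ {p q} → p ≡ a → Adj p q → κ q ≡ i → (X p - X q) ∣ ∏ commonFactor * - g
      divides′ ≡.refl pq κq≡i = ∣-resp (solve 2 (λ w g → :- (w :* g) := w :* :- g) refl (∏ commonFactor) g)
        (IsIdeal.neg-closed (∣-isIdeal _) (∣-swap (divides (symmetric pq) κq≡i)))
    lift-difference {a} {b} a≢b a≢j b≢j | no a≢i | no b≢i = X a - X b , R/d.refl , λ pq κp≡a κq≡b →
      ≡.subst₂ (λ p q → (X p - X q) ∣ _) (≡.sym (merge-fibre a≢i κp≡a)) (≡.sym (merge-fibre b≢i κq≡b))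
        (∣-*ˡ _ (∣-refl _))

    -- Only edges joining i or j to a common neighbour can fail to divide this lift of Q(𝓐ᴴ).
    lift-product : ∀ {L} → All EdgeForm L → ∃ λ M → M R/d.≈ product L ×
                   (∀ {p q} → Adj p q → κ p ≢ κ q → Any (λ f → Difference f (κ p) (κ q)) L →
                    (X p - X q) ∣ ∏ commonFactor * M)
    lift-product []                                     = 1# , R/d.refl , λ _ _ ()
    lift-product {f ∷ L} ((a , b , ab , κa≢κb , diff@(u , unit , f̄≈)) ∷ forms)
      with lift-difference κa≢κb (κ≢j a) (κ≢j b) | lift-product forms
    ... | g , g~ , g-divides | M , M~ , M-divides = u * g * M , lifted , divides
      where
      w : Carrier
      w = ∏ commonFactor
      lifted : u * g * M R/d.≈ f * product L
      lifted = R/d.*-cong (R/d.trans (R/d.*-congˡ g~)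
        (R/d.trans (≈⇒~ (sym f̄≈)) (R/d.sym (~-restriction f)))) M~
      regroup : ∀ {h} → h ∣ w * g → h ∣ w * (u * g * M)
      regroup ∣wg = ∣-resp (solve 4 (λ w g u m → (u :* m) :* (w :* g) := w :* (u :* g :* m)) refl w g u M)
        (∣-*ˡ (u * M) ∣wg)
      divides : ∀ {p q} → Adj p q → κ p ≢ κ q → Any (λ f → Difference f (κ p) (κ q)) (f ∷ L) →
                (X p - X q) ∣ w * (u * g * M)
      divides {p} {q} pq κp≢κq (here diff′) with difference-unique κp≢κq κa≢κb diff′ diff
      ... | inj₁ (κp≡κa , κq≡κb) = regroup (g-divides pq κp≡κa κq≡κb)
      ... | inj₂ (κp≡κb , κq≡κa) = regroup (∣-swap (g-divides (symmetric pq) κq≡κa κp≡κb))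
      divides pq κp≢κq (there any) =
        ∣-resp (solve 4 (λ w g u m → (u :* g) :* (w :* m) := w :* (u :* g :* m)) refl w g u M)
          (∣-*ˡ (u * g) (M-divides pq κp≢κq any))

  Complete : List Carrier → Set _
  Complete L = ∀ {p q} → Adj p q → κ p ≢ κ q → Any (λ f → Difference f (κ p) (κ q)) L

  -- Residues of clique forms

  module _ {Z : Pred (Fin ℓ) Level.zero} (Z? : Decidable Z) (Z⊆W : ∀ {k} → Z k → Common k)
           (clique : ∀ {k m} → Z k → Z m → k ≢ m → Adj k m) where

    cofactor : Vector Carrier ℓ
    cofactor k = if does (Z? k) then 1# else commonFactor k

    private
      C : Pred (Fin ℓ) Level.zero
      C k = (k ≡ i ⊎ k ≡ j) ⊎ Z k

      C? : Decidable C
      C? k = (k Fin.≟ i ⊎-dec k Fin.≟ j) ⊎-dec Z? k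

      C-clique : ∀ {p q} → C p → C q → p ≢ q → Adj p q
      C-clique (inj₁ (inj₁ ≡.refl)) (inj₁ (inj₁ ≡.refl)) p≢q = contradiction ≡.refl p≢q
      C-clique (inj₁ (inj₁ ≡.refl)) (inj₁ (inj₂ ≡.refl)) _   = ij
      C-clique (inj₁ (inj₂ ≡.refl)) (inj₁ (inj₁ ≡.refl)) _   = symmetric ij
      C-clique (inj₁ (inj₂ ≡.refl)) (inj₁ (inj₂ ≡.refl)) p≢q = contradiction ≡.refl p≢q
      C-clique (inj₁ (inj₁ ≡.refl)) (inj₂ Zq)            _   = symmetric (proj₁ (Z⊆W Zq))
      C-clique (inj₁ (inj₂ ≡.refl)) (inj₂ Zq)            _   = symmetric (proj₂ (Z⊆W Zq))
      C-clique (inj₂ Zp)            (inj₁ (inj₁ ≡.refl)) _   = proj₁ (Z⊆W Zp)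
      C-clique (inj₂ Zp)            (inj₁ (inj₂ ≡.refl)) _   = proj₂ (Z⊆W Zp)
      C-clique (inj₂ Zp)            (inj₂ Zq)            p≢q = clique Zp Zq p≢q

      cliqueFactor : Vector Carrier ℓ
      cliqueFactor k = if does (Z? k) then X i - X k else 1#

      edgeFactor : Vector Carrier ℓ
      edgeFactor k = if does (k Fin.≟ j) then d else 1#

      ¬Zi : ¬ Z i
      ¬Zi Zi = SimpleGraph.irreflexive G ≡.refl (proj₁ (Z⊆W Zi))

      ¬Zj : ¬ Z j
      ¬Zj Zj = SimpleGraph.irreflexive G ≡.refl (proj₂ (Z⊆W Zj))

      common-split : ∏ commonFactor ≈ ∏ cliqueFactor * ∏ cofactor
      common-split = trans (∏-cong pointwise) (∏-distrib-* cliqueFactor cofactor)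
        where
        pointwise : ∀ k → commonFactor k ≈ cliqueFactor k * cofactor k
        pointwise k with Z? k
        ... | no  _  = sym (*-identityˡ _)
        ... | yes Zk rewrite dec-true (common? k) (Z⊆W Zk) = sym (*-identityʳ _)

      clique-regular : Regular (∏ cliqueFactor)
      clique-regular = regular-∏ cliqueFactor pointwise
        where
        pointwise : ∀ k → Regular (cliqueFactor k)
        pointwise k with Z? k
        ... | no  _  = regular-1
        ... | yes Zk = regular λ { ≡.refl → ¬Zi Zk }

    -- The residue is that of the form of the clique Z ∪ {i , j}; the cofactor is ∏_{k ∈ W ∖ Z} (x_i - x_k).
    clique-residue : ∀ {L} → All EdgeForm L → Complete L → ∃ λ η →
                     (∀ {p q} → Adj p q → Logarithmic p q η) × d ∣ (product L * ∏ cofactor - η i)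
    clique-residue {L} forms complete with lift-product forms
    ... | M , M~ , M-divides = η , (λ pq → η-logarithmic (adjacent-distinct G pq) (edge∣Q pq)) , residue
      where
      Q : Carrier
      -- A common multiple of all edge differences, standing in for Q(𝓐): `d` serves the edge {i ,
      -- j}, and `M`, a lift of Q(𝓐ᴴ), together with the common factors serves every other edge.
      Q = d * (∏ commonFactor * M)

      edge∣Q : ∀ {p q} → Adj p q → (X p - X q) ∣ Q
      edge∣Q {p} {q} pq with κ p Fin.≟ κ q
      ... | no  κp≢κq = ∣-*ˡ d (M-divides pq κp≢κq (complete pq κp≢κq))
      ... | yes κp≡κq with merge-identifies (adjacent-distinct G pq) κp≡κq
      ...   | inj₁ (≡.refl , ≡.refl) = ∣-*ʳ _ (∣-swap (∣-refl _))
      ...   | inj₂ (≡.refl , ≡.refl) = ∣-*ʳ _ (∣-refl _)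

      open CliqueForm C? (λ Cp Cq p≢q → edge∣Q (C-clique Cp Cq p≢q))

      denominator-i : denominator i ≈ d * ∏ cliqueFactor
      denominator-i = begin
        ∏ (factor i)                     ≈⟨ ∏-cong pointwise ⟩
        ∏ (λ k → edgeFactor k * cliqueFactor k) ≈⟨ ∏-distrib-* edgeFactor cliqueFactor ⟩
        ∏ edgeFactor * ∏ cliqueFactor    ≈⟨ *-congʳ (trans (∏-single edgeFactor j away) at-j) ⟩
        d * ∏ cliqueFactor               ∎
        where
        away : ∀ k → k ≢ j → edgeFactor k ≈ 1#
        away k k≢j rewrite dec-false (k Fin.≟ j) k≢j = refl
        at-j : edgeFactor j ≈ d
        at-j rewrite dec-true (j Fin.≟ j) ≡.refl = refl
        pointwise : ∀ k → factor i k ≈ edgeFactor k * cliqueFactor k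
        pointwise k with k Fin.≟ i | k Fin.≟ j | Z? k
        ... | yes ≡.refl | yes i≡j    | _      = contradiction i≡j i≢j
        ... | yes ≡.refl | no  _      | yes Zi = contradiction Zi ¬Zi
        ... | yes ≡.refl | no  _      | no  _  = sym (*-identityˡ 1#)
        ... | no  _      | yes ≡.refl | yes Zj = contradiction Zj ¬Zj
        ... | no  _      | yes ≡.refl | no  _  = sym (*-identityʳ _)
        ... | no  _      | no  _      | yes _  = sym (*-identityˡ _)
        ... | no  _      | no  _      | no  _  = sym (*-identityˡ 1#)

      ηi≈ : η i ≈ M * ∏ cofactor
      ηi≈ = cancelˡ (regular-* (regular i≢j) clique-regular) (begin
        (d * ∏ cliqueFactor) * η i                           ≈⟨ *-comm _ _ ⟩
        η i * (d * ∏ cliqueFactor)                           ≈⟨ *-congˡ denominator-i ⟨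
        η i * denominator i                                  ≈⟨ η-in (inj₁ (inj₁ ≡.refl)) ⟨
        d * (∏ commonFactor * M)                             ≈⟨ *-congˡ (*-congʳ common-split) ⟩
        d * (∏ cliqueFactor * ∏ cofactor * M)                ≈⟨ solve 4
            (λ d z w m → d :* (z :* w :* m) := (d :* z) :* (m :* w)) refl d (∏ cliqueFactor)
            (∏ cofactor) M ⟩
        (d * ∏ cliqueFactor) * (M * ∏ cofactor)              ∎)

      residue : d ∣ (product L * ∏ cofactor - η i)
      residue = R/d.trans (R/d.*-congʳ (R/d.sym M~)) (≈⇒~ (sym ηi≈))

  -- Residues lie in the ideals of the non-edges

  Distinct : Carrier → Carrier → Set _
  Distinct f g = ∀ {p q} → p ≢ q → Difference f p q → ¬ Difference g p q

  private
    -- Used twice, to split the factors y_u and y_v off Q(𝓐ᴴ). The remaining factors are recorded as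
    -- distinct from the one removed, and the last component carries the witness for the second
    -- extraction over to the shorter list.
    extract : ∀ {p t t′} {P : Pred Carrier p} {T : Pred Carrier t} {T′ : Pred Carrier t′} {L} →
              All P L → AllPairs Distinct L → Any T L →
              ∃₂ λ f L′ → product L ≈ f * product L′ × T f × P f × All P L′ × AllPairs Distinct L′ ×
                All (Distinct f) L′ × (Any T′ L → ¬ T′ f → Any T′ L′)
    extract {L = f ∷ L} (Pf ∷ PL) (≢f ∷ distinct) (here Tf) =
      f , L , refl , Tf , Pf , PL , distinct , ≢f ,
        λ { (here T′f) ¬T′f → contradiction T′f ¬T′f ; (there any) _ → any }
    extract {L = g ∷ L} (Pg ∷ PL) (≢g ∷ distinct) (there any) with extract (All.zip (PL , ≢g)) distinct any
    ... | f , L′ , eq , Tf , (Pf , g≢f) , PL′ , distinct′ , ≢f , retain =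
      f , g ∷ L′ , trans (*-congˡ eq) (x∙yz≈y∙xz _ _ _) , Tf , Pf
        , Pg ∷ All.map proj₁ PL′
        , All.map proj₂ PL′ ∷ distinct′
        , (λ p≢q Df Dg → g≢f p≢q Dg Df) ∷ ≢f
        , λ { (here T′g) _ → here T′g ; (there any) ¬T′f → there (retain any ¬T′f) }
      where open import Algebra.Properties.CommutativeSemigroup *-commutativeSemigroup using (x∙yz≈y∙xz)

  -- The ideal (p , q) of the quotient by `r`, as its preimage (p , q , r).
  SpannedBy : (p q r : Carrier) → Pred Carrier _
  SpannedBy p q r f = ∃₂ λ s t → r ∣ (f - (s * p + t * q))

  spanned-isIdeal : ∀ p q r → IsIdeal (SpannedBy p q r)
  spanned-isIdeal p q r = record
    { resp     = λ { f≈g (s , t , h , eq) → s , t , h , trans (+-congʳ (sym f≈g)) eq }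
    ; 0∈       = 0# , 0# , 0# , (begin
        0# - (0# * p + 0# * q) ≈⟨ +-congˡ (-‿cong (+-cong (zeroˡ p) (zeroˡ q))) ⟩
        0# - (0# + 0#)         ≈⟨ +-congˡ (-‿cong (+-identityʳ 0#)) ⟩
        0# - 0#                ≈⟨ -‿inverseʳ 0# ⟩
        0#                     ≈⟨ zeroˡ r ⟨
        0# * r                 ∎)
    ; +-closed = λ { {f} {g} (s , t , h , eq) (s′ , t′ , h′ , eq′) → s + s′ , t + t′ , h + h′ ,
        trans (+-congˡ (-‿cong (trans (+-cong (distribʳ p s s′) (distribʳ q t t′)) (interchange _ _ _ _))))
          (trans (solve 4 (λ f g a b → (f :+ g) :- (a :+ b) := (f :- a) :+ (g :- b)) refl f g _ _)
                 (trans (+-cong eq eq′) (sym (distribʳ r h h′)))) }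
    ; *-closed = λ { k {f} (s , t , h , eq) → k * s , k * t , k * h ,
        trans (+-congˡ (-‿cong (trans (+-cong (*-assoc k s p) (*-assoc k t q)) (sym (distribˡ k _ _)))))
          (trans (solve 3 (λ k f a → k :* f :- k :* a := k :* (f :- a)) refl k f _)
                 (trans (*-congˡ eq) (sym (*-assoc k h r)))) }
    }
    where open import Algebra.Properties.CommutativeSemigroup
                 (CommutativeMonoid.commutativeSemigroup +-commutativeMonoid) using (interchange)

  module _ {η : Vector Carrier ℓ} (η-log : ∀ {p q} → Adj p q → Logarithmic p q η)
           {u v : Fin ℓ} (Wu : Common u) (Wv : Common v) (u≢v : u ≢ v) (¬uv : ¬ Adj u v) where
    private
      i≢u : i ≢ u
      i≢u = adjacent-distinct G (symmetric (proj₁ Wu))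
      j≢u : j ≢ u
      j≢u = adjacent-distinct G (symmetric (proj₂ Wu))
      i≢v : i ≢ v
      i≢v = adjacent-distinct G (symmetric (proj₁ Wv))
      j≢v : j ≢ v
      j≢v = adjacent-distinct G (symmetric (proj₂ Wv))

    -- With η_i = (x_j - x_u)(x_j - x_v) A and η_u = (x_i - x_j)(x_i - x_v)(x_j - x_v) B,
    -- the condition along {i , u} says A ≡ (x_i - x_v) B modulo x_i - x_u.
    private
      factor-two : ∀ {f g h} → f ∣ h → g ∣ h → CoprimeTo g f → ∃ λ k → h ≈ f * g * k
      factor-two {f} {g} {h} (k , h≈kf) g∣h coprime = factor
        (coprime (∣-resp (trans h≈kf (*-comm k f)) g∣h))
        where
        factor : g ∣ k → ∃ λ k → h ≈ f * g * k
        factor (k′ , k≈k′g) = k′ , trans h≈kf (trans (*-congʳ k≈k′g)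
          (solve 3 (λ k g f → k :* g :* f := f :* g :* k) refl k′ g f))

    ηi-factor : ∃ λ A → η i ≈ (X j - X u) * (X j - X v) * A ×
                (∃₂ λ s t → A ≈ s * (X u - X i) + t * (X v - X i))
    ηi-factor = A , ηi≈ , combine
      -- x_i - x_u divides the left side of `difference≈`, the edge {i , u} accounting for η_i +
      -- η_u. Primality then strips x_i - x_j and x_j - x_v from the right side.
      (prime j≢v [ i≢j ∘ ≡.sym ∘ proj₁ , j≢u ∘ proj₁ ]′ (prime i≢j [ j≢u ∘ proj₂ , i≢u ∘ proj₁ ]′
        (∣-resp difference≈ (IsIdeal.+-closed (∣-isIdeal _)
          (∣-*ˡ ((X j - X v) * A) (∣-refl (X i - X u)))
          (IsIdeal.neg-closed (∣-isIdeal _) (proj₂ (η-log (symmetric (proj₁ Wu)))))))))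
      where
      u≢i = i≢u ∘ ≡.sym
      u≢j = j≢u ∘ ≡.sym

      i-factors : ∃ λ A → η i ≈ (X j - X u) * (X j - X v) * A
      i-factors = factor-two (proj₁ (η-log (symmetric (proj₂ Wu))) i i≢j i≢u)
                             (proj₁ (η-log (symmetric (proj₂ Wv))) i i≢j i≢v)
                             (prime j≢u [ u≢v ∘ proj₂ , j≢v ∘ proj₁ ]′)

      u-factors : ∃ λ B → η u ≈ (X i - X j) * (X i - X v) * B
      u-factors = factor-two (proj₁ (η-log ij) u u≢i u≢j)
                             (proj₁ (η-log (symmetric (proj₁ Wv))) u u≢i u≢v)
                             (prime i≢j [ j≢v ∘ proj₂ , i≢v ∘ proj₁ ]′)

      A B′ : Carrier
      A  = proj₁ i-factors
      B′ = proj₁ u-factors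

      ηi≈ : η i ≈ (X j - X u) * (X j - X v) * A
      ηi≈ = proj₂ i-factors

      ηu≈ : η u ≈ (X i - X j) * (X i - X v) * B′
      ηu≈ = proj₂ u-factors

      B′-divisible : (X j - X v) ∣ B′
      B′-divisible = prime i≢v [ i≢j ∘ proj₁ , i≢v ∘ proj₁ ]′ (prime i≢j [ i≢j ∘ proj₁ , i≢v ∘ proj₁ ]′
        (∣-resp (trans ηu≈ (*-assoc _ _ _)) (proj₁ (η-log (symmetric (proj₂ Wv))) u u≢j u≢v)))

      B : Carrier
      B = proj₁ B′-divisible

      B′≈ : B′ ≈ B * (X j - X v)
      B′≈ = proj₂ B′-divisible

      difference≈ : (X j - X v) * A * (X i - X u) - (η i + η u) ≈
                    (X i - X j) * ((X j - X v) * (A - (X i - X v) * B))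
      difference≈ = begin
        (X j - X v) * A * (X i - X u) - (η i + η u)
          ≈⟨ +-congˡ (-‿cong (+-cong
               (trans ηi≈ (trans (*-assoc _ _ _)
                 (*-congʳ (solve 3 (λ i j u → j :- u := (i :- u) :- (i :- j)) refl (X i) (X j) (X u)))))
               (trans ηu≈ (trans (*-congˡ B′≈) (*-assoc _ _ _))))) ⟩
        (X j - X v) * A * (X i - X u) -
          (((X i - X u) - (X i - X j)) * ((X j - X v) * A) + (X i - X j) *
            ((X i - X v) * (B * (X j - X v))))
          ≈⟨ solve 4 (λ d e x z → x :* d :- ((d :- e) :* x :+ e :* z) := e :* (x :- z)) refl
               (X i - X u) (X i - X j) ((X j - X v) * A) _ ⟩
        (X i - X j) * ((X j - X v) * A - (X i - X v) * (B * (X j - X v)))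
          ≈⟨ *-congˡ (solve 4 (λ m n A B → m :* A :- n :* (B :* m) := m :* (A :- n :* B)) refl (X j - X v)
              (X i - X v) A B) ⟩
        (X i - X j) * ((X j - X v) * (A - (X i - X v) * B)) ∎
      combine : (X i - X u) ∣ (A - (X i - X v) * B) → ∃₂ λ s t → A ≈ s * (X u - X i) + t * (X v - X i)
      combine (h , eq) = - h , - B , (begin
        A                                             ≈⟨ solve 2 (λ A C → A := (A :- C) :+ C) refl A
            ((X i - X v) * B) ⟩
        (A - (X i - X v) * B) + (X i - X v) * B       ≈⟨ +-congʳ eq ⟩
        h * (X i - X u) + (X i - X v) * B
          ≈⟨ +-cong (solve 3 (λ i u h → h :* (i :- u) := :- h :* (u :- i)) refl (X i) (X u) h)
                    (solve 3 (λ i v B → (i :- v) :* B := :- B :* (v :- i)) refl (X i) (X v) B) ⟩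
        - h * (X u - X i) + - B * (X v - X i)         ∎)

    private
      ρ : Fin ℓ → Fin ℓ
      ρ = merge v i ∘ merge u i

      ρu≡i : ρ u ≡ i
      ρu≡i = ≡.trans (≡.cong (merge v i) (merge-same u i)) (merge-target v i)

      ρv≡i : ρ v ≡ i
      ρv≡i = ≡.trans (≡.cong (merge v i) (merge-other i (u≢v ∘ ≡.sym))) (merge-same v i)

      ρi≡i : ρ i ≡ i
      ρi≡i = ≡.trans (≡.cong (merge v i) (merge-target u i)) (merge-target v i)

      restrict collapse : Carrier → Carrier
      restrict = ⟪ X ∘ κ ⟫
      collapse = ⟪ X ∘ ρ ⟫

      difference-swap : ∀ {f p q} → Difference f p q → Difference f q p
      difference-swap {p = p} {q} (c , (c′ , c′c≈1) , f≈) = - c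
        , (- c′ , trans (solve 2 (λ c c′ → :- c′ :* :- c := c′ :* c) refl c c′) c′c≈1)
        , trans f≈ (solve 3 (λ c p q → c :* (p :- q) := :- c :* (q :- p)) refl c (X p) (X q))

      -- The map `ρ` identifies two distinct vertices only if both lie in {i , u , v}. The pairs {u
      -- , i} and {v , i} are excluded by the hypotheses on `f`, and {u , v} because it would have
      -- to be an edge of G: it is here that the non-edge enters.
      ρ-separates : ∀ {f p q} → Adj p q → κ p ≢ κ q → Difference f (κ p) (κ q) →
                    ¬ Difference f u i → ¬ Difference f v i → ρ (κ p) ≢ ρ (κ q)
      ρ-separates {p = p} {q} pq κp≢κq diff ¬u ¬v eq with merge u i (κ p) Fin.≟ merge u i (κ q)
      ... | yes eq′ = [ (λ (κp≡u , κq≡i) → ¬u (≡.subst₂ (Difference _) κp≡u κq≡i diff))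
                      , (λ (κp≡i , κq≡u) → ¬u (difference-swap (≡.subst₂ (Difference _) κp≡i κq≡u diff))) ]′
                      (merge-identifies κp≢κq eq′)
      ... | no neq with merge-identifies neq eq
      ...   | inj₁ (p↦v , q↦i) = [ (λ κq≡u → ¬uv
        (symmetric (≡.subst₂ Adj (merge-fibre (i≢v ∘ ≡.sym) κp≡v) (merge-fibre (i≢u ∘ ≡.sym) κq≡u) pq)))
                                 , (λ κq≡i → ¬v (≡.subst₂ (Difference _) κp≡v κq≡i diff)) ]′
                                 (merge-fibre-target {k = κ q} q↦i)
        where
        κp≡v : κ p ≡ v
        κp≡v = merge-fibre (i≢v ∘ ≡.sym) p↦v
      ...   | inj₂ (p↦i , q↦v) = [ (λ κp≡u → ¬uv
        (≡.subst₂ Adj (merge-fibre (i≢u ∘ ≡.sym) κp≡u) (merge-fibre (i≢v ∘ ≡.sym) κq≡v) pq))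
                                 , (λ κp≡i → ¬v (difference-swap (≡.subst₂ (Difference _) κp≡i κq≡v diff))) ]′
                                 (merge-fibre-target {k = κ p} p↦i)
        where
        κq≡v : κ q ≡ v
        κq≡v = merge-fibre (i≢v ∘ ≡.sym) q↦v

      -- After the collapse each factor is still a unit times a difference of distinct variables, so
      -- the product can be cancelled.
      collapse-regular : ∀ {L} → All EdgeForm L →
                         All (λ f → ¬ Difference f u i × ¬ Difference f v i) L →
                         Regular (collapse (restrict (product L)))
      collapse-regular [] [] = regular-resp (sym (trans (⟪⟫-cong _ (⟪⟫-1 _)) (⟪⟫-1 _))) regular-1
      collapse-regular {f ∷ L} ((p , q , pq , κp≢κq , diff@(c , unit , f≈)) ∷ forms) ((¬u , ¬v) ∷ rest) =
        regular-resp (sym (trans (⟪⟫-cong _ (⟪⟫-* _ f (product L))) (⟪⟫-* _ _ _)))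
          (regular-* (regular-resp (sym collapsed)
                       (regular-* (regular-unit (⟪⟫-unit _ unit))
                         (regular (ρ-separates {f} pq κp≢κq diff ¬u ¬v))))
                     (collapse-regular forms rest))
        where
        collapsed : collapse (restrict f) ≈ collapse c * (X (ρ (κ p)) - X (ρ (κ q)))
        collapsed = trans (⟪⟫-cong _ f≈) (trans (⟪⟫-* _ c _) (*-congˡ (⟪⟫-X-X _ (κ p) (κ q))))

      κi : κ i ≡ i
      κi = merge-target j i

      κu : κ u ≡ u
      κu = merge-other i (j≢u ∘ ≡.sym)

      κv : κ v ≡ v
      κv = merge-other i (j≢v ∘ ≡.sym)

      κj : κ j ≡ i
      κj = merge-same j i

      κ-separates-i : ∀ {k} → i ≢ k → κ k ≡ k → κ i ≢ κ k
      κ-separates-i i≢k κk eq = i≢k (≡.trans (≡.sym κi) (≡.trans eq κk))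

      collapse-vanishes : ∀ {k} → ρ k ≡ i → collapse (X k - X i) ≈ 0#
      collapse-vanishes {k} ρk = trans (⟪⟫-X-X _ k i)
        (trans (reflexive (≡.cong₂ (λ k m → X k - X m) ρk ρi≡i)) (-‿inverseʳ (X i)))

      restrict-X-X : ∀ {k m k′ m′} → κ k ≡ k′ → κ m ≡ m′ → restrict (X k - X m) ≈ X k′ - X m′
      restrict-X-X {k} {m} κk κm = trans (⟪⟫-X-X _ k m) (reflexive (≡.cong₂ (λ k m → X k - X m) κk κm))

      spanned : IsIdeal (SpannedBy (X u - X i) (X v - X i) d)
      spanned = spanned-isIdeal _ _ _

      -- The collapse by κ and ρ is the restriction to x_i = x_j = x_u = x_v.
      collapsed-spanned : ∀ {f} → collapse (restrict f) ≈ 0# → SpannedBy (X u - X i) (X v - X i) d f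
      collapsed-spanned {f} f≈0 = I.resp
        (solve 3 (λ f g h → (f :- g) :+ (g :- h) :+ h := f) refl f (restrict f) (collapse (restrict f)))
        (I.+-closed (I.+-closed (merge-mod spanned κ κ-moves f) (merge-mod spanned ρ ρ-moves (restrict f)))
                    (I.resp (sym f≈0) I.0∈))
        where
        module I = IsIdeal spanned
        generator₁ : SpannedBy (X u - X i) (X v - X i) d (X u - X i)
        generator₁ = 1# , 0# , 0# , trans
          (solve 4 (λ p q o z → p :- (o :* p :+ z :* q) := (p :- o :* p) :- z :* q) refl (X u - X i)
          (X v - X i) 1# 0#)
          (trans (+-cong (trans (+-congˡ (-‿cong (*-identityˡ _))) (-‿inverseʳ _)) (-‿cong (zeroˡ _)))
                 (trans (-‿inverseʳ 0#) (sym (zeroˡ d))))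
        generator₂ : SpannedBy (X u - X i) (X v - X i) d (X v - X i)
        generator₂ = 0# , 1# , 0# , trans
          (solve 4 (λ p q o z → q :- (z :* p :+ o :* q) := (q :- o :* q) :- z :* p) refl (X u - X i)
          (X v - X i) 1# 0#)
          (trans (+-cong (trans (+-congˡ (-‿cong (*-identityˡ _))) (-‿inverseʳ _)) (-‿cong (zeroˡ _)))
                 (trans (-‿inverseʳ 0#) (sym (zeroˡ d))))
        generator₃ : SpannedBy (X u - X i) (X v - X i) d d
        generator₃ = 0# , 0# , 1# , trans
          (+-congˡ (-‿cong (trans (+-cong (zeroˡ _) (zeroˡ _)) (+-identityʳ 0#))))
          (trans (+-congˡ ε⁻¹≈ε) (trans (+-identityʳ d) (sym (*-identityˡ d))))
          where open AbelianGroupProperties +-abelianGroup using (ε⁻¹≈ε)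
        κ-moves : ∀ k → SpannedBy (X u - X i) (X v - X i) d (X k - X (κ k))
        κ-moves k with k Fin.≟ j
        ... | yes ≡.refl = I.resp (solve 2 (λ i j → :- (i :- j) := j :- i) refl (X i) (X j))
          (I.neg-closed generator₃)
        ... | no  _      = I.resp (sym (-‿inverseʳ (X k))) I.0∈
        ρ-moves : ∀ k → SpannedBy (X u - X i) (X v - X i) d (X k - X (ρ k))
        ρ-moves k = cases (k Fin.≟ u) (k Fin.≟ v)
          where
          cases : Dec (k ≡ u) → Dec (k ≡ v) → SpannedBy (X u - X i) (X v - X i) d (X k - X (ρ k))
          cases (yes ≡.refl) _            = I.resp
            (reflexive (≡.cong (λ m → X u - X m) (≡.sym ρu≡i))) generator₁
          cases (no  _)      (yes ≡.refl) = I.resp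
            (reflexive (≡.cong (λ m → X v - X m) (≡.sym ρv≡i))) generator₂
          cases (no  k≢u)    (no  k≢v)    = I.resp
            (trans (sym (-‿inverseʳ (X k))) (reflexive (≡.cong (λ m → X k - X m) (≡.sym
              (≡.trans (≡.cong (merge v i) (merge-other i k≢u)) (merge-other i k≢v)))))) I.0∈

      -- On `x_i = x_j` both sides of the residue equation contain the product `y`: on the left from
      -- the factors `f` and `g` of Q(𝓐ᴴ), on the right from η_i. Once it is cancelled, the right
      -- side is a multiple of `A`, which vanishes on x_i = x_u = x_v; the factors other than `r` on
      -- the left do not vanish there.
      module Conclusion {L L′ L″ f g}
        (L≈ : product L ≈ f * product L′) (L′≈ : product L′ ≈ g * product L″)
        (diff-f : Difference f i u) (diff-g : Difference g i v)
        (rest-regular : Regular (collapse (restrict (product L″))))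
        {r w} (d∣ : d ∣ (product L * r - w * η i)) where

        A s t c₁ c₂ y : Carrier
        A  = proj₁ ηi-factor
        s  = proj₁ (proj₂ (proj₂ ηi-factor))
        t  = proj₁ (proj₂ (proj₂ (proj₂ ηi-factor)))
        c₁ = proj₁ diff-f
        c₂ = proj₁ diff-g
        y  = (X i - X u) * (X i - X v)

        ηi≈ : η i ≈ (X j - X u) * (X j - X v) * A
        ηi≈ = proj₁ (proj₂ ηi-factor)

        A≈ : A ≈ s * (X u - X i) + t * (X v - X i)
        A≈ = proj₂ (proj₂ (proj₂ (proj₂ ηi-factor)))

        restricted : restrict (product L * r) ≈ restrict (w * η i)
        restricted = x∙y⁻¹≈ε⇒x≈y _ _ (trans (sym (⟪⟫-minus _ (product L * r) (w * η i)))
                                              (∣⇒vanishes j i (∣-swap d∣)))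
          where open AbelianGroupProperties +-abelianGroup using (x∙y⁻¹≈ε⇒x≈y)

        restricted-ηi : restrict (w * η i) ≈ restrict w * (y * restrict A)
        restricted-ηi = begin
          restrict (w * η i)
            ≈⟨ ⟪⟫-* _ w (η i) ⟩
          restrict w * restrict (η i)
            ≈⟨ *-congˡ (⟪⟫-cong _ ηi≈) ⟩
          restrict w * restrict ((X j - X u) * (X j - X v) * A)
            ≈⟨ *-congˡ (trans (⟪⟫-* _ ((X j - X u) * (X j - X v)) A)
                (*-congʳ (⟪⟫-* _ (X j - X u) (X j - X v)))) ⟩
          restrict w * (restrict (X j - X u) * restrict (X j - X v) * restrict A)
            ≈⟨ *-congˡ (*-congʳ (*-cong (restrict-X-X κj κu) (restrict-X-X κj κv))) ⟩
          restrict w * (y * restrict A) ∎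

        restricted-L : restrict (product L * r) ≈ y * (c₁ * c₂ * restrict (product L″ * r))
        restricted-L = begin
          restrict (product L * r)
            ≈⟨ ⟪⟫-cong _ (trans (*-congʳ (trans L≈ (*-congˡ L′≈)))
                 (solve 4 (λ f g z r → f :* (g :* z) :* r := (f :* g) :* (z :* r)) refl f g
                   (product L″) r)) ⟩
          restrict ((f * g) * (product L″ * r))
            ≈⟨ trans (⟪⟫-* _ (f * g) (product L″ * r)) (*-congʳ (⟪⟫-* _ f g)) ⟩
          restrict f * restrict g * restrict (product L″ * r)
            ≈⟨ *-congʳ (*-cong (proj₂ (proj₂ diff-f)) (proj₂ (proj₂ diff-g))) ⟩
          (c₁ * (X i - X u)) * (c₂ * (X i - X v)) * restrict (product L″ * r)
            ≈⟨ *-congʳ (solve 4 (λ y y′ a b → (a :* y) :* (b :* y′) := (y :* y′) :* (a :* b)) refl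
                 (X i - X u) (X i - X v) c₁ c₂) ⟩
          y * (c₁ * c₂) * restrict (product L″ * r)
            ≈⟨ *-assoc y (c₁ * c₂) _ ⟩
          y * (c₁ * c₂ * restrict (product L″ * r)) ∎

        cancelled : c₁ * c₂ * restrict (product L″ * r) ≈ restrict w * restrict A
        cancelled = cancelˡ (regular-* (regular i≢u) (regular i≢v)) (begin
          y * (c₁ * c₂ * restrict (product L″ * r)) ≈⟨ restricted-L ⟨
          restrict (product L * r)                  ≈⟨ restricted ⟩
          restrict (w * η i)                        ≈⟨ restricted-ηi ⟩
          restrict w * (y * restrict A)             ≈⟨ x∙yz≈y∙xz _ y _ ⟩
          y * (restrict w * restrict A)             ∎)
          where open import Algebra.Properties.CommutativeSemigroup *-commutativeSemigroup using (x∙yz≈y∙xz)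

        A-vanishes : collapse (restrict A) ≈ 0#
        A-vanishes = begin
          collapse (restrict A)
            ≈⟨ ⟪⟫-cong _ (⟪⟫-cong _ A≈) ⟩
          collapse (restrict (s * (X u - X i) + t * (X v - X i)))
            ≈⟨ ⟪⟫-cong _ (trans (⟪⟫-+ _ (s * (X u - X i)) (t * (X v - X i)))
                 (+-cong (⟪⟫-* _ s (X u - X i)) (⟪⟫-* _ t (X v - X i)))) ⟩
          collapse (restrict s * restrict (X u - X i) + restrict t * restrict (X v - X i))
            ≈⟨ ⟪⟫-cong _ (+-cong (*-congˡ (restrict-X-X κu κi)) (*-congˡ (restrict-X-X κv κi))) ⟩
          collapse (restrict s * (X u - X i) + restrict t * (X v - X i))
            ≈⟨ trans (⟪⟫-+ _ (restrict s * (X u - X i)) (restrict t * (X v - X i)))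
                 (+-cong (⟪⟫-* _ (restrict s) (X u - X i)) (⟪⟫-* _ (restrict t) (X v - X i))) ⟩
          collapse (restrict s) * collapse (X u - X i) + collapse (restrict t) * collapse (X v - X i)
            ≈⟨ +-cong (*-congˡ (collapse-vanishes ρu≡i)) (*-congˡ (collapse-vanishes ρv≡i)) ⟩
          collapse (restrict s) * 0# + collapse (restrict t) * 0#
            ≈⟨ trans (+-cong (zeroʳ _) (zeroʳ _)) (+-identityʳ 0#) ⟩
          0# ∎

        product-vanishes : collapse (restrict (product L″ * r)) ≈ 0#
        product-vanishes = regular-* (regular-unit (⟪⟫-unit _ (proj₁ (proj₂ diff-f))))
                                     (regular-unit (⟪⟫-unit _ (proj₁ (proj₂ diff-g)))) (begin
          collapse c₁ * collapse c₂ * collapse (restrict (product L″ * r))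
            ≈⟨ trans (⟪⟫-* _ (c₁ * c₂) _) (*-congʳ (⟪⟫-* _ c₁ c₂)) ⟨
          collapse (c₁ * c₂ * restrict (product L″ * r))
            ≈⟨ ⟪⟫-cong _ cancelled ⟩
          collapse (restrict w * restrict A)
            ≈⟨ ⟪⟫-* _ (restrict w) (restrict A) ⟩
          collapse (restrict w) * collapse (restrict A)
            ≈⟨ *-congˡ A-vanishes ⟩
          collapse (restrict w) * 0#
            ≈⟨ zeroʳ _ ⟩
          0# ∎)

        r-spanned : SpannedBy (X u - X i) (X v - X i) d r
        r-spanned = collapsed-spanned (rest-regular (begin
          collapse (restrict (product L″)) * collapse (restrict r)
            ≈⟨ trans (⟪⟫-cong _ (⟪⟫-* _ (product L″) r)) (⟪⟫-* _ (restrict (product L″)) (restrict r)) ⟨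
          collapse (restrict (product L″ * r))
            ≈⟨ product-vanishes ⟩
          0# ∎))

    residue-spanned : ∀ {L} → All EdgeForm L → AllPairs Distinct L → Complete L →
                      ∀ {r} → (∃ λ w → d ∣ (product L * r - w * η i)) →
                      SpannedBy (X u - X i) (X v - X i) d r
    residue-spanned {L} forms distinct complete {r} (w , d∣) =
      let f , L′ , L≈ , diff-f , _ , forms′ , distinct′ , ≢f , retain =
            extract {T = λ f → Difference f i u} {T′ = λ f → Difference f i v} forms distinct
              (≡.subst₂ (λ p q → Any (λ f → Difference f p q) L) κi κu
                 (complete (symmetric (proj₁ Wu)) (κ-separates-i i≢u κu)))
          g , L″ , L′≈ , diff-g , _ , forms″ , _ , ≢g , _ =
            extract {T = λ f → Difference f i v} {T′ = λ f → Difference f i v}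
              (All.zip (forms′ , ≢f)) distinct′
              (retain (≡.subst₂ (λ p q → Any (λ f → Difference f p q) L) κi κv
                         (complete (symmetric (proj₁ Wv)) (κ-separates-i i≢v κv)))
                      (λ diff′ → [ u≢v ∘ proj₂ , i≢v ∘ proj₁ ]′
                        (difference-unique {f} i≢u i≢v diff-f diff′)))
          -- Q(𝓐ᴴ) is reduced: by distinctness no remaining factor is again y_u or y_v up to a unit.
          rest-regular = collapse-regular (All.map proj₁ forms″) (All.map
            (λ { ((_ , ≢f) , ≢g) → (λ diff → ≢f i≢u diff-f (difference-swap diff))
                                 , (λ diff → ≢g i≢v diff-g (difference-swap diff)) })
            (All.zip (forms″ , ≢g)))
      in Conclusion.r-spanned {L} {L′} {L″} {f} {g} L≈ L′≈ diff-f diff-g rest-regular {r} {w} d∣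

  -- The ideal of residues and its monomials

  IsResidueOf : List Carrier → Pred Carrier _
  IsResidueOf L r = ∃ λ η → (∀ {p q} → Adj p q → Logarithmic p q η) × d ∣ (product L * r - η i)

  -- Logarithmic numerators form a module; this is what allows residues to be produced one monomial
  -- at a time.
  residue-isIdeal : ∀ L → IsIdeal (IsResidueOf L)
  residue-isIdeal L = record
    { resp     = λ { f≈g (η , log , d∣) → η , log , I.resp (+-congʳ (*-congˡ f≈g)) d∣ }
    ; 0∈       = (λ _ → 0#)
               , (λ _ → (λ _ _ _ → zero-divisible _) , IsIdeal.+-closed (∣-isIdeal _) (zero-divisible _)
                 (zero-divisible _))
               , I.resp (trans (sym (-‿inverseʳ 0#)) (+-congʳ (sym (zeroʳ (product L))))) I.0∈
    ; +-closed = λ { {f} {g} (η , log , d∣) (η′ , log′ , d∣′) → (λ k → η k + η′ k)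
               , (λ pq → (λ k k≢p k≢q → IsIdeal.+-closed (∣-isIdeal _) (proj₁ (log pq) k k≢p k≢q)
                 (proj₁ (log′ pq) k k≢p k≢q))
                       , IsIdeal.resp (∣-isIdeal _) (interchange _ _ _ _)
                           (IsIdeal.+-closed (∣-isIdeal _) (proj₂ (log pq)) (proj₂ (log′ pq))))
               , I.resp (trans (solve 4 (λ x y m n → (x :- m) :+ (y :- n) := (x :+ y) :- (m :+ n)) refl
                                  (product L * f) (product L * g) (η i) (η′ i))
                               (+-congʳ (sym (distribˡ (product L) f g))))
                        (I.+-closed d∣ d∣′) }
    ; *-closed = λ { h {f} (η , log , d∣) → (λ k → h * η k)
               , (λ pq → (λ k k≢p k≢q → ∣-*ˡ h (proj₁ (log pq) k k≢p k≢q))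
                       , ∣-resp (distribˡ h _ _) (∣-*ˡ h (proj₂ (log pq))))
               , ∣-resp (solve 4 (λ h l f n → h :* (l :* f :- n) := l :* (h :* f) :- h :* n) refl h
                 (product L) f (η i))
                        (∣-*ˡ h d∣) }
    }
    where
    open import Algebra.Properties.CommutativeSemigroup
      (CommutativeMonoid.commutativeSemigroup +-commutativeMonoid) using (interchange)
    module I = IsIdeal (∣-isIdeal d)
    zero-divisible : ∀ f → f ∣ 0#
    zero-divisible f = IsIdeal.0∈ (∣-isIdeal f)

  residue-~ : ∀ {L f g} → d ∣ (f - g) → IsResidueOf L g → IsResidueOf L f
  residue-~ {L} {f} {g} d∣f-g (η , log , d∣) = η , log , R/d.trans (R/d.*-congˡ d∣f-g) d∣

  -- Exchanging y_k and - x_k turns the ideals (y_u , y_v) into monomial ideals.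
  reflect : Vector Carrier ℓ
  reflect k = if does (k Fin.≟ i) then X i else if does (k Fin.≟ j) then X i else X i - X k

  private
    reflect-i : reflect i ≈ X i
    reflect-i rewrite dec-true (i Fin.≟ i) ≡.refl = refl

    reflect-j : reflect j ≈ X i
    reflect-j rewrite dec-false (j Fin.≟ i) (i≢j ∘ ≡.sym) | dec-true (j Fin.≟ j) ≡.refl = refl

    reflect-other : ∀ {k} → k ≢ i → k ≢ j → reflect k ≈ X i - X k
    reflect-other {k} k≢i k≢j rewrite dec-false (k Fin.≟ i) k≢i | dec-false (k Fin.≟ j) k≢j = refl

    common≢i : ∀ {k} → Common k → k ≢ i
    common≢i Wk = adjacent-distinct G (proj₁ Wk)

    common≢j : ∀ {k} → Common k → k ≢ j
    common≢j Wk = adjacent-distinct G (proj₂ Wk)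

    reflected-generator : ∀ {k} → Common k → ⟪ reflect ⟫ (X k - X i) ≈ - X k
    reflected-generator {k} Wk = trans (⟪⟫-X-X reflect k i)
      (trans (+-cong (reflect-other (common≢i Wk) (common≢j Wk)) (-‿cong reflect-i))
             (solve 2 (λ i k → (i :- k) :- i := :- k) refl (X i) (X k)))

  -- This holds only modulo x_i - x_j, because x_j is sent to x_i and does not come back.
  reflect-involutive : ∀ f → d ∣ (f - ⟪ reflect ⟫ (⟪ reflect ⟫ f))
  reflect-involutive f = R/d.trans
    (IsIdeal.resp (∣-isIdeal d) (+-congʳ (⟪X⟫ f)) (⟪⟫-mod (∣-isIdeal d) X (⟪ reflect ⟫ ∘ reflect) moved f))
    (≈⇒~ (sym (⟪⟫-∘ reflect reflect f)))
    where
    moved : ∀ k → X k R/d.≈ ⟪ reflect ⟫ (reflect k)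
    moved k = cases (k Fin.≟ i) (k Fin.≟ j)
      where
      cases : Dec (k ≡ i) → Dec (k ≡ j) → X k R/d.≈ ⟪ reflect ⟫ (reflect k)
      cases (yes ≡.refl) _ = ≈⇒~ (sym (trans (⟪⟫-cong reflect reflect-i)
        (trans (⟪⟫-X reflect i) reflect-i)))
      cases (no  _) (yes ≡.refl) = R/d.trans (∣-swap (∣-refl _))
        (≈⇒~ (sym (trans (⟪⟫-cong reflect reflect-j) (trans (⟪⟫-X reflect i) reflect-i))))
      cases (no k≢i) (no k≢j) = ≈⇒~ (sym (begin
        ⟪ reflect ⟫ (reflect k)   ≈⟨ ⟪⟫-cong reflect (reflect-other k≢i k≢j) ⟩
        ⟪ reflect ⟫ (X i - X k)   ≈⟨ ⟪⟫-X-X reflect i k ⟩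
        reflect i - reflect k     ≈⟨ +-cong reflect-i (-‿cong (reflect-other k≢i k≢j)) ⟩
        X i - (X i - X k)         ≈⟨ solve 2 (λ i k → i :- (i :- k) := k) refl (X i) (X k) ⟩
        X k                       ∎))

  -- The reflection kills x_i - x_j, so the congruence becomes an equation in S, and it turns the
  -- generators into - x_u and - x_v. Membership then shows in the coefficients.
  reflect-spanned : ∀ {u v r} → Common u → Common v → SpannedBy (X u - X i) (X v - X i) d r →
                    ∃₂ λ A B → ⟪ reflect ⟫ r ≈ X u * A + X v * B
  reflect-spanned {u} {v} {r} Wu Wv (s , t , h , eq) = - σ s , - σ t , (begin
    σ r
      ≈⟨ ⟪⟫-cong reflect (trans (solve 2 (λ r y → r := y :+ (r :- y)) refl r
          (s * (X u - X i) + t * (X v - X i))) (+-congˡ eq)) ⟩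
    σ (s * (X u - X i) + t * (X v - X i) + h * d)
      ≈⟨ trans (⟪⟫-+ reflect _ (h * d)) (+-cong (trans (⟪⟫-+ reflect (s * (X u - X i)) (t * (X v - X i)))
           (+-cong (⟪⟫-* reflect s _) (⟪⟫-* reflect t _))) (⟪⟫-* reflect h d)) ⟩
    σ s * σ (X u - X i) + σ t * σ (X v - X i) + σ h * σ d
      ≈⟨ +-cong (+-cong (*-congˡ (reflected-generator Wu)) (*-congˡ (reflected-generator Wv)))
          (*-congˡ σd≈0) ⟩
    σ s * - X u + σ t * - X v + σ h * 0#
      ≈⟨ trans (+-congˡ (zeroʳ _)) (+-identityʳ _) ⟩
    σ s * - X u + σ t * - X v
      ≈⟨ +-cong (solve 2 (λ s x → s :* :- x := x :* :- s) refl (σ s) (X u))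
          (solve 2 (λ s x → s :* :- x := x :* :- s) refl (σ t) (X v)) ⟩
    X u * - σ s + X v * - σ t ∎)
    where
    σ : Carrier → Carrier
    σ = ⟪ reflect ⟫
    σd≈0 : σ d ≈ 0#
    σd≈0 = trans (⟪⟫-X-X reflect i j) (trans (+-cong reflect-i (-‿cong reflect-j)) (-‿inverseʳ _))

  module _ {Z : Pred (Fin ℓ) Level.zero} (Z? : Decidable Z) (Z⊆W : ∀ {k} → Z k → Common k)
           (clique : ∀ {k m} → Z k → Z m → k ≢ m → Adj k m) where
    open Exp semiring using (_^_)

    cofactor-∣-power : (ν : Vector ℕ ℓ) → (∀ {k} → Common k → ν k ≡ 0 → Z k) →
                       ∏ (cofactor Z? Z⊆W clique) ∣ ∏ (λ k → reflect k ^ ν k)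
    cofactor-∣-power ν ν-zero = ∏-∣-∏ (cofactor Z? Z⊆W clique) _ pointwise
      where
      1∣ : ∀ f → 1# ∣ f
      1∣ f = f , sym (*-identityʳ f)
      power : ∀ {k} → Common k → ∀ n → n ≢ 0 → (X i - X k) ∣ reflect k ^ n
      power Wk zero    n≢0 = contradiction ≡.refl n≢0
      power Wk (suc n) _   = ∣-*ʳ _ (∣-resp (sym (reflect-other (common≢i Wk) (common≢j Wk))) (∣-refl _))
      common-divides : ∀ k → Dec (Common k) → (Common k → ν k ≢ 0) → commonFactor k ∣ reflect k ^ ν k
      common-divides k (yes Wk) ν≢0 rewrite dec-true  (common? k) Wk  = power Wk (ν k) (ν≢0 Wk)
      common-divides k (no ¬Wk) _   rewrite dec-false (common? k) ¬Wk = 1∣ _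
      pointwise : ∀ k → cofactor Z? Z⊆W clique k ∣ reflect k ^ ν k
      pointwise k with Z? k
      ... | yes _  = 1∣ _
      ... | no ¬Zk = common-divides k (common? k) (λ Wk → ¬Zk ∘ ν-zero Wk)

  module _ (ν : Vector ℕ ℓ) where
    open Exp semiring using (_^_)

    Missing : Pred (Fin ℓ) Level.zero
    Missing k = Common k × ν k ≡ 0

    missing? : Decidable Missing
    missing? k = common? k ×-dec (ν k ℕ.≟ 0)

    -- The obstruction to the monomial x^ν lying in all ideals (x_u , x_v) for the non-edges {u , v}
    -- of W.
    MissingNonEdge : Set
    MissingNonEdge = ∃₂ λ u v → Missing u × Missing v × u ≢ v × ¬ Adj u v

    missingNonEdge? : Dec MissingNonEdge
    missingNonEdge? = Fin.any? λ u → Fin.any? λ v →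
      missing? u ×-dec (missing? v ×-dec (¬? (u Fin.≟ v) ×-dec ¬? (adj? u v)))

    -- Without an obstruction the common neighbours with exponent 0 form a clique. The residue of
    -- its form is the product of x_i - x_k over all other k ∈ W, and each of these factors divides
    -- the reflected monomial because its exponent is positive.
    power-residue : ∀ {L} → All EdgeForm L → Complete L → ¬ MissingNonEdge →
                    IsResidueOf L (∏ (λ k → reflect k ^ ν k))
    power-residue {L} forms complete none = IsIdeal.resp (residue-isIdeal L) (sym (proj₂ divides))
      (IsIdeal.*-closed (residue-isIdeal L) (proj₁ divides)
        (clique-residue missing? proj₁ clique forms complete))
      where
      clique : ∀ {k m} → Missing k → Missing m → k ≢ m → Adj k m
      clique {k} {m} Mk Mm k≢m = decidable-stable (adj? k m) (λ ¬km → none (k , m , Mk , Mm , k≢m , ¬km))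
      divides : ∏ (cofactor missing? proj₁ clique) ∣ ∏ (λ k → reflect k ^ ν k)
      divides = cofactor-∣-power missing? proj₁ clique ν (λ Wk ν≡0 → Wk , ν≡0)

-- Linear forms, hyperplanes and bases of the dual space

module LinearForms {a b c e} {K : Field a b} {R : CommutativeRing c e} {ℓ : ℕ}
                   (P : SubstitutionRing (Field.commutativeRing K) R ℓ) where
  private
    module K = Field K
    module ΣK where
      open SemiringSum K.semiring public
      open SingleTerm K.+-commutativeMonoid public
    module ΣR where
      open SemiringSum (CommutativeRing.semiring R) public
      open SingleTerm (CommutativeRing.+-commutativeMonoid R) public
  open CommutativeRing R hiding (zero)
  open CommutativeRingIdeals R
  open Solver R
  open SubstitutionRing P
  open Differences P
  open SemiringSum semiring using (sum)
  open Arrangements K ℓ using (V; V*; Ker; combination; IsBasis)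

  unit-vector : Fin ℓ → V
  unit-vector s k = if does (k Fin.≟ s) then K.1# else K.0#

  unit-vector-same : ∀ s → unit-vector s s ≡ K.1#
  unit-vector-same s rewrite dec-true (s Fin.≟ s) ≡.refl = ≡.refl

  unit-vector-other : ∀ {s k} → k ≢ s → unit-vector s k ≡ K.0#
  unit-vector-other {s} {k} k≢s rewrite dec-false (k Fin.≟ s) k≢s = ≡.refl

  const-0 : const K.0# ≈ 0#
  const-0 = identityˡ-unique _ _ (trans (sym (const-+ K.0# K.0#)) (const-cong (K.+-identityˡ K.0#)))
    where open AbelianGroupProperties +-abelianGroup using (identityˡ-unique)

  const-sum : ∀ {n} (f : Vector K.Carrier n) → const (ΣK.sum f) ≈ sum (const ∘ f)
  const-sum {zero}  f = const-0
  const-sum {suc n} f = trans (const-+ _ _) (+-congˡ (const-sum (f ∘ suc)))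

  ⟪⟫-sum : ∀ σ {n} (f : Vector Carrier n) → ⟪ σ ⟫ (sum f) ≈ sum (⟪ σ ⟫ ∘ f)
  ⟪⟫-sum σ {zero}  f = ⟪⟫-0 σ
  ⟪⟫-sum σ {suc n} f = trans (⟪⟫-+ σ _ _) (+-congˡ (⟪⟫-sum σ (f ∘ suc)))

  linearForm : V* → Carrier
  linearForm α = sum (λ k → const (α k) * X k)

  KUnit : Pred K.Carrier _
  KUnit s = ∃ λ t → t K.* s K.≈ K.1#

  const-unit : ∀ {s} → KUnit s → Unit (const s)
  const-unit {s} (t , ts≈1) = const t , trans (sym (const-* t s)) (trans (const-cong ts≈1) const-1)

  expand-X : ∀ m → sum (λ s → const (unit-vector s m) * X s) ≈ X m
  expand-X m = trans
    (ΣR.sum-single (λ s → const (unit-vector s m) * X s) m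
      (λ s s≢m → trans (*-congʳ (trans (reflexive (≡.cong const (unit-vector-other (s≢m ∘ ≡.sym))))
        const-0)) (zeroˡ _)))
    (trans (*-congʳ (trans (reflexive (≡.cong const (unit-vector-same m))) const-1)) (*-identityˡ _))

  -- A linear form whose kernel, among the vectors v ∘ κ, is {v_{κ p} = v_{κ q}}.
  module HyperplaneForm (κ : Fin ℓ → Fin ℓ) (α : V*) {p q : Fin ℓ} (κp≢κq : κ p ≢ κ q)
    (⇒Ker : ∀ v → v (κ p) K.≈ v (κ q) → Ker α (v ∘ κ))
    (Ker⇒ : ∀ v → Ker α (v ∘ κ) → v (κ p) K.≈ v (κ q)) where

    -- The value of `α` at e_s ∘ κ, which is the coefficient of x_s after the substitution `X ∘ κ`.
    -- Test vectors determine it: e_s with `s` outside {κ p , κ q}, and e_{κ p} + e_{κ q}, have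
    -- equal entries at κ p and κ q, while e_{κ p} has not, which makes `leading` nonzero.
    fibreSum : V*
    fibreSum s = ΣK.sum (λ k → α k K.* unit-vector s (κ k))

    leading : K.Carrier
    leading = fibreSum (κ p)

    private
      fibreSum-other : ∀ {s} → κ p ≢ s → κ q ≢ s → fibreSum s K.≈ K.0#
      fibreSum-other {s} p≢ q≢ = ⇒Ker (unit-vector s)
        (K.reflexive (≡.trans (unit-vector-other p≢) (≡.sym (unit-vector-other q≢))))

      fibreSum-cancel : fibreSum (κ q) K.+ leading K.≈ K.0#
      fibreSum-cancel = K.trans (K.sym (ΣK.∑-distrib-+ (λ k → α k K.* unit-vector (κ q) (κ k))
        (λ k → α k K.* unit-vector (κ p) (κ k))))
        (K.trans (ΣK.sum-cong-≋ (λ k → K.sym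
          (K.distribˡ (α k) (unit-vector (κ q) (κ k)) (unit-vector (κ p) (κ k)))))
          (⇒Ker (λ m → unit-vector (κ q) m K.+ unit-vector (κ p) m) (K.trans
            (K.reflexive (≡.cong₂ K._+_ (unit-vector-other κp≢κq) (unit-vector-same (κ p))))
            (K.trans (K.+-comm _ _)
            (K.reflexive (≡.sym (≡.cong₂ K._+_ (unit-vector-same (κ q))
              (unit-vector-other (κp≢κq ∘ ≡.sym)))))))))

    leading-unit : KUnit leading
    leading-unit with K.inverse leading leading≉0
      where
      leading≉0 : ¬ leading K.≈ K.0#
      leading≉0 eq = K.1≉0 (K.trans (K.reflexive (≡.sym (unit-vector-same (κ p))))
        (K.trans (Ker⇒ (unit-vector (κ p)) eq) (K.reflexive (unit-vector-other (κp≢κq ∘ ≡.sym)))))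
    ... | t , eq = t , K.trans (K.*-comm _ _) eq

    fibreSum≈ : ∀ s → fibreSum s K.+ leading K.* unit-vector s (κ q) K.≈ leading K.* unit-vector s (κ p)
    fibreSum≈ s = cases (κ p Fin.≟ s) (κ q Fin.≟ s)
      where
      times : ∀ {x y} → x ≡ y → leading K.* x K.≈ leading K.* y
      times eq = K.reflexive (≡.cong (leading K.*_) eq)
      cases : Dec (κ p ≡ s) → Dec (κ q ≡ s) →
              fibreSum s K.+ leading K.* unit-vector s (κ q) K.≈ leading K.* unit-vector s (κ p)
      cases (yes ≡.refl) _            = K.trans
        (K.+-congˡ (K.trans (times (unit-vector-other (κp≢κq ∘ ≡.sym))) (K.zeroʳ _)))
        (K.trans (K.+-identityʳ _) (K.sym (K.trans (times (unit-vector-same (κ p))) (K.*-identityʳ _))))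
      cases (no  _)      (yes ≡.refl) = K.trans
        (K.+-congˡ (K.trans (times (unit-vector-same (κ q))) (K.*-identityʳ _)))
        (K.trans fibreSum-cancel (K.sym (K.trans (times (unit-vector-other κp≢κq)) (K.zeroʳ _))))
      cases (no  p≢s)    (no q≢s)     = K.trans
        (K.+-cong (fibreSum-other p≢s q≢s)
          (times (≡.trans (unit-vector-other q≢s) (≡.sym (unit-vector-other p≢s)))))
        (K.+-identityˡ _)

    restricted-form : ⟪ X ∘ κ ⟫ (linearForm α) ≈ const leading * (X (κ p) - X (κ q))
    restricted-form = begin
      ⟪ X ∘ κ ⟫ (linearForm α)
        ≈⟨ ⟪⟫-sum (X ∘ κ) (λ k → const (α k) * X k) ⟩
      sum (λ k → ⟪ X ∘ κ ⟫ (const (α k) * X k))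
        ≈⟨ ΣR.sum-cong-≋ expand-term ⟩
      sum (λ k → sum (λ s → const (α k K.* unit-vector s (κ k)) * X s))
        ≈⟨ ΣR.∑-comm (λ k s → const (α k K.* unit-vector s (κ k)) * X s) ⟩
      sum (λ s → sum (λ k → const (α k K.* unit-vector s (κ k)) * X s))
        ≈⟨ ΣR.sum-cong-≋ (λ s → trans
             (sym (ΣR.*-distribʳ-sum (X s) (λ k → const (α k K.* unit-vector s (κ k)))))
             (*-congʳ (sym (const-sum (λ k → α k K.* unit-vector s (κ k)))))) ⟩
      sum (λ s → const (fibreSum s) * X s)
        ≈⟨ x+y≈z⇒x≈z-y _ _ _ (trans (+-congˡ (sym (scaled-X (κ q)))) (trans
             (sym (ΣR.∑-distrib-+ (λ s → const (fibreSum s) * X s)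
               (λ s → const (leading K.* unit-vector s (κ q)) * X s)))
             (trans (ΣR.sum-cong-≋ collect) (scaled-X (κ p))))) ⟩
      const leading * X (κ p) - const leading * X (κ q)
        ≈⟨ solve 3 (λ c x y → c :* x :- c :* y := c :* (x :- y)) refl (const leading) (X (κ p)) (X (κ q)) ⟩
      const leading * (X (κ p) - X (κ q)) ∎
      where
      open SetoidReasoning setoid
      x+y≈z⇒x≈z-y : ∀ x y z → x + y ≈ z → x ≈ z - y
      x+y≈z⇒x≈z-y x y z eq = trans (solve 2 (λ x y → x := (x :+ y) :- y) refl x y) (+-congʳ eq)

      expand-term : ∀ k → ⟪ X ∘ κ ⟫ (const (α k) * X k) ≈ sum
        (λ s → const (α k K.* unit-vector s (κ k)) * X s)
      expand-term k = begin
        ⟪ X ∘ κ ⟫ (const (α k) * X k)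
          ≈⟨ trans (⟪⟫-* _ _ _) (*-cong (⟪⟫-const _ _) (⟪⟫-X _ k)) ⟩
        const (α k) * X (κ k)
          ≈⟨ *-congˡ (expand-X (κ k)) ⟨
        const (α k) * sum (λ s → const (unit-vector s (κ k)) * X s)
          ≈⟨ ΣR.*-distribˡ-sum (const (α k)) (λ s → const (unit-vector s (κ k)) * X s) ⟩
        sum (λ s → const (α k) * (const (unit-vector s (κ k)) * X s))
          ≈⟨ ΣR.sum-cong-≋ (λ s → trans (sym (*-assoc (const (α k)) (const (unit-vector s (κ k))) (X s)))
              (*-congʳ (sym (const-* (α k) (unit-vector s (κ k)))))) ⟩
        sum (λ s → const (α k K.* unit-vector s (κ k)) * X s) ∎

      scaled-X : ∀ m → sum (λ s → const (leading K.* unit-vector s m) * X s) ≈ const leading * X m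
      scaled-X m = begin
        sum (λ s → const (leading K.* unit-vector s m) * X s)
          ≈⟨ ΣR.sum-cong-≋ (λ s → trans (*-congʳ (const-* leading (unit-vector s m)))
              (*-assoc (const leading) (const (unit-vector s m)) (X s))) ⟩
        sum (λ s → const leading * (const (unit-vector s m) * X s))
          ≈⟨ ΣR.*-distribˡ-sum (const leading) (λ s → const (unit-vector s m) * X s) ⟨
        const leading * sum (λ s → const (unit-vector s m) * X s)
          ≈⟨ *-congˡ (expand-X m) ⟩
        const leading * X m ∎

      collect : ∀ s → const (fibreSum s) * X s + const (leading K.* unit-vector s (κ q)) * X s ≈
                      const (leading K.* unit-vector s (κ p)) * X s
      collect s = trans (sym (distribʳ (X s) (const (fibreSum s)) _))
        (*-congʳ (trans (sym (const-+ (fibreSum s) _)) (const-cong (fibreSum≈ s))))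

  IsMultiple : V* → Fin ℓ → Fin ℓ → K.Carrier → Set _
  IsMultiple α p q s = KUnit s × α p K.≈ s × α q K.+ s K.≈ K.0# × (∀ k → k ≢ p → k ≢ q → α k K.≈ K.0#) ×
                       linearForm α ≈ const s * (X p - X q)

  hyperplane-form : ∀ α {p q} → p ≢ q → (∀ v → v p K.≈ v q → Ker α v) → (∀ v → Ker α v → v p K.≈ v q) →
                    ∃ λ s → IsMultiple α p q s
  hyperplane-form α {p} {q} p≢q ⇒Ker Ker⇒ = leading , leading-unit , fibreSum≈α p
    , K.trans (K.+-cong (fibreSum≈α q)
      (K.sym (K.trans (K.*-congˡ (K.reflexive (unit-vector-same q))) (K.*-identityʳ _))))
              (K.trans (fibreSum≈ q) (K.trans (K.*-congˡ (K.reflexive (unit-vector-other p≢q)))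
                (K.zeroʳ _)))
    , (λ k k≢p k≢q → K.trans (fibreSum≈α k) (K.trans (K.sym (K.+-identityʳ _))
        (K.trans (K.+-congˡ (K.sym (K.trans (K.*-congˡ (K.reflexive (unit-vector-other (k≢q ∘ ≡.sym))))
          (K.zeroʳ _))))
          (K.trans (fibreSum≈ k) (K.trans (K.*-congˡ (K.reflexive (unit-vector-other (k≢p ∘ ≡.sym))))
            (K.zeroʳ _))))))
    , trans (sym (⟪X⟫ _)) restricted-form
    where
    open HyperplaneForm id α {p} {q} p≢q ⇒Ker Ker⇒
    fibreSum≈α : ∀ s → α s K.≈ fibreSum s
    fibreSum≈α s = K.sym (K.trans (ΣK.sum-single (λ k → α k K.* unit-vector s k) s
      (λ k k≢s → K.trans (K.*-congˡ (K.reflexive (unit-vector-other k≢s))) (K.zeroʳ _)))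
      (K.trans (K.*-congˡ (K.reflexive (unit-vector-same s))) (K.*-identityʳ _)))

  module _ {α : V*} {p q : Fin ℓ} (p≢q : p ≢ q) {s} (multiple : IsMultiple α p q s) where
    private
      C : Carrier
      C = const s
      C-unit : Unit C
      C-unit = const-unit (proj₁ multiple)
      αp : const (α p) ≈ C
      αp = const-cong (proj₁ (proj₂ multiple))
      αq : const (α q) ≈ - C
      αq = inverseˡ-unique _ _ (trans (sym (const-+ _ _))
        (trans (const-cong (proj₁ (proj₂ (proj₂ multiple)))) const-0))
        where open AbelianGroupProperties +-abelianGroup using (inverseˡ-unique)
      α-other : ∀ k → k ≢ p → k ≢ q → const (α k) ≈ 0#
      α-other k k≢p k≢q = trans (const-cong (proj₁ (proj₂ (proj₂ (proj₂ multiple))) k k≢p k≢q)) const-0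
      form≈ : linearForm α ≈ C * (X p - X q)
      form≈ = proj₂ (proj₂ (proj₂ (proj₂ multiple)))

      unit-∣ : ∀ {d f} → d ∣ C * f → d ∣ f
      unit-∣ {d} {f} d∣Cf = ∣-resp (trans (sym (*-assoc _ _ _))
        (trans (*-congʳ (proj₂ C-unit)) (*-identityˡ f)))
        (∣-*ˡ (proj₁ C-unit) d∣Cf)

    difference∣⇒form∣ : ∀ {f} → (X p - X q) ∣ f → linearForm α ∣ f
    difference∣⇒form∣ {f} (h , eq) = h * proj₁ C-unit , trans eq
      (sym (trans (*-congˡ form≈) (trans (*-assoc _ _ _)
      (*-congˡ (trans (sym (*-assoc _ _ _)) (trans (*-congʳ (proj₂ C-unit)) (*-identityˡ _)))))))

    form∣⇒difference∣ : ∀ {f} → linearForm α ∣ f → (X p - X q) ∣ f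
    form∣⇒difference∣ {f} (h , eq) = h * C , trans eq (trans (*-congˡ form≈) (sym (*-assoc h C _)))

    module _ (η : Vector Carrier ℓ) where

      wedge : Fin ℓ → Fin ℓ → Carrier
      wedge k m = η k * const (α m) - η m * const (α k)

      -- For `k` outside {p , q} the coefficient at (k , p) is s η_k, and the one at (q , p) is s
      -- (η_p + η_q), where `s` is a unit.
      wedge⇒logarithmic : (∀ k m → linearForm α ∣ wedge k m) → Logarithmic p q η
      wedge⇒logarithmic form∣ =
        (λ k k≢p k≢q → unit-∣ (∣-resp (trans
          (+-cong (*-congˡ αp) (trans (-‿cong (trans (*-congˡ (α-other k k≢p k≢q)) (zeroʳ _))) ε⁻¹≈ε))
                                             (trans (+-identityʳ _) (*-comm _ _)))
                                     (form∣⇒difference∣ (form∣ k p))))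
        , unit-∣ (∣-resp (trans (+-cong (*-congˡ αp) (-‿cong (*-congˡ αq)))
                                (solve 3 (λ c x y → y :* c :- x :* :- c := c :* (x :+ y)) refl C (η p)
                                  (η q)))
                         (form∣⇒difference∣ (form∣ q p)))
        where open AbelianGroupProperties +-abelianGroup using (ε⁻¹≈ε)

      logarithmic⇒wedge : Logarithmic p q η → ∀ k m → linearForm α ∣ wedge k m
      logarithmic⇒wedge (∣η , ∣η+η) k m = difference∣⇒form∣
        (cases (k Fin.≟ p) (k Fin.≟ q) (m Fin.≟ p) (m Fin.≟ q))
        where
        module I = IsIdeal (∣-isIdeal (X p - X q))
        same : ∀ k → (X p - X q) ∣ wedge k k
        same k = I.resp (sym (-‿inverseʳ _)) I.0∈
        mixed : (X p - X q) ∣ wedge p q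
        mixed = I.resp (sym (trans (+-cong (*-congˡ αq) (-‿cong (*-congˡ αp)))
                  (solve 3 (λ c x y → x :* :- c :- y :* c := :- c :* (x :+ y)) refl C (η p) (η q))))
                (I.*-closed (- C) ∣η+η)
        anti : ∀ k m → (X p - X q) ∣ wedge k m → (X p - X q) ∣ wedge m k
        anti k m ∣km = I.resp (solve 2 (λ x y → :- (x :- y) := y :- x) refl (η k * const (α m))
          (η m * const (α k)))
          (I.neg-closed ∣km)
        outside : ∀ k m → k ≢ p → k ≢ q → (X p - X q) ∣ wedge k m
        outside k m k≢p k≢q = I.+-closed (∣-*ʳ _ (∣η k k≢p k≢q))
          (I.neg-closed (I.resp (sym (trans (*-congˡ (α-other k k≢p k≢q)) (zeroʳ _))) I.0∈))
        cases : Dec (k ≡ p) → Dec (k ≡ q) → Dec (m ≡ p) → Dec (m ≡ q) → (X p - X q) ∣ wedge k m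
        cases (yes ≡.refl) _            (yes ≡.refl) _            = same p
        cases (yes ≡.refl) _            (no _)       (yes ≡.refl) = mixed
        cases (yes ≡.refl) _            (no m≢p)     (no m≢q)     = anti m p (outside m p m≢p m≢q)
        cases (no  _)      (yes ≡.refl) _            (yes ≡.refl) = same q
        cases (no  _)      (yes ≡.refl) (yes ≡.refl) (no _)       = anti p q mixed
        cases (no  _)      (yes ≡.refl) (no m≢p)     (no m≢q)     = anti m q (outside m q m≢p m≢q)
        cases (no  k≢p)    (no  k≢q)    _            _            = outside k m k≢p k≢q

  module DualBasis {n} {β : Vector V* n} (basis : IsBasis β) where
    open IsBasis basis

    coordinates : Fin ℓ → Vector K.Carrier n
    coordinates k = proj₁ (spanning (λ l → unit-vector k l))

    private
      coordinates≈ : ∀ k l → unit-vector k l K.≈ combination (coordinates k) β l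
      coordinates≈ k = proj₂ (spanning (λ l → unit-vector k l))

      kronecker : Fin n → Fin n → K.Carrier
      kronecker t u = if does (u Fin.≟ t) then K.1# else K.0#

      pairing : Fin n → Fin n → K.Carrier
      pairing t u = ΣK.sum (λ k → β t k K.* coordinates k u)

      expand : ∀ (γ : V*) l → ΣK.sum (λ k → γ k K.* unit-vector k l) K.≈ γ l
      expand γ l = K.trans (ΣK.sum-single (λ k → γ k K.* unit-vector k l) l
        (λ k k≢l → K.trans (K.*-congˡ (K.reflexive (unit-vector-other (k≢l ∘ ≡.sym)))) (K.zeroʳ _)))
        (K.trans (K.*-congˡ (K.reflexive (unit-vector-same l))) (K.*-identityʳ _))

      pairing-combination : ∀ t l → combination (pairing t) β l K.≈ β t l
      pairing-combination t l = begin
        ΣK.sum (λ u → pairing t u K.* β u l)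
          ≈⟨ ΣK.sum-cong-≋ (λ u → K.trans (ΣK.*-distribʳ-sum (β u l) (λ k → β t k K.* coordinates k u))
              (ΣK.sum-cong-≋ (λ k → K.*-assoc (β t k) (coordinates k u) (β u l)))) ⟩
        ΣK.sum (λ u → ΣK.sum (λ k → β t k K.* (coordinates k u K.* β u l)))
          ≈⟨ ΣK.∑-comm (λ u k → β t k K.* (coordinates k u K.* β u l)) ⟩
        ΣK.sum (λ k → ΣK.sum (λ u → β t k K.* (coordinates k u K.* β u l)))
          ≈⟨ ΣK.sum-cong-≋ (λ k → K.trans (K.sym
              (ΣK.*-distribˡ-sum (β t k) (λ u → coordinates k u K.* β u l)))
              (K.*-congˡ (K.sym (coordinates≈ k l)))) ⟩
        ΣK.sum (λ k → β t k K.* unit-vector k l)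
          ≈⟨ expand (β t) l ⟩
        β t l ∎
        where open SetoidReasoning K.setoid

    -- Spanning provides the matrix `coordinates` as an inverse of β on one side only. Independence
    -- makes it two-sided, since `pairing t` and `kronecker t` both express β_t in terms of β.
    pairing≈ : ∀ t u → pairing t u K.≈ kronecker t u
    pairing≈ t u = x∙y⁻¹≈ε⇒x≈y _ _ (independent (λ u → pairing t u K.- kronecker t u) vanishes u)
      where
      open AbelianGroupProperties K.+-abelianGroup using (x∙y⁻¹≈ε⇒x≈y)
      open Solver K.commutativeRing using () renaming
        (solve to solveK; _:=_ to _:=K_; _:+_ to _:+K_; _:*_ to _:*K_; _:-_ to _:-K_)
      kronecker-combination : ∀ l → combination (kronecker t) β l K.≈ β t l
      kronecker-combination l = K.trans
        (ΣK.sum-single (λ u → kronecker t u K.* β u l) t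
          (λ u u≢t → K.trans (K.*-congʳ (K.reflexive
          (≡.cong (λ z → if z then K.1# else K.0#) (dec-false (u Fin.≟ t) u≢t)))) (K.zeroˡ _)))
        (K.trans (K.*-congʳ (K.reflexive (≡.cong (λ z → if z then K.1# else K.0#)
          (dec-true (t Fin.≟ t) ≡.refl)))) (K.*-identityˡ _))
      vanishes : ∀ l → combination (λ u → pairing t u K.- kronecker t u) β l K.≈ K.0#
      vanishes l = a+b≈c⇒c≈b⇒a≈0 (K.trans
        (K.sym (ΣK.∑-distrib-+ (λ u → (pairing t u K.- kronecker t u) K.* β u l)
        (λ u → kronecker t u K.* β u l)))
          (K.trans (ΣK.sum-cong-≋ (λ u → solveK 3 (λ x y z → (x :-K y) :*K z :+K y :*K z :=K x :*K z) K.refl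
            (pairing t u) (kronecker t u) (β u l)))
                   (pairing-combination t l)))
        (kronecker-combination l)
        where
        open AbelianGroupProperties K.+-abelianGroup using (identityˡ-unique)
        a+b≈c⇒c≈b⇒a≈0 : ∀ {x y z} → x K.+ y K.≈ z → y K.≈ z → x K.≈ K.0#
        a+b≈c⇒c≈b⇒a≈0 x+y≈z y≈z = identityˡ-unique _ _ (K.trans x+y≈z (K.sym y≈z))

    component : Vector Carrier ℓ → Fin n → Carrier
    component η t = sum (λ k → η k * const (coordinates k t))

    component-combination : ∀ η l → η l ≈ sum (λ t → component η t * const (β t l))
    component-combination η l = sym (begin
      sum (λ t → component η t * const (β t l))
        ≈⟨ ΣR.sum-cong-≋ (λ t → trans (ΣR.*-distribʳ-sum (const (β t l))
            (λ k → η k * const (coordinates k t)))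
             (ΣR.sum-cong-≋ (λ k → trans (*-assoc (η k) (const (coordinates k t)) (const (β t l)))
               (*-congˡ (sym (const-* (coordinates k t) (β t l))))))) ⟩
      sum (λ t → sum (λ k → η k * const (coordinates k t K.* β t l)))
        ≈⟨ ΣR.∑-comm (λ t k → η k * const (coordinates k t K.* β t l)) ⟩
      sum (λ k → sum (λ t → η k * const (coordinates k t K.* β t l)))
        ≈⟨ ΣR.sum-cong-≋ (λ k → trans (sym (ΣR.*-distribˡ-sum (η k)
            (λ t → const (coordinates k t K.* β t l))))
             (*-congˡ (trans (sym (const-sum (λ t → coordinates k t K.* β t l)))
               (const-cong (K.sym (coordinates≈ k l)))))) ⟩
      sum (λ k → η k * const (unit-vector k l))
        ≈⟨ ΣR.sum-single (λ k → η k * const (unit-vector k l)) l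
            (λ k k≢l → trans (*-congˡ (trans
            (reflexive (≡.cong const (unit-vector-other (k≢l ∘ ≡.sym)))) const-0)) (zeroʳ _)) ⟩
      η l * const (unit-vector l l)
        ≈⟨ trans (*-congˡ (trans (reflexive (≡.cong const (unit-vector-same l))) const-1)) (*-identityʳ _) ⟩
      η l ∎)
      where open SetoidReasoning setoid

    component-unique : ∀ {η} {g : Vector Carrier n} → (∀ k → η k ≈ sum (λ t → g t * const (β t k))) →
                       ∀ u → component η u ≈ g u
    component-unique {η} {g} η≈ u = begin
      sum (λ k → η k * const (coordinates k u))
        ≈⟨ ΣR.sum-cong-≋ (λ k → trans (*-congʳ (η≈ k))
            (trans (ΣR.*-distribʳ-sum (const (coordinates k u)) (λ t → g t * const (β t k)))
             (ΣR.sum-cong-≋ (λ t → trans (*-assoc (g t) (const (β t k)) (const (coordinates k u)))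
               (*-congˡ (sym (const-* (β t k) (coordinates k u)))))))) ⟩
      sum (λ k → sum (λ t → g t * const (β t k K.* coordinates k u)))
        ≈⟨ ΣR.∑-comm (λ k t → g t * const (β t k K.* coordinates k u)) ⟩
      sum (λ t → sum (λ k → g t * const (β t k K.* coordinates k u)))
        ≈⟨ ΣR.sum-cong-≋ (λ t → trans (sym (ΣR.*-distribˡ-sum (g t)
            (λ k → const (β t k K.* coordinates k u))))
             (*-congˡ (trans (sym (const-sum (λ k → β t k K.* coordinates k u)))
               (const-cong (pairing≈ t u))))) ⟩
      sum (λ t → g t * const (kronecker t u))
        ≈⟨ ΣR.sum-single (λ t → g t * const (kronecker t u)) u
            (λ t t≢u → trans (*-congˡ (trans
            (reflexive (≡.cong (λ z → const (if z then K.1# else K.0#))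
            (dec-false (u Fin.≟ t) (t≢u ∘ ≡.sym)))) const-0)) (zeroʳ _)) ⟩
      g u * const (kronecker u u)
        ≈⟨ trans (*-congˡ (trans (reflexive
            (≡.cong (λ z → const (if z then K.1# else K.0#)) (dec-true (u Fin.≟ u) ≡.refl))) const-1))
            (*-identityʳ _) ⟩
      g u ∎
      where open SetoidReasoning setoid

    -- Modulo x_p - x_q a logarithmic form is η_p (dx_p - dx_q), a multiple of β_t.
    component-residue : ∀ {η p q t s} → Logarithmic p q η → IsMultiple (β t) p q s →
                        (X p - X q) ∣ (const s * component η t - η p)
    component-residue {η} {p} {q} {t} {s} (∣η , ∣η+η) (_ , βp , βq , β-other , _) =
      R/d.trans (≈⇒~ scaled) (R/d.trans
        (CommutativeMonoidSum.sum-cong-≋ R/d.+-commutativeMonoid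
          {x = λ k → const s * (η k * const (coordinates k t))}
          {y = λ k → η p * const (β t k K.* coordinates k t)} pointwise)
        (≈⇒~ total))
      where
      module R/d = CommutativeRing (((X p - X q) ∣_) / ∣-isIdeal (X p - X q))
      scaled : const s * component η t ≈ sum (λ k → const s * (η k * const (coordinates k t)))
      scaled = ΣR.*-distribˡ-sum (const s) (λ k → η k * const (coordinates k t))
      total : sum (λ k → η p * const (β t k K.* coordinates k t)) ≈ η p
      total = trans (sym (ΣR.*-distribˡ-sum (η p) (λ k → const (β t k K.* coordinates k t))))
        (trans (*-congˡ (trans (sym (const-sum (λ k → β t k K.* coordinates k t)))
        (trans (const-cong (K.trans (pairing≈ t t)
          (K.reflexive (≡.cong (λ z → if z then K.1# else K.0#) (dec-true (t Fin.≟ t) ≡.refl))))) const-1)))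
        (*-identityʳ _))
      βq≈ : const (β t q) ≈ - const s
      βq≈ = inverseˡ-unique _ _ (trans (sym (const-+ _ _)) (trans (const-cong βq) const-0))
        where open AbelianGroupProperties +-abelianGroup using (inverseˡ-unique)
      coefficient : ∀ k → (const s * η k) R/d.≈ (η p * const (β t k))
      coefficient k = cases (k Fin.≟ p) (k Fin.≟ q)
        where
        module I = IsIdeal (∣-isIdeal (X p - X q))
        cases : Dec (k ≡ p) → Dec (k ≡ q) → (const s * η k) R/d.≈ (η p * const (β t k))
        cases (yes ≡.refl) _ = ≈⇒~ (trans (*-comm _ _) (*-congˡ (const-cong (K.sym βp))))
        cases (no _) (yes ≡.refl) = I.resp
          (sym (trans (+-congˡ (-‿cong (*-congˡ βq≈)))
            (solve 3 (λ c x y → c :* y :- x :* :- c := c :* (x :+ y)) refl (const s) (η p) (η q))))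
          (I.*-closed (const s) ∣η+η)
        cases (no k≢p) (no k≢q) = I.+-closed (I.*-closed (const s) (∣η k k≢p k≢q))
          (I.neg-closed (I.resp (sym (trans (*-congˡ (trans (const-cong (β-other k k≢p k≢q)) const-0))
            (zeroʳ _))) I.0∈))
      pointwise : ∀ k → (const s * (η k * const (coordinates k t))) R/d.≈
        (η p * const (β t k K.* coordinates k t))
      pointwise k = R/d.trans (≈⇒~ (sym (*-assoc _ _ _)))
        (R/d.trans (R/d.*-congʳ (coefficient k))
          (≈⇒~ (trans (*-assoc _ _ _) (*-congˡ (sym (const-* _ _))))))

AllPairs-map⁺ : ∀ {a b p r s} {A : Set a} {B : Set b} {f : A → B} {P : A → Set p}
                {R : A → A → Set r} {S : B → B → Set s} →
                (∀ {x y} → P x → P y → R x y → S (f x) (f y)) →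
                ∀ {xs} → All P xs → AllPairs R xs → AllPairs S (List.map f xs)
AllPairs-map⁺ RS []        []            = []
AllPairs-map⁺ RS (px ∷ ps) (xRs ∷ pairs) =
  All.map⁺ (All.zipWith (λ (py , xRy) → RS px py xRy) (ps , xRs)) ∷ AllPairs-map⁺ RS ps pairs

-- Defining forms and residues of the graphic arrangement

module GraphicArrangement {a b c e} {K : Field a b} {R : CommutativeRing c e} {ℓ : ℕ}
                          (P : SubstitutionRing (Field.commutativeRing K) R ℓ)
                          (1≉0 : ¬ CommutativeRing._≈_ R (CommutativeRing.1# R) (CommutativeRing.0# R))
                          (G : SimpleGraph ℓ) {i j : Fin ℓ} (ij : SimpleGraph.Adj G i j) where
  private
    module K = Field K
  open SimpleGraph G using (Adj)
  open Arrangements K ℓ using (V; V*; Ker; graphic; _^_; DefiningForms; IsBasis)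
  open SubstitutionRing P using (const)
  open LinearForms {K = K} P
  open ResidueAlong P 1≉0 G ij

  private
    H : Pred V b
    H = graphic G (i , j , ij)

    κi≡κj : κ i ≡ κ j
    κi≡κj = ≡.trans (merge-target j i) (≡.sym (merge-same j i))

    cong-V : ∀ (v : V) {k m} → k ≡ m → v k K.≈ v m
    cong-V v eq = K.reflexive (≡.cong v eq)

    κ-fixes : ∀ {v} → H v → ∀ k → v (κ k) K.≈ v k
    κ-fixes {v} vi≈vj k with k Fin.≟ j
    ... | yes ≡.refl = vi≈vj
    ... | no  _      = K.refl

    H≢⇒κ-separates : ∀ {p q} (pq : Adj p q) → ¬ graphic G (p , q , pq) ≐ H → κ p ≢ κ q
    H≢⇒κ-separates pq ≢H κp≡κq with merge-identifies (adjacent-distinct G pq) κp≡κq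
    ... | inj₁ (≡.refl , ≡.refl) = ≢H (K.sym , K.sym)
    ... | inj₂ (≡.refl , ≡.refl) = ≢H (id , id)

    κ-separates⇒H≢ : ∀ {p q} (pq : Adj p q) → κ p ≢ κ q → ¬ graphic G (p , q , pq) ≐ H
    κ-separates⇒H≢ {p} {q} pq κp≢κq (_ , H⊆) = K.1≉0 (K.trans
      (K.reflexive (≡.sym (unit-vector-same (κ p))))
      (K.trans (H⊆ {unit-vector (κ p) ∘ κ} (cong-V (unit-vector (κ p)) κi≡κj))
               (K.reflexive (unit-vector-other (κp≢κq ∘ ≡.sym)))))

    -- All vectors v ∘ κ lie in H, so equality of the two subsets of H is exactly what
    -- `HyperplaneForm` asks of `α` on these vectors.
    restricted-difference : ∀ {p q} (pq : Adj p q) → κ p ≢ κ q → ∀ {α} →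
                            (H ∩ graphic G (p , q , pq)) ≐ (H ∩ Ker α) →
                            Difference (linearForm α) (κ p) (κ q)
    restricted-difference {p} {q} pq κp≢κq {α} (⊆Ker , Ker⊆) = const leading , const-unit leading-unit ,
      restricted-form
      where
      open HyperplaneForm κ α {p} {q} κp≢κq
        (λ v eq → proj₂ (⊆Ker {v ∘ κ} (cong-V v κi≡κj , eq)))
        (λ v eq → proj₂ (Ker⊆ {v ∘ κ} (cong-V v κi≡κj , eq)))

    same-restriction : ∀ {p q p′ q′} (pq : Adj p q) (p′q′ : Adj p′ q′) → SamePair (κ p) (κ q) (κ p′)
      (κ q′) →
                       ∀ {v} → H v → v p K.≈ v q → v p′ K.≈ v q′
    same-restriction {p} {q} {p′} {q′} pq p′q′ same {v} Hv vp≈vq =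
      K.trans (K.sym (κ-fixes {v} Hv p′)) (K.trans (swap same) (κ-fixes {v} Hv q′))
      where
      vκ : v (κ p) K.≈ v (κ q)
      vκ = K.trans (κ-fixes {v} Hv p) (K.trans vp≈vq (K.sym (κ-fixes {v} Hv q)))
      swap : SamePair (κ p) (κ q) (κ p′) (κ q′) → v (κ p′) K.≈ v (κ q′)
      swap (inj₁ (eq , eq′)) = K.trans (cong-V v (≡.sym eq)) (K.trans vκ (cong-V v eq′))
      swap (inj₂ (eq , eq′)) = K.trans (cong-V v (≡.sym eq′)) (K.trans (K.sym vκ) (cong-V v eq))

  edge-form : ∀ {p q} (pq : Adj p q) {α} → graphic G (p , q , pq) ≐ (U ∩ Ker α) → ∃ λ s → IsMultiple α p q s
  edge-form {p} {q} pq {α} (⊆Ker , Ker⊆) = hyperplane-form α (adjacent-distinct G pq)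
    (λ v eq → proj₂ (⊆Ker {v} eq)) (λ v eq → Ker⊆ {v} (_ , eq))

  module _ (restricted : DefiningForms H (graphic G ^ (i , j , ij))) where
    open DefiningForms restricted

    L : List (CommutativeRing.Carrier R)
    L = List.map linearForm forms

    L-edges : All EdgeForm L
    L-edges = All.map⁺ (All.map (λ { (((p , q , pq) , ≢H) , eq) →
      p , q , pq , H≢⇒κ-separates pq ≢H , restricted-difference pq (H≢⇒κ-separates pq ≢H) eq }) sound)

    L-complete : Complete L
    L-complete {p} {q} pq κp≢κq = Any.map⁺ (Any.map (restricted-difference pq κp≢κq)
      (complete ((p , q , pq) , κ-separates⇒H≢ pq κp≢κq)))

    -- Two forms that restrict to multiples of the same difference come from edges with the same
    -- image under `κ`, and such edges cut out the same subset of H.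
    L-distinct : AllPairs Distinct L
    L-distinct = AllPairs-map⁺ different sound distinct
      where
      different : ∀ {α β} → (∃ λ k → (graphic G ^ (i , j , ij)) k ≐ (H ∩ Ker α)) →
                  (∃ λ k → (graphic G ^ (i , j , ij)) k ≐ (H ∩ Ker β)) →
                  ¬ ((H ∩ Ker α) ≐ (H ∩ Ker β)) → Distinct (linearForm α) (linearForm β)
      different {α} {β} (((p , q , pq) , ≢H) , eq) (((p′ , q′ , p′q′) , ≢H′) , eq′) α≢β {r}
        {s} r≢s diff diff′ =
        α≢β ( (λ {v} (Hv , αv) → proj₁ eq′ {v}
          (Hv , same-restriction pq p′q′ pair {v} Hv (proj₂ (proj₂ eq {v} (Hv , αv)))))
            , (λ {v} (Hv , βv) → proj₁ eq {v}
              (Hv , same-restriction p′q′ pq (flip pair) {v} Hv (proj₂ (proj₂ eq′ {v} (Hv , βv))))))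
        where
        κp≢κq = H≢⇒κ-separates pq ≢H
        κp′≢κq′ = H≢⇒κ-separates p′q′ ≢H′
        flip : ∀ {a b c d : Fin ℓ} → SamePair a b c d → SamePair c d a b
        flip (inj₁ (x , y)) = inj₁ (≡.sym x , ≡.sym y)
        flip (inj₂ (x , y)) = inj₂ (≡.sym y , ≡.sym x)
        compose : ∀ {a b c d e f : Fin ℓ} → SamePair a b c d → SamePair c d e f → SamePair a b e f
        compose (inj₁ (≡.refl , ≡.refl)) t = t
        compose (inj₂ (≡.refl , ≡.refl)) (inj₁ (x , y)) = inj₂ (y , x)
        compose (inj₂ (≡.refl , ≡.refl)) (inj₂ (x , y)) = inj₁ (y , x)
        pair : SamePair (κ p) (κ q) (κ p′) (κ q′)
        pair = compose
          (difference-unique {linearForm α} κp≢κq r≢s (restricted-difference pq κp≢κq eq) diff)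
          (flip (difference-unique {linearForm β} κp′≢κq′ r≢s
            (restricted-difference p′q′ κp′≢κq′ eq′) diff′))

  module _ {m} {αᴴ : V*} {αs : Vector V* m} (isBasis : IsBasis (αᴴ Vector.∷ αs))
           {s} (multiple : IsMultiple αᴴ i j s) (L : List (CommutativeRing.Carrier R)) where
    open CommutativeRing R hiding (zero)
    open CommutativeRingIdeals R
    open SubstitutionRing P using (X)
    open Differences P
    open DualBasis isBasis
    open SemiringSum semiring using (sum)
    private
      module R/d = CommutativeRing (((X i - X j) ∣_) / ∣-isIdeal (X i - X j))

      C C⁻¹ : Carrier
      C   = const s
      C⁻¹ = proj₁ (const-unit (proj₁ multiple))

      C⁻¹C≈1 : C⁻¹ * C ≈ 1#
      C⁻¹C≈1 = proj₂ (const-unit (proj₁ multiple))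

      cancel : ∀ f → C⁻¹ * (C * f) ≈ f
      cancel f = trans (sym (*-assoc C⁻¹ C f)) (trans (*-congʳ C⁻¹C≈1) (*-identityˡ f))

    -- If `αᴴ` is s (x_i - x_j), the coefficient of dα_H is congruent to s⁻¹ η_i; this is the scalar
    -- `w`.
    residue⇒ : ∀ {η} {g : Vector Carrier (suc m)} {r} → Logarithmic i j η →
               (∀ k → η k ≈ sum (λ t → g t * const ((αᴴ Vector.∷ αs) t k))) →
               linearForm αᴴ ∣ (product L * r - g zero) →
               ∃ λ w → (X i - X j) ∣ (product L * r - w * η i)
    residue⇒ {η} {g} log η≈ form∣ = C⁻¹ , R/d.trans
      (form∣⇒difference∣ (adjacent-distinct G ij) multiple form∣)
      (R/d.trans (≈⇒~ (sym (trans (cancel _) (component-unique {η} {g} η≈ zero))))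
        (R/d.*-congˡ {C⁻¹} (component-residue {η} {t = zero} log multiple)))

    residue⇐ : ∀ {r} → IsResidueOf L r → ∃ λ η → (∀ {p q} → Adj p q → Logarithmic p q η) ×
               ∃ λ (g : Vector Carrier (suc m)) →
                 (∀ k → η k ≈ sum (λ t → g t * const ((αᴴ Vector.∷ αs) t k))) ×
               linearForm αᴴ ∣ (product L * r - g zero)
    -- The form is multiplied by s beforehand, so that its dα_H coefficient becomes η_i modulo x_i -
    -- x_j.
    residue⇐ {r} (η , log , d∣) = Cη , Cη-log , component Cη , component-combination Cη
      , difference∣⇒form∣ (adjacent-distinct G ij) multiple (R/d.trans d∣ (R/d.sym (R/d.trans
          (≈⇒~ (sym (cancel _))) (R/d.trans
            (R/d.*-congˡ {C⁻¹} (component-residue {Cη} {t = zero} (Cη-log ij) multiple))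
            (≈⇒~ (cancel (η i)))))))
      where
      Cη : Vector Carrier ℓ
      Cη k = C * η k
      Cη-log : ∀ {p q} → Adj p q → Logarithmic p q Cη
      Cη-log pq = (λ k k≢p k≢q → ∣-*ˡ C (proj₁ (log pq) k k≢p k≢q))
                , ∣-resp (distribˡ C _ _) (∣-*ˡ C (proj₂ (log pq)))

-- The residue ideal as an intersection

module GraphicResidue {c e : Level} (K : Field c e) {ℓ : ℕ} (G : SimpleGraph ℓ) {i j : Fin ℓ}
                      (ij : SimpleGraph.Adj G i j) where
  private
    module K = Field K
  open SimpleGraph G using (Adj)
  open Arrangements K ℓ hiding (_^_)
  open Polynomials K ℓ
  open Monomials ℓ
  open Substitution K ℓ
  private
    module S = CommutativeRing polynomialRing
  open CommutativeRingIdeals polynomialRing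
  open Differences substitutionRing
  open LinearForms {K = K} substitutionRing

  1≉0 : ¬ 1ₛ ≋ 0ₛ
  1≉0 eq = K.1≉0 (K.trans (K.sym (K.+-identityʳ K.1#)) (K.trans (K.reflexive (≡.sym constant)) (eq 𝟘)))
    where
    constant : coeff 1ₛ 𝟘 ≡ K.1# K.+ K.0#
    constant rewrite dec-true (𝟘 ≟ₘ 𝟘) ≡.refl = ≡.refl

  open ResidueAlong substitutionRing 1≉0 G ij
  open GraphicArrangement {K = K} substitutionRing 1≉0 G ij

  private
    wedgeₛ : V* → Ω¹ → Fin ℓ → Fin ℓ → S
    wedgeₛ α η k m = η k *ₛ const (α m) -ₛ η m *ₛ const (α k)

  ∈Ω²⇒∣wedge : ∀ {α : V*} {η : Ω¹} → (η ∧ d α) ∈ ⌜ α ⌝ Ω² → ∀ k m → ⌜ α ⌝ ∣ wedgeₛ α η k m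
  ∈Ω²⇒∣wedge {α} {η} (τ , η∧dα≋) k m = cases (Fin.<-cmp k m)
    where
    ordered : ∀ k m → k Fin.< m → ⌜ α ⌝ ∣ wedgeₛ α η k m
    ordered k m k<m = ≡.subst (λ k → ⌜ α ⌝ ∣ wedgeₛ α η k m) inject≡k
      (τ m k′ , S.trans {wedgeₛ α η (inject k′) m} {⌜ α ⌝ *ₛ τ m k′} {τ m k′ *ₛ ⌜ α ⌝} (η∧dα≋ m k′)
        (S.*-comm ⌜ α ⌝ (τ m k′)))
      where
      k′ : Fin (toℕ m)
      k′ = fromℕ< k<m
      inject≡k : inject k′ ≡ k
      inject≡k = Fin.toℕ-injective (≡.trans (Fin.toℕ-inject k′) (Fin.toℕ-fromℕ< k<m))
    cases : Tri (k Fin.< m) (k ≡ m) (m Fin.< k) → ⌜ α ⌝ ∣ wedgeₛ α η k m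
    cases (tri< k<m _ _)    = ordered k m k<m
    cases (tri≈ _ ≡.refl _) = IsIdeal.resp (∣-isIdeal ⌜ α ⌝) {0ₛ} {wedgeₛ α η k k}
      (S.sym {wedgeₛ α η k k} {0ₛ} (S.-‿inverseʳ (η k *ₛ const (α k)))) (IsIdeal.0∈ (∣-isIdeal ⌜ α ⌝))
    -- Ω² records only one order of the indices. Divisibility of a difference is a congruence modulo
    -- the form, and its symmetry gives the other order.
    cases (tri> _ _ m<k)    = CommutativeRing.sym ((⌜ α ⌝ ∣_) / ∣-isIdeal ⌜ α ⌝)
      {η m *ₛ const (α k)} {η k *ₛ const (α m)} (ordered m k m<k)

  ∣wedge⇒∈Ω² : ∀ {α : V*} {η : Ω¹} → (∀ k m → ⌜ α ⌝ ∣ wedgeₛ α η k m) → (η ∧ d α) ∈ ⌜ α ⌝ Ω²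
  ∣wedge⇒∈Ω² {α} {η} ∣w = (λ b a → proj₁ (∣w (inject a) b)) , λ b a →
    S.trans {wedgeₛ α η (inject a) b} {proj₁ (∣w (inject a) b) *ₛ ⌜ α ⌝} {⌜ α ⌝ *ₛ proj₁ (∣w (inject a) b)}
      (proj₂ (∣w (inject a) b)) (S.*-comm (proj₁ (∣w (inject a) b)) ⌜ α ⌝)

  private
    coeff-spanned : ∀ u v A B ν → lookup ν u ≡ 0 → lookup ν v ≡ 0 → coeff (x u *ₛ A +ₛ x v *ₛ B) ν K.≈ K.0#
    coeff-spanned u v A B ν νu≡0 νv≡0 = K.trans (coeff-++ (x u *ₛ A) (x v *ₛ B) ν)
      (K.trans (K.+-cong (coeff-x*-0 u A ν νu≡0) (coeff-x*-0 v B ν νv≡0)) (K.+-identityˡ K.0#))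

  -- After reflection the coefficient of `r` vanishes at every monomial outside one of the ideals
  -- (x_u , x_v). Reflecting back sends each remaining monomial to a residue, and reflecting twice
  -- recovers `r` modulo x_i - x_j.
  spanned⇒residue : ∀ {L} → All EdgeForm L → Complete L → ∀ r →
    (∀ {u v} → Common u → Common v → u ≢ v → ¬ Adj u v → SpannedBy (x u -ₛ x i) (x v -ₛ x i)
      (x i -ₛ x j) r) →
    IsResidueOf L r
  spanned⇒residue {L} forms complete r spanned =
    residue-~ {L} {r} {subst reflect (subst reflect r)} (reflect-involutive r)
      (subst-∈ reflect {P = λ ν → ¬ MissingNonEdge (lookup ν)} (residue-isIdeal L)
        (λ ν → ¬? (missingNonEdge? (lookup ν)))
        (λ ν → power-residue (lookup ν) {L} forms complete) (subst reflect r) vanishing)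
    where
    at-nonEdge : ∀ ν → MissingNonEdge (lookup ν) → coeff (subst reflect r) ν K.≈ K.0#
    at-nonEdge ν (u , v , (Wu , νu≡0) , (Wv , νv≡0) , u≢v , ¬uv) = conclude
      (reflect-spanned {u} {v} {r} Wu Wv (spanned Wu Wv u≢v ¬uv))
      where
      conclude : (∃₂ λ A B → subst reflect r ≋ x u *ₛ A +ₛ x v *ₛ B) → coeff (subst reflect r) ν K.≈ K.0#
      conclude (A , B , eq) = K.trans (eq ν) (coeff-spanned u v A B ν νu≡0 νv≡0)

    vanishing : ∀ ν → ¬ ¬ MissingNonEdge (lookup ν) → coeff (subst reflect r) ν K.≈ K.0#
    vanishing ν ¬¬nonEdge = at-nonEdge ν (decidable-stable (missingNonEdge? (lookup ν)) ¬¬nonEdge)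

  module _ (ρ : ResidueData (graphic G) (i , j , ij)) where
    open ResidueData ρ
    open LogarithmicForm
    private
      open DefiningForms definingForms using () renaming (sound to 𝓐-sound; complete to 𝓐-complete)

      αᴴ-multiple : ∃ λ s → IsMultiple αᴴ i j s
      αᴴ-multiple = edge-form ij {αᴴ} ((λ {v} w → _ , proj₁ αᴴ-defines {v} w) ,
        (λ {v} w → proj₂ αᴴ-defines {v} (proj₂ w)))

      form∣ : ∀ {f} → (x i -ₛ x j) ∣ f → ⌜ αᴴ ⌝ ∣ f
      form∣ {f} = difference∣⇒form∣ {α = αᴴ} (adjacent-distinct G ij) (proj₂ αᴴ-multiple) {f}

      difference∣ : ∀ {f} → ⌜ αᴴ ⌝ ∣ f → (x i -ₛ x j) ∣ f
      difference∣ {f} = form∣⇒difference∣ {α = αᴴ} (adjacent-distinct G ij) (proj₂ αᴴ-multiple) {f}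

      Lᴴ : List S
      Lᴴ = L restricted

      log-at-edges : (ω : LogarithmicForm definingForms) → ∀ {p q} → Adj p q → Logarithmic p q (Qω ω)
      log-at-edges ω {p} {q} pq = at-form (All.lookupAny (logarithmic ω) (𝓐-complete (p , q , pq)))
        where
        at-form : ∀ {α} → ((Qω ω ∧ d α) ∈ ⌜ α ⌝ Ω²) × (graphic G (p , q , pq) ≐ U ∩ Ker α) → Logarithmic p q
          (Qω ω)
        at-form {α} (∈Ω² , eq) = wedge⇒logarithmic (adjacent-distinct G pq) (proj₂ (edge-form pq {α} eq))
          (Qω ω)
          (∈Ω²⇒∣wedge {α} {Qω ω} ∈Ω²)

      logarithmicForm : ∀ η → (∀ {p q} → Adj p q → Logarithmic p q η) → LogarithmicForm definingForms
      logarithmicForm η log = record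
        { ω = record { numerator = η }
        ; logarithmic = All.map (λ {α} → at-form {α}) 𝓐-sound }
        where
        at-form : ∀ {α} → (∃ λ k → graphic G k ≐ U ∩ Ker α) → (η ∧ d α) ∈ ⌜ α ⌝ Ω²
        at-form {α} ((p , q , pq) , eq) = ∣wedge⇒∈Ω² {α} {η}
          (logarithmic⇒wedge (adjacent-distinct G pq) (proj₂ (edge-form pq {α} eq)) η (log pq))

    private
      spanned⇒member : ∀ u v r → SpannedBy (x u -ₛ x i) (x v -ₛ x i) (x i -ₛ x j) r →
                       ⟨ x u -ₛ x i , x v -ₛ x i ⟩[mod αᴴ ] r
      spanned⇒member u v r (s , t , ∣r) = s , t , form∣ {r -ₛ (s *ₛ (x u -ₛ x i) +ₛ t *ₛ (x v -ₛ x i))} ∣r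

      member⇒spanned : ∀ u v r → ⟨ x u -ₛ x i , x v -ₛ x i ⟩[mod αᴴ ] r →
                       SpannedBy (x u -ₛ x i) (x v -ₛ x i) (x i -ₛ x j) r
      member⇒spanned u v r (s , t , ∣r) = s , t , difference∣
        {r -ₛ (s *ₛ (x u -ₛ x i) +ₛ t *ₛ (x v -ₛ x i))} ∣r

    residueIdeal⊆ : ∀ {r} → residueIdeal r → ∀ {u v} → W G i j u → W G i j v → u ≢ v → ¬ Adj u v →
                    ⟨ x u -ₛ x i , x v -ₛ x i ⟩[mod αᴴ ] r
    residueIdeal⊆ {r} (ω , g , Qω≋ , Qᴴr≋g₀) {u} {v} Wu Wv u≢v ¬uv = spanned⇒member u v r
      (residue-spanned {Qω ω} (log-at-edges ω) Wu Wv u≢v ¬uv {Lᴴ}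
        (L-edges restricted) (L-distinct restricted) (L-complete restricted) {r}
        (residue⇒ isBasis (proj₂ αᴴ-multiple) Lᴴ {Qω ω} {g} {r} (log-at-edges ω ij) Qω≋ Qᴴr≋g₀))

    ⊆residueIdeal : ∀ {r} → (∀ {u v} → W G i j u → W G i j v → u ≢ v → ¬ Adj u v →
                    ⟨ x u -ₛ x i , x v -ₛ x i ⟩[mod αᴴ ] r) → residueIdeal r
    ⊆residueIdeal {r} r∈ = conclude (residue⇐ isBasis (proj₂ αᴴ-multiple) Lᴴ {r}
      (spanned⇒residue {Lᴴ} (L-edges restricted) (L-complete restricted) r
        (λ {u} {v} Wu Wv u≢v ¬uv → member⇒spanned u v r (r∈ Wu Wv u≢v ¬uv))))
      where
      conclude : (∃ λ η → (∀ {p q} → Adj p q → Logarithmic p q η) × ∃ λ (g : Vector S (suc m)) →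
                   (∀ k → η k ≋ sumₛ (λ t → g t *ₛ const ((αᴴ Vector.∷ αs) t k))) ×
                   ⌜ αᴴ ⌝ ∣ (product Lᴴ *ₛ r -ₛ g zero)) → residueIdeal r
      conclude (η , log , g , η≋ , ∣residue) = logarithmicForm η log , g , η≋ , ∣residue

theorem1p3 : ∀ {c e : Level} (K : Field c e) {ℓ : ℕ} (G : SimpleGraph ℓ) →
    let open SimpleGraph G
        open Arrangements K ℓ
    in
    (i j : Fin ℓ) (ij : Adj i j) (ρ : ResidueData (graphic G) (i , j , ij)) →
    let open ResidueData ρ
        y : Fin ℓ → S
        y k = x k -ₛ x i
    in
    residueIdeal ≐
      ⋂ (NonEdgeInW G i j) (λ (u , v , _) → ⟨ y u , y v ⟩[mod αᴴ ])
theorem1p3 K G i j ij ρ =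
    (λ {r} r∈ (u , v , Wu , Wv , u≢v , ¬uv) → residueIdeal⊆ ρ {r} r∈ {u} {v} Wu Wv u≢v ¬uv)
  , (λ {r} r∈ → ⊆residueIdeal ρ {r} (λ {u} {v} Wu Wv u≢v ¬uv → r∈ (u , v , Wu , Wv , u≢v , ¬uv)))
  where open GraphicResidue K G ij
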